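{- Let $q'$ be a prime power and $q=(q')^{4}$. Then for every odd codimension $r=2t+1\geq 3$ there exists a linear $[n_r,n_r-r]_q$ code $\mathcal{C}_r$ with covering radius $2$ and length $$n_r=\left(2+\frac{2}{\sqrt[4]{q}}+\frac{2}{\sqrt{q}}\right)q^{\frac{r-2}{2}}+\left\lfloor q^{\frac{r-5}{2}}\right\rfloor,$$ and the family satisfies $$\liminf_{r\to\infty}\frac{V_q(n_r,2)}{q^{r}}<2+\frac{4}{\sqrt[4]{q}}+\frac{6}{\sqrt{q}}+\frac{4}{\sqrt[4]{q^{3}}}-\frac{2}{q}-\frac{8}{q\sqrt[4]{q}}.$$
   Context: For a prime power $q$, an $[n,n-r]_q$ code is a linear subspace of $F_q^n$ of dimension $n-r$; it has covering radius $R$ if every column of $F_q^{r}$ is a linear combination of at most $R$ columns of a parity-check matrix, and $R$ is the smallest such integer. $V_q(n,R)=\sum_{i=0}^{R}(q-1)^i\binom{n}{i}$; $V_q(n,R)/q^r$ is the covering density of an $[n,n-r]_qR$ code. -}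

module Defs where

open import Level using (Level; 0ℓ) renaming (suc to lsuc; _⊔_ to _⊔ˡ_)
open import Function using (_∘_)
open import Data.Nat as ℕ using (ℕ; zero; suc; _≤_; _<_; _^_; _∸_)
open import Data.Nat.Primality using (Prime)
open import Data.Nat.Combinatorics using (_C_)
open import Data.Fin using (Fin)
open import Data.Product using (Σ; ∃; ∃₂; _×_; _,_)
open import Relation.Nullary using (¬_)
open import Relation.Binary.PropositionalEquality using (_≡_)
open import Algebra.Bundles using (CommutativeRing)
open import Data.Integer using (+_)
import Data.Rational as ℚ
open ℚ using (ℚ)

IsPrimePower : ℕ → Set
IsPrimePower q = ∃₂ λ p k → Prime p × 1 ≤ k × q ≡ p ^ k

record Field (c ℓ : Level) : Set (lsuc (c ⊔ˡ ℓ)) where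
  field
    commutativeRing : CommutativeRing c ℓ
  open CommutativeRing commutativeRing public
  field
    0≉1     : ¬ (0# ≈ 1#)
    inverse : ∀ x → ¬ (x ≈ 0#) → ∃ λ y → (x * y) ≈ 1#

HasCard : ∀ {c ℓ} → Field c ℓ → ℕ → Set (c ⊔ˡ ℓ)
HasCard F q = Σ (Fin q → Carrier) λ e →
                 (∀ x → ∃ λ i → e i ≈ x) × (∀ i j → e i ≈ e j → i ≡ j)
  where open Field F

module Codes {c ℓ} (F : Field c ℓ) where
  open Field F

  ∑ : (m : ℕ) → (Fin m → Carrier) → Carrier
  ∑ zero    f = 0#
  ∑ (suc m) f = f Fin.zero + ∑ m (f ∘ Fin.suc)
    where import Data.Fin as Fin

  Matrix : ℕ → ℕ → Set c
  Matrix r n = Fin r → Fin n → Carrier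

  FullRowRank : ∀ {r n} → Matrix r n → Set (c ⊔ˡ ℓ)
  FullRowRank {r} {n} H =
    ∀ (a : Fin r → Carrier) → (∀ j → ∑ r (λ i → a i * H i j) ≈ 0#) → ∀ i → a i ≈ 0#

  LinCombAtMost : ∀ {r n} → Matrix r n → ℕ → (Fin r → Carrier) → Set (c ⊔ˡ ℓ)
  LinCombAtMost {r} {n} H R s =
    ∃ λ m → m ≤ R × Σ (Fin m → Fin n) λ js → Σ (Fin m → Carrier) λ a →
      ∀ i → s i ≈ ∑ m (λ k → a k * H i (js k))

  CoversWithin : ∀ {r n} → Matrix r n → ℕ → Set (c ⊔ˡ ℓ)
  CoversWithin {r} H R = ∀ (s : Fin r → Carrier) → LinCombAtMost H R s

  HasCoveringRadius : ∀ {r n} → Matrix r n → ℕ → Set (c ⊔ˡ ℓ)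
  HasCoveringRadius H R = CoversWithin H R × (∀ R′ → R′ < R → ¬ CoversWithin H R′)

  -- an [n, n-r]_q code with covering radius R (given by a parity-check matrix
  -- H of rank r; the code is the kernel of H)
  CodeWithCoveringRadius : (n r R : ℕ) → Set (c ⊔ˡ ℓ)
  CodeWithCoveringRadius n r R =
    Σ (Matrix r n) λ H → FullRowRank H × HasCoveringRadius H R

V : ℕ → ℕ → ℕ → ℕ
V q n zero    = 1
V q n (suc R) = V q n R ℕ.+ (q ∸ 1) ^ suc R ℕ.* (n C suc R)

-- a / b as a rational (total: value 0 when b = 0, never used here)
_÷ℕ_ : ℕ → ℕ → ℚ
a ÷ℕ zero  = ℚ.0ℚ
a ÷ℕ suc b = (+ a) ℚ./ suc b

-- ⌊ q^{(r-5)/2} ⌋ for r = 2t+1, q = q'^4:  = q'^{4(t-2)} if t ≥ 2, and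
-- ⌊ q^{-1} ⌋ = 0 if t = 1 (q ≥ 2).
floorTerm : ℕ → ℕ → ℕ
floorTerm q′ zero          = 0
floorTerm q′ (suc zero)    = 0
floorTerm q′ (suc (suc k)) = q′ ^ (4 ℕ.* k)

-- n_r for r = 2t+1, q = q'^4 (so ⁴√q = q', √q = q'^2):
-- (2 + 2/q' + 2/q'^2) q^{(r-2)/2} = (2 + 2/q' + 2/q'^2) q'^{4t-2}
--   = 2 q'^{4t-2} + 2 q'^{4t-3} + 2 q'^{4t-4}      (t ≥ 1)
lengthN : ℕ → ℕ → ℕ
lengthN q′ t = 2 ℕ.* q′ ^ (4 ℕ.* t ∸ 2) ℕ.+ 2 ℕ.* q′ ^ (4 ℕ.* t ∸ 3)
               ℕ.+ 2 ℕ.* q′ ^ (4 ℕ.* t ∸ 4) ℕ.+ floorTerm q′ t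

density : ℕ → ℕ → ℚ
density q′ t = V (q′ ^ 4) (lengthN q′ t) 2 ÷ℕ ((q′ ^ 4) ^ (2 ℕ.* t ℕ.+ 1))

densityBound : ℕ → ℚ
densityBound q′ =
  (((((+ 2) ℚ./ 1 ℚ.+ 4 ÷ℕ q′) ℚ.+ 6 ÷ℕ (q′ ^ 2)) ℚ.+ 4 ÷ℕ (q′ ^ 3))
     ℚ.- 2 ÷ℕ (q′ ^ 4)) ℚ.- 8 ÷ℕ (q′ ^ 5)

-- liminf_{t → ∞} a t < b   (a indexed by t ≥ 1), unfolded:
-- there is c < b with a t ≤ c for infinitely many t.
LiminfBelow : (ℕ → ℚ) → ℚ → Set
LiminfBelow a b = ∃ λ c → c ℚ.< b × (∀ N → ∃ λ t → N ≤ t × 1 ≤ t × a t ℚ.≤ c)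

-- Write x for q′ and let L ⊂ E ⊂ K be the fields with x, x², x⁴ elements, E = L + τ L. In PG(2, E) the Baer
-- subplane B₁ = PG(2, L) and its image B₂ under M = 1 + τ Ω are disjoint, where Ω is the companion matrix of
-- a cubic t³ − t − γ irreducible over E. Every point of PG(2, K) lies on a line defined over E, which meets
-- both subplanes, so every non-zero s ∈ K³ is a h + b h′ with h ∈ B₁, h′ ∈ B₂ and a, b ≠ 0.
--
-- In codimension 3 + 2m the syndromes are (s, (uᵢ, vᵢ)ᵢ) with m pairs. Over h ∈ B₁ take the columns
-- (h, (0, ξᵢ)ᵢ), over M w ∈ B₂ the columns (M w, (η₀, ε η₀²), (ηᵢ, η₀ ηᵢ)ᵢ), with ξ, η ∈ Kᵐ and ε ∈ {0, 1} the
-- leading coordinate of w. A syndrome with s ≠ 0 is a combination of one column of either kind: the uᵢ determine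
-- η, then the vᵢ determine ξ. If s = 0 and u₀ ≠ 0, take the difference of two columns over the same M w with
-- η₀ ≠ 0 and η₀′ = 0; the remaining (uᵢ, vᵢ) are then regular linear equations for (ηᵢ, ηᵢ′). The syndromes
-- with s = 0 and u₀ = 0 form a space of dimension 2m − 1, covered recursively by at most qᵐ⁻¹ further columns.
--
-- For t ≥ 2 the length is q^(t−2) (2 (x² + x + 1) q + 1), so (q − 1)² n² / 2 q^(2t+1) does not depend on t; it
-- bounds the density from above and is smaller than the given bound.

module Submission where

open import Defs
open import Level using (0ℓ)
open import Algebra.Bundles using (CommutativeRing)
open import Algebra.Structures using (IsCommutativeRing)
open import Algebra.Morphism.Structures using (IsRingMonomorphism)
import Algebra.Morphism.RingMonomorphism as RingMonomorphism
open import Data.Bool using (T)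
open import Data.Fin as Fin using (Fin; zero; suc; fromℕ; inject₁; punchOut; combine; remQuot)
open import Data.Fin.Permutation using (Permutation; permutation)
import Data.Fin.Properties as Fin
open import Data.Integer as ℤ using (ℤ; -[1+_]; _⊖_) renaming (+_ to pos)
import Data.Integer.Properties as ℤ
import Data.Integer.Solver
open import Data.List as List using (List)
open import Data.List.Membership.Propositional using (_∈_)
open import Data.List.Membership.Propositional.Properties using (∈-map⁺; ∈-allFin; ∈-++⁺ˡ; ∈-++⁺ʳ; ∈-cartesianProductWith⁺)
import Data.List.Properties as List
open import Data.List.Relation.Unary.Any using (here; there)
open import Data.Maybe using (nothing)
open import Data.Nat as ℕ using (ℕ; zero; suc; _≤_; _<_; z≤n; s≤s; s<s⁻¹; NonZero)
open import Data.Nat.Combinatorics using (_C_; nC1≡n; nCn≡1; nCk+nC[k+1]≡[n+1]C[k+1])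
open import Data.Nat.Divisibility using (_∣_; divides; ∣⇒≤)
open import Data.Nat.Primality using (Prime; euclidsLemma; prime⇒nonTrivial; prime⇒nonZero)
import Data.Nat.Properties as ℕ
import Data.Nat.Solver
open import Data.Product using (∃; Σ; _×_; _,_; proj₁; proj₂; uncurry)
import Data.Rational as ℚ
import Data.Rational.Properties as ℚ
open import Data.Rational.Unnormalised as ℚᵘ using (mkℚᵘ; *≤*; *<*; *≡*)
import Data.Rational.Unnormalised.Properties as ℚᵘ
open import Data.Sum using (_⊎_; inj₁; inj₂)
open import Data.Unit using (⊤; tt)
open import Data.Vec as Vec using (Vec; []; _∷_)
open import Data.Vec.Properties using (≡-dec; ∷-injective)
import Data.Vec.Properties as Vec
open import Data.Vec.Relation.Unary.All as All using (All; []; _∷_)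
open import Function using (_∘_)
open import Function.Definitions using (Injective)
open import Relation.Binary.PropositionalEquality as ≡ using (_≡_; _≢_; refl; cong; cong₂; subst; subst₂)
open import Relation.Nullary using (¬_; Dec; yes; no; does; contradiction)
open import Relation.Unary using (Pred; Decidable; _⊆_)
open import Tactic.RingSolver.Core.AlmostCommutativeRing using (fromCommutativeRing)
open import Tactic.RingSolver.Core.Expression as Expression using (Expr; Κ; Ι; _⊕_; _⊗_; ⊝_; _⊛_)
open import Tactic.RingSolver.Core.Polynomial.Parameters using (Homomorphism)

-- The line over E through s comes from s = s₁ + θ s₂ with s₁, s₂ over E: some form f over E
-- vanishes on both. Writing f = f₁ + τ f₂ over L leaves two equations in three unknowns over L,
-- hence a point of B₁; the pullback of f under M gives in the same way the point of B₂.
-- Disjointness of B₁ and B₂ excludes eigenvalues of Ω in L, but injectivity of M involves -1 / τ,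
-- so the cubic must have no root in E. The requirement a, b ≠ 0 shapes the geometry, because η and
-- ξ are found by dividing by b and a. Even a point of one subplane therefore needs a representation
-- that uses both. Nothing depends on the characteristic: t³ - t vanishes at 0 and at 1 in every
-- field, and a chord from 0 of the parabola has slope η₀ without a factor 2. Origin of the density
-- bound: with P = x² + x + 1 the quantity independent of t is close to (1 - 1/q)² 2P²/q, and the
-- bound is 2P²/q - 4P²/q² expanded in 1/x up to x⁻⁵. The omitted terms, from -12/x⁶ on, outweigh
-- the positive corrections such as 2P/q².

module ℕ+* = Data.Nat.Solver.+-*-Solver

-- A ring solver with integer coefficients

-- Integer coefficients let the solver recognise cancellation in an abstract ring.
module ℤ-Solver {c ℓ} (R : CommutativeRing c ℓ) where
  open CommutativeRing R renaming (refl to ≈-refl)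
  open import Algebra.Properties.Monoid.Mult.TCOptimised +-monoid using (×-homo-+; 1+×) renaming (_×_ to _×′_)
  open import Algebra.Properties.Semiring.Mult.TCOptimised semiring using (×1-homo-*)
  open import Algebra.Properties.Ring ring using (-‿distribˡ-*; -‿distribʳ-*; -0#≈0#; -‿involutive; -‿+-comm)
  open import Relation.Binary.Reasoning.Setoid setoid

  ⟦_⟧ℤ : ℤ → Carrier
  ⟦ pos n ⟧ℤ    = n ×′ 1#
  ⟦ -[1+ n ] ⟧ℤ = - (suc n ×′ 1#)

  ⟦⊖⟧ : ∀ m n → ⟦ m ⊖ n ⟧ℤ ≈ m ×′ 1# + - (n ×′ 1#)
  ⟦⊖⟧ m zero = sym (trans (+-congˡ -0#≈0#) (+-identityʳ _))
  ⟦⊖⟧ zero (suc n) = sym (+-identityˡ _)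
  ⟦⊖⟧ (suc m) (suc n) = begin
    ⟦ suc m ⊖ suc n ⟧ℤ                                ≡⟨ ≡.cong ⟦_⟧ℤ (ℤ.[1+m]⊖[1+n]≡m⊖n m n) ⟩
    ⟦ m ⊖ n ⟧ℤ                                        ≈⟨ ⟦⊖⟧ m n ⟩
    m ×′ 1# + - (n ×′ 1#)                             ≈⟨ +-congʳ (sym (+-identityˡ _)) ⟩
    0# + m ×′ 1# + - (n ×′ 1#)                        ≈⟨ +-congʳ (+-congʳ (sym (-‿inverseʳ 1#))) ⟩
    1# + - 1# + m ×′ 1# + - (n ×′ 1#)                 ≈⟨ +-congʳ (trans (+-assoc _ _ _) (trans (+-congˡ (+-comm _ _)) (sym (+-assoc _ _ _)))) ⟩
    1# + m ×′ 1# + - 1# + - (n ×′ 1#)                 ≈⟨ +-assoc _ _ _ ⟩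
    1# + m ×′ 1# + (- 1# + - (n ×′ 1#))               ≈⟨ +-cong (sym (1+× m 1#)) (trans (-‿+-comm _ _) (-‿cong (sym (1+× n 1#)))) ⟩
    suc m ×′ 1# + - (suc n ×′ 1#)                     ∎

  ⟦+⟧ : ∀ i j → ⟦ i ℤ.+ j ⟧ℤ ≈ ⟦ i ⟧ℤ + ⟦ j ⟧ℤ
  ⟦+⟧ (pos m) (pos n)       = ×-homo-+ 1# m n
  ⟦+⟧ (pos m) -[1+ n ]      = ⟦⊖⟧ m (suc n)
  ⟦+⟧ -[1+ m ] (pos n)      = trans (⟦⊖⟧ n (suc m)) (+-comm _ _)
  ⟦+⟧ -[1+ m ] -[1+ n ]     = begin
    - (suc (suc (m ℕ.+ n)) ×′ 1#)          ≡⟨ ≡.cong (λ k → - (suc k ×′ 1#)) (≡.sym (ℕ.+-suc m n)) ⟩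
    - ((suc m ℕ.+ suc n) ×′ 1#)            ≈⟨ -‿cong (×-homo-+ 1# (suc m) (suc n)) ⟩
    - (suc m ×′ 1# + suc n ×′ 1#)          ≈⟨ -‿+-comm _ _ ⟨
    - (suc m ×′ 1#) + - (suc n ×′ 1#)      ∎

  ⟦-⟧ : ∀ i → ⟦ ℤ.- i ⟧ℤ ≈ - ⟦ i ⟧ℤ
  ⟦-⟧ (pos zero)    = sym -0#≈0#
  ⟦-⟧ (pos (suc n)) = ≈-refl
  ⟦-⟧ -[1+ n ]      = sym (-‿involutive _)

  ⟦pos*⟧ : ∀ m j → ⟦ pos m ℤ.* j ⟧ℤ ≈ m ×′ 1# * ⟦ j ⟧ℤ
  ⟦pos*⟧ m (pos n) = begin
    ⟦ pos m ℤ.* pos n ⟧ℤ ≡⟨ ≡.cong ⟦_⟧ℤ (≡.sym (ℤ.pos-* m n)) ⟩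
    (m ℕ.* n) ×′ 1#      ≈⟨ ×1-homo-* m n ⟩
    m ×′ 1# * n ×′ 1#    ∎
  ⟦pos*⟧ m -[1+ n ] = begin
    ⟦ pos m ℤ.* -[1+ n ] ⟧ℤ            ≡⟨ ≡.cong ⟦_⟧ℤ (≡.sym (ℤ.neg-distribʳ-* (pos m) (pos (suc n)))) ⟩
    ⟦ ℤ.- (pos m ℤ.* pos (suc n)) ⟧ℤ   ≈⟨ ⟦-⟧ (pos m ℤ.* pos (suc n)) ⟩
    - ⟦ pos m ℤ.* pos (suc n) ⟧ℤ       ≈⟨ -‿cong (⟦pos*⟧ m (pos (suc n))) ⟩
    - (m ×′ 1# * suc n ×′ 1#)          ≈⟨ -‿distribʳ-* _ _ ⟩
    m ×′ 1# * - (suc n ×′ 1#)          ∎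

  ⟦*⟧ : ∀ i j → ⟦ i ℤ.* j ⟧ℤ ≈ ⟦ i ⟧ℤ * ⟦ j ⟧ℤ
  ⟦*⟧ (pos m)  j = ⟦pos*⟧ m j
  ⟦*⟧ -[1+ m ] j = begin
    ⟦ -[1+ m ] ℤ.* j ⟧ℤ                ≡⟨ ≡.cong ⟦_⟧ℤ (≡.sym (ℤ.neg-distribˡ-* (pos (suc m)) j)) ⟩
    ⟦ ℤ.- (pos (suc m) ℤ.* j) ⟧ℤ       ≈⟨ ⟦-⟧ (pos (suc m) ℤ.* j) ⟩
    - ⟦ pos (suc m) ℤ.* j ⟧ℤ           ≈⟨ -‿cong (⟦pos*⟧ (suc m) j) ⟩
    - (suc m ×′ 1# * ⟦ j ⟧ℤ)           ≈⟨ -‿distribˡ-* _ _ ⟩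
    - (suc m ×′ 1#) * ⟦ j ⟧ℤ           ∎

  homomorphism : Homomorphism 0ℓ 0ℓ c ℓ
  homomorphism = record
    { from = record { rawRing = ℤ.+-*-rawRing ; isZero = λ i → does (i ℤ.≟ ℤ.0ℤ) }
    ; to = fromCommutativeRing R (λ _ → nothing)
    ; morphism = record
      { ⟦_⟧ = ⟦_⟧ℤ ; +-homo = ⟦+⟧ ; *-homo = ⟦*⟧ ; -‿homo = ⟦-⟧ ; 0-homo = ≈-refl ; 1-homo = ≈-refl }
    ; Zero-C⟶Zero-R = λ i → isZero⇒≈0 i
    }
    where
    isZero⇒≈0 : ∀ i → T (does (i ℤ.≟ ℤ.0ℤ)) → 0# ≈ ⟦ i ⟧ℤ
    isZero⇒≈0 (pos zero) _ = ≈-refl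

  open Expression.Eval rawRing ⟦_⟧ℤ using (⟦_⟧)
  open import Tactic.RingSolver.Core.Polynomial.Base (Homomorphism.from homomorphism)
  open import Tactic.RingSolver.Core.Polynomial.Semantics homomorphism using () renaming (⟦_⟧ to ⟦_⟧ₚ)
  open import Tactic.RingSolver.Core.Polynomial.Homomorphism homomorphism
  open import Algebra.Properties.Semiring.Exp.TCOptimised semiring using (^-congˡ)

  norm : ∀ {n} → Expr ℤ n → Poly n
  norm (Κ x)   = κ x
  norm (Ι x)   = ι x
  norm (x ⊕ y) = norm x ⊞ norm y
  norm (x ⊗ y) = norm x ⊠ norm y
  norm (⊝ x)   = ⊟ norm x
  norm (x ⊛ i) = norm x ⊡ i

  ⟦norm⟧ : ∀ {n} (e : Expr ℤ n) ρ → ⟦ norm e ⟧ₚ ρ ≈ ⟦ e ⟧ ρ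
  ⟦norm⟧ (Κ x)   ρ = κ-hom x ρ
  ⟦norm⟧ (Ι x)   ρ = ι-hom x ρ
  ⟦norm⟧ (x ⊕ y) ρ = trans (⊞-hom (norm x) (norm y) ρ) (+-cong (⟦norm⟧ x ρ) (⟦norm⟧ y ρ))
  ⟦norm⟧ (x ⊗ y) ρ = trans (⊠-hom (norm x) (norm y) ρ) (*-cong (⟦norm⟧ x ρ) (⟦norm⟧ y ρ))
  ⟦norm⟧ (⊝ x)   ρ = trans (⊟-hom (norm x) ρ) (-‿cong (⟦norm⟧ x ρ))
  ⟦norm⟧ (x ⊛ i) ρ = trans (⊡-hom (norm x) i ρ) (^-congˡ i (⟦norm⟧ x ρ))

  open import Relation.Binary.Reflection setoid Ι ⟦_⟧ (λ e → ⟦ norm e ⟧ₚ) ⟦norm⟧ public using (solve)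

  infix  4 _:=_
  infixl 6 _:+_ _:-_
  infixl 7 _:*_
  infix  8 :-_
  con : ∀ {n} → ℤ → Expr ℤ n
  con = Κ
  _:+_ _:*_ _:-_ : ∀ {n} → Expr ℤ n → Expr ℤ n → Expr ℤ n
  _:+_ = _⊕_
  _:*_ = _⊗_
  x :- y = x ⊕ ⊝ y
  :-_ : ∀ {n} → Expr ℤ n → Expr ℤ n
  :-_ = ⊝_
  _:=_ : ∀ {n} → Expr ℤ n → Expr ℤ n → Expr ℤ n × Expr ℤ n
  _:=_ = _,_

-- Binomial coefficients and the Frobenius map

absorption : ∀ n k → suc k ℕ.* (suc n C suc k) ≡ suc n ℕ.* (n C k)
absorption zero    zero    = ≡.refl
absorption zero    (suc k) = ℕ.*-zeroʳ (suc (suc k))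
absorption (suc n) zero    = ≡.trans (ℕ.*-identityˡ _) (≡.trans (nC1≡n (suc (suc n))) (≡.sym (ℕ.*-identityʳ _)))
absorption (suc n) (suc k) = begin
  suc (suc k) ℕ.* (suc (suc n) C suc (suc k))                             ≡⟨ ≡.cong (suc (suc k) ℕ.*_) (≡.sym (nCk+nC[k+1]≡[n+1]C[k+1] (suc n) (suc k))) ⟩
  suc (suc k) ℕ.* ((suc n C suc k) ℕ.+ (suc n C suc (suc k)))             ≡⟨ ℕ.*-distribˡ-+ (suc (suc k)) (suc n C suc k) _ ⟩
  (suc n C suc k) ℕ.+ suc k ℕ.* (suc n C suc k) ℕ.+ suc (suc k) ℕ.* (suc n C suc (suc k)) ≡⟨ ≡.cong₂ (λ u v → (suc n C suc k) ℕ.+ u ℕ.+ v) (absorption n k) (absorption n (suc k)) ⟩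
  (suc n C suc k) ℕ.+ suc n ℕ.* (n C k) ℕ.+ suc n ℕ.* (n C suc k)         ≡⟨ ℕ.+-assoc (suc n C suc k) _ _ ⟩
  (suc n C suc k) ℕ.+ (suc n ℕ.* (n C k) ℕ.+ suc n ℕ.* (n C suc k))       ≡⟨ ≡.cong ((suc n C suc k) ℕ.+_) (≡.sym (ℕ.*-distribˡ-+ (suc n) (n C k) _)) ⟩
  (suc n C suc k) ℕ.+ suc n ℕ.* ((n C k) ℕ.+ (n C suc k))                 ≡⟨ ≡.cong (λ u → (suc n C suc k) ℕ.+ suc n ℕ.* u) (nCk+nC[k+1]≡[n+1]C[k+1] n k) ⟩
  suc (suc n) ℕ.* (suc n C suc k)                                         ∎
  where open ≡.≡-Reasoning

-- By absorption p divides k · C(p, k), and it cannot divide k since 0 < k < p.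
prime∣pCk : ∀ {p k} → Prime p → 0 < k → k < p → p ∣ (p C k)
prime∣pCk {suc n} {suc k} pr _ k<p
  with euclidsLemma (suc k) (suc n C suc k) pr (divides (n C k) (≡.trans (absorption n k) (ℕ.*-comm (suc n) _)))
... | inj₁ p∣k = contradiction (∣⇒≤ p∣k) (ℕ.<⇒≱ k<p)
... | inj₂ p∣C = p∣C

module Frobenius {c ℓ} (R : CommutativeRing c ℓ) where
  open CommutativeRing R hiding (zero; refl)
  open import Algebra.Properties.Semiring.Mult semiring using (×-congʳ; ×1-homo-*; ×-homo-1; ×-assoc-*) renaming (_×_ to _·_)
  open import Algebra.Properties.Semiring.Exp semiring using (_^_; ^-congˡ; ^-assocʳ)
  open import Algebra.Properties.CommutativeMonoid.Sum +-commutativeMonoid using (sum; sum-init-last; sum-cong-≋; sum-replicate-zero)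
  open import Algebra.Properties.CommutativeSemiring.Binomial commutativeSemiring using (theorem; binomialTerm)
  open import Relation.Binary.Reasoning.Setoid setoid

  module _ {p} (pr : Prime p) (p·1≈0 : p · 1# ≈ 0#) where

    p∣n⇒n·x≈0 : ∀ {n} x → p ∣ n → n · x ≈ 0#
    p∣n⇒n·x≈0 {n} x (divides k refl) = begin
      (k ℕ.* p) · x                 ≈⟨ ×-congʳ (k ℕ.* p) (*-identityˡ x) ⟨
      (k ℕ.* p) · (1# * x)          ≈⟨ ×-assoc-* (k ℕ.* p) 1# x ⟨
      (k ℕ.* p) · 1# * x            ≈⟨ *-congʳ (×1-homo-* k p) ⟩
      (k · 1# * p · 1#) * x         ≈⟨ *-congʳ (trans (*-congˡ p·1≈0) (zeroʳ _)) ⟩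
      0# * x                        ≈⟨ zeroˡ x ⟩
      0#                            ∎

    -- In the binomial expansion only the two outer terms survive: all inner coefficients are
    -- multiples of p.
    frobenius-+ : ∀ x y → (x + y) ^ p ≈ x ^ p + y ^ p
    frobenius-+ x y = go p pr refl
      where
      -- The exponent is decoupled from the module parameter p so that it can be matched as a
      -- successor, which is what peels off both end terms of the sum.
      go : ∀ n → Prime n → n ≡ p → (x + y) ^ n ≈ x ^ n + y ^ n
      go zero prn _ = contradiction (prime⇒nonZero prn) λ ()
      go (suc n) prn refl = begin
        (x + y) ^ suc n
          ≈⟨ theorem (suc n) x y ⟩
        term zero + sum (λ i → term (suc i))
          ≈⟨ +-congˡ (sum-init-last (λ i → term (suc i))) ⟩
        term zero + (sum (λ i → term (suc (inject₁ i))) + term (suc (fromℕ n)))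
          ≈⟨ +-cong head (+-cong (trans (sum-cong-≋ middle) (sum-replicate-zero n)) top) ⟩
        y ^ suc n + (0# + x ^ suc n)
          ≈⟨ trans (+-congˡ (+-identityˡ _)) (+-comm _ _) ⟩
        x ^ suc n + y ^ suc n ∎
        where
        term = binomialTerm x y (suc n)
        head : term zero ≈ y ^ suc n
        head = trans (×-homo-1 _) (*-identityˡ _)
        middle : ∀ i → term (suc (inject₁ i)) ≈ 0#
        middle i = p∣n⇒n·x≈0 _ (prime∣pCk prn (s≤s z≤n)
          (s≤s (≡.subst (ℕ._< n) (≡.sym (Fin.toℕ-inject₁ i)) (Fin.toℕ<n i))))
        top : term (suc (fromℕ n)) ≈ x ^ suc n
        top rewrite Fin.toℕ-fromℕ n | nCn≡1 (suc n) | ℕ.n∸n≡0 n = trans (×-homo-1 _) (*-identityʳ _)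

    frobenius^-+ : ∀ k x y → (x + y) ^ (p ℕ.^ k) ≈ x ^ (p ℕ.^ k) + y ^ (p ℕ.^ k)
    frobenius^-+ zero    x y = trans (*-identityʳ _) (+-cong (sym (*-identityʳ _)) (sym (*-identityʳ _)))
    frobenius^-+ (suc k) x y = begin
      (x + y) ^ (p ℕ.* p ℕ.^ k)                  ≈⟨ ^-assocʳ (x + y) p (p ℕ.^ k) ⟨
      ((x + y) ^ p) ^ (p ℕ.^ k)                  ≈⟨ ^-congˡ (p ℕ.^ k) (frobenius-+ x y) ⟩
      (x ^ p + y ^ p) ^ (p ℕ.^ k)                ≈⟨ frobenius^-+ k (x ^ p) (y ^ p) ⟩
      (x ^ p) ^ (p ℕ.^ k) + (y ^ p) ^ (p ℕ.^ k)  ≈⟨ +-cong (^-assocʳ x p _) (^-assocʳ y p _) ⟩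
      x ^ (p ℕ.* p ℕ.^ k) + y ^ (p ℕ.* p ℕ.^ k)  ∎

-- Rank and covering radius of parity-check matrices

module CoveringCodes {c ℓ} (F : Field c ℓ) where
  open Field F hiding (zero; refl)
  open Codes F
  open import Relation.Binary.Reasoning.Setoid setoid
  open import Algebra.Properties.CommutativeMonoid.Sum +-commutativeMonoid using (sum; ∑-comm; sum-cong-≋)

  ∑≡sum : ∀ m f → ∑ m f ≡ sum f
  ∑≡sum zero    f = refl
  ∑≡sum (suc m) f = cong (f zero +_) (∑≡sum m (f ∘ suc))

  ∑-cong : ∀ m {f g} → (∀ i → f i ≈ g i) → ∑ m f ≈ ∑ m g
  ∑-cong zero    f≈g = CommutativeRing.refl commutativeRing
  ∑-cong (suc m) f≈g = +-cong (f≈g zero) (∑-cong m (f≈g ∘ suc))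

  ∑-0 : ∀ m {f} → (∀ i → f i ≈ 0#) → ∑ m f ≈ 0#
  ∑-0 zero    f≈0 = CommutativeRing.refl commutativeRing
  ∑-0 (suc m) f≈0 = trans (+-cong (f≈0 zero) (∑-0 m (f≈0 ∘ suc))) (+-identityˡ 0#)

  δ : ∀ {r} → Fin r → Fin r → Carrier
  δ zero    zero    = 1#
  δ zero    (suc _) = 0#
  δ (suc _) zero    = 0#
  δ (suc i) (suc j) = δ i j

  ∑-δ : ∀ {r} (a : Fin r → Carrier) i → ∑ r (λ j → a j * δ i j) ≈ a i
  ∑-δ {suc r} a zero    = trans (+-cong (*-identityʳ (a zero)) (∑-0 r (λ j → zeroʳ (a (suc j))))) (+-identityʳ (a zero))
  ∑-δ {suc r} a (suc i) = trans (+-cong (zeroʳ (a zero)) (∑-δ (a ∘ suc) i)) (+-identityˡ (a (suc i)))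

  ∑-bilinear : ∀ r m (a : Fin r → Carrier) (c : Fin m → Carrier) (h : Fin r → Fin m → Carrier) →
               ∑ r (λ i → a i * ∑ m (λ k → c k * h i k)) ≈ ∑ m (λ k → c k * ∑ r (λ i → a i * h i k))
  ∑-bilinear r m a c h = begin
    ∑ r (λ i → a i * ∑ m (λ k → c k * h i k))        ≈⟨ ∑-cong r (λ i → *-∑ m (a i) (λ k → c k * h i k)) ⟩
    ∑ r (λ i → ∑ m (λ k → a i * (c k * h i k)))      ≈⟨ ∑-swap (λ i k → a i * (c k * h i k)) ⟩
    ∑ m (λ k → ∑ r (λ i → a i * (c k * h i k)))      ≈⟨ ∑-cong m (λ k → ∑-cong r (λ i → exchange (a i) (c k) (h i k))) ⟩
    ∑ m (λ k → ∑ r (λ i → c k * (a i * h i k)))      ≈⟨ ∑-cong m (λ k → sym (*-∑ r (c k) (λ i → a i * h i k))) ⟩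
    ∑ m (λ k → c k * ∑ r (λ i → a i * h i k))        ∎
    where
    *-∑ : ∀ m x f → x * ∑ m f ≈ ∑ m (λ k → x * f k)
    *-∑ zero    x f = zeroʳ x
    *-∑ (suc m) x f = trans (distribˡ x (f zero) _) (+-congˡ (*-∑ m x (f ∘ suc)))
    exchange : ∀ x y z → x * (y * z) ≈ y * (x * z)
    exchange x y z = trans (sym (*-assoc x y z)) (trans (*-congʳ (*-comm x y)) (*-assoc y x z))
    ∑-swap : ∀ {r m} (f : Fin r → Fin m → Carrier) → ∑ r (λ i → ∑ m (f i)) ≈ ∑ m (λ k → ∑ r (λ i → f i k))
    ∑-swap {r} {m} f = begin
      ∑ r (λ i → ∑ m (f i))             ≈⟨ ∑-cong r (λ i → reflexive (∑≡sum m (f i))) ⟩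
      ∑ r (λ i → sum (f i))             ≡⟨ ∑≡sum r _ ⟩
      sum (λ i → sum (f i))             ≈⟨ ∑-comm f ⟩
      sum (λ k → sum (λ i → f i k))     ≡⟨ ∑≡sum m _ ⟨
      ∑ m (λ k → sum (λ i → f i k))     ≈⟨ ∑-cong m (λ k → reflexive (≡.sym (∑≡sum r _))) ⟩
      ∑ m (λ k → ∑ r (λ i → f i k))     ∎

  -- A functional vanishing on the columns vanishes on everything they span, in particular on the unit vectors.
  covers⇒fullRowRank : ∀ {r n R} {H : Matrix r n} → CoversWithin H R → FullRowRank H
  covers⇒fullRowRank {r} {H = H} covers a aH≈0 i with m , _ , js , c , δ≈ ← covers (δ i) = begin
    a i                                                  ≈⟨ ∑-δ a i ⟨
    ∑ r (λ j → a j * δ i j)                              ≈⟨ ∑-cong r (λ j → *-congˡ (δ≈ j)) ⟩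
    ∑ r (λ j → a j * ∑ m (λ k → c k * H j (js k)))       ≈⟨ ∑-bilinear r m a c (λ j k → H j (js k)) ⟩
    ∑ m (λ k → c k * ∑ r (λ j → a j * H j (js k)))       ≈⟨ ∑-0 m (λ k → trans (*-congˡ (aH≈0 (js k))) (zeroʳ (c k))) ⟩
    0#                                                   ∎

  module _ {q} (card : HasCard F q) where
    private
      e = proj₁ card

    -- A coordinate equal to 1 excludes the empty combination, so R < 2 leaves exactly one column.
    multiple-of-column : ∀ {r n R} {H : Matrix r n} {s : Fin r → Carrier} → R < 2 → {i₀ : Fin r} → s i₀ ≈ 1# → LinCombAtMost H R s →
                         ∃ λ j → ∃ λ c → ∀ i → s i ≈ c * H i j
    multiple-of-column R<2 {i₀} s≈1 (zero , _ , _ , _ , s≈) = contradiction (trans (sym (s≈ i₀)) s≈1) 0≉1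
    multiple-of-column R<2 s≈1 (suc zero , _ , js , c , s≈) = js zero , c zero , λ i → trans (s≈ i) (+-identityʳ _)
    multiple-of-column R<2 s≈1 (suc (suc m) , m≤R , _) = contradiction (ℕ.≤-<-trans m≤R R<2) λ { (s≤s (s≤s ())) }

    -- Both scalars are inverse to the same entry `H i₀ j`, hence equal.
    proportional⇒≈ : ∀ {r n} {H : Matrix r n} {s s′ : Fin r → Carrier} {j i₀} → s i₀ ≈ 1# → s′ i₀ ≈ 1# →
                     (∃ λ c → ∀ i → s i ≈ c * H i j) → (∃ λ c → ∀ i → s′ i ≈ c * H i j) → ∀ i → s i ≈ s′ i
    proportional⇒≈ {H = H} {s} {s′} {j} {i₀} s≈1 s′≈1 (c , s≈) (c′ , s′≈) i = begin
      s i            ≈⟨ s≈ i ⟩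
      c * H i j      ≈⟨ *-congʳ c≈c′ ⟩
      c′ * H i j     ≈⟨ s′≈ i ⟨
      s′ i           ∎
      where
      c≈c′ : c ≈ c′
      c≈c′ = begin
        c                    ≈⟨ *-identityʳ c ⟨
        c * 1#               ≈⟨ *-congˡ (trans (sym s′≈1) (s′≈ i₀)) ⟩
        c * (c′ * H i₀ j)    ≈⟨ trans (*-congˡ (*-comm c′ _)) (sym (*-assoc c _ c′)) ⟩
        c * H i₀ j * c′      ≈⟨ *-congʳ (trans (sym (s≈ i₀)) s≈1) ⟩
        1# * c′              ≈⟨ *-identityˡ c′ ⟩
        c′                   ∎

    funToFin-cong : ∀ {r} {f g : Fin r → Fin q} → (∀ i → f i ≡ g i) → Fin.funToFin f ≡ Fin.funToFin g
    funToFin-cong {zero}  f≗g = refl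
    funToFin-cong {suc r} f≗g = cong₂ Fin.combine (f≗g zero) (funToFin-cong (f≗g ∘ suc))

    finToFun-injective : ∀ {r} {y y′ : Fin (q ℕ.^ r)} → (∀ i → Fin.finToFun {q} {r} y i ≡ Fin.finToFun y′ i) → y ≡ y′
    finToFun-injective {r} {y} {y′} y≗y′ = ≡.trans (≡.sym (Fin.funToFin-finToFin {r} {q} y))
      (≡.trans (funToFin-cong y≗y′) (Fin.funToFin-finToFin {r} {q} y′))

    affineVector : ∀ {r} → Fin (q ℕ.^ r) → Fin (suc r) → Carrier
    affineVector         y zero    = 1#
    affineVector {r = r} y (suc i) = e (Fin.finToFun {q} {r} y i)

    -- Two distinct vectors with first coordinate 1 are not multiples of the same column.
    few-columns⇒¬covers : ∀ {r n R} {H : Matrix (suc r) n} → n < q ℕ.^ r → R < 2 → ¬ CoversWithin H R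
    few-columns⇒¬covers {r} {n} {R} {H} n<qʳ R<2 covers = Fin.<⇒≢ y<y′ (finToFun-injective λ i →
        proj₂ (proj₂ card) _ _ (proportional⇒≈ {H = H} {i₀ = zero} (CommutativeRing.refl commutativeRing) (CommutativeRing.refl commutativeRing) (proj₂ (multiple y))
          (subst (λ j → ∃ λ c → ∀ i → affineVector y′ i ≈ c * H i j) (≡.sym j≡j′) (proj₂ (multiple y′))) (suc i)))
      where
      multiple : ∀ y → ∃ λ j → ∃ λ c → ∀ i → affineVector y i ≈ c * H i j
      multiple y = multiple-of-column {H = H} R<2 {zero} (CommutativeRing.refl commutativeRing) (covers (affineVector y))
      collision = Fin.pigeonhole n<qʳ (λ y → proj₁ (multiple y))
      y y′ : Fin (q ℕ.^ r)
      y = proj₁ collision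
      y′ = proj₁ (proj₂ collision)
      y<y′ : y Fin.< y′
      y<y′ = proj₁ (proj₂ (proj₂ collision))
      j≡j′ : proj₁ (multiple y) ≡ proj₁ (multiple y′)
      j≡j′ = proj₂ (proj₂ (proj₂ collision))

-- Finite fields: characteristic and Fermat's little theorem

open ≡ using (sym; trans; module ≡-Reasoning)

-- The carrier is `Fin q` with propositional equality, so that equality is decidable, search is
-- finite and cardinalities can be compared. `Transport` moves an arbitrary setoid field of q
-- elements here.
record FiniteField (q : ℕ) : Set where
  infixl 7 _*_
  infixl 6 _+_
  infix  8 -_
  infix  4 _≟_
  field
    _+_ _*_           : Fin q → Fin q → Fin q
    -_                : Fin q → Fin q
    0# 1#             : Fin q
    isCommutativeRing : IsCommutativeRing _≡_ _+_ _*_ -_ 0# 1#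
    0≢1               : 0# ≢ 1#
    inverse           : ∀ x → x ≢ 0# → ∃ λ y → x * y ≡ 1#

  commutativeRing : CommutativeRing 0ℓ 0ℓ
  commutativeRing = record { isCommutativeRing = isCommutativeRing }

  open CommutativeRing commutativeRing public
    using (+-assoc; +-comm; +-identityˡ; +-identityʳ; -‿inverseˡ; -‿inverseʳ;
           *-assoc; *-comm; *-identityˡ; *-identityʳ; zeroˡ; zeroʳ;
           semiring; +-commutativeMonoid; *-commutativeMonoid)
  open import Algebra.Properties.Semiring.Exp semiring public using (_^_; ^-assocʳ)
  open import Algebra.Properties.CommutativeSemiring.Exp (CommutativeRing.commutativeSemiring commutativeRing) public using (^-distrib-*)
  open ℤ-Solver commutativeRing public using (solve; con; _:+_; _:*_; _:-_; :-_; _:=_)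

  _≟_ : (x y : Fin q) → Dec (x ≡ y)
  _≟_ = Fin._≟_

  *-cancelˡ : ∀ {x y z} → x ≢ 0# → x * y ≡ x * z → y ≡ z
  *-cancelˡ {x} {y} {z} x≢0 xy≡xz = begin
    y            ≡⟨ *-identityˡ y ⟨
    1# * y       ≡⟨ cong (_* y) x⁻¹x≡1 ⟨
    x⁻¹ * x * y  ≡⟨ *-assoc x⁻¹ x y ⟩
    x⁻¹ * (x * y) ≡⟨ cong (x⁻¹ *_) xy≡xz ⟩
    x⁻¹ * (x * z) ≡⟨ *-assoc x⁻¹ x z ⟨
    x⁻¹ * x * z  ≡⟨ cong (_* z) x⁻¹x≡1 ⟩
    1# * z       ≡⟨ *-identityˡ z ⟩
    z            ∎
    where
    open ≡-Reasoning
    x⁻¹ = proj₁ (inverse x x≢0)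
    x⁻¹x≡1 : x⁻¹ * x ≡ 1#
    x⁻¹x≡1 = trans (*-comm x⁻¹ x) (proj₂ (inverse x x≢0))

  xy≡0⇒y≡0 : ∀ {x y} → x ≢ 0# → x * y ≡ 0# → y ≡ 0#
  xy≡0⇒y≡0 {x} x≢0 xy≡0 = *-cancelˡ x≢0 (trans xy≡0 (sym (zeroʳ x)))

  xy≡0⇒x≡0∨y≡0 : ∀ x {y} → x * y ≡ 0# → x ≡ 0# ⊎ y ≡ 0#
  xy≡0⇒x≡0∨y≡0 x xy≡0 with x ≟ 0#
  ... | yes x≡0 = inj₁ x≡0
  ... | no  x≢0 = inj₂ (xy≡0⇒y≡0 x≢0 xy≡0)

  xy≢0 : ∀ {x y} → x ≢ 0# → y ≢ 0# → x * y ≢ 0#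
  xy≢0 x≢0 y≢0 xy≡0 = y≢0 (xy≡0⇒y≡0 x≢0 xy≡0)

  x-y≡0⇒x≡y : ∀ {x y} → x + - y ≡ 0# → x ≡ y
  x-y≡0⇒x≡y {x} {y} e = trans (solve 2 (λ x y → x := x :- y :+ y) refl x y) (trans (cong (_+ y) e) (+-identityˡ y))

  x^n≡0⇒x≡0 : ∀ x n → x ^ n ≡ 0# → x ≡ 0#
  x^n≡0⇒x≡0 x zero    e = contradiction (sym e) 0≢1
  x^n≡0⇒x≡0 x (suc n) e with xy≡0⇒x≡0∨y≡0 x e
  ... | inj₁ x≡0 = x≡0
  ... | inj₂ y≡0 = x^n≡0⇒x≡0 x n y≡0

module FiniteFieldProperties {q} (K : FiniteField q) where
  open FiniteField K
  open import Algebra.Properties.Semiring.Mult semiring using (×1-homo-*) renaming (_×_ to _·_)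
  open ≡-Reasoning
  import Algebra.Properties.CommutativeMonoid.Sum +-commutativeMonoid as ∑
  import Algebra.Properties.CommutativeMonoid.Sum *-commutativeMonoid as ∏

  translation : Fin q → Permutation q q
  translation y = permutation (_+ y) (_+ - y)
    (λ x → solve 2 (λ x y → x :- y :+ y := x) refl x y)
    (λ x → solve 2 (λ x y → x :+ y :- y := x) refl x y)

  -- Translating by 1 permutes K, so adding q · 1 does not change the sum of all elements.
  q·1≡0 : q · 1# ≡ 0#
  q·1≡0 = begin
    q · 1#                      ≡⟨ solve 2 (λ x y → x := y :+ x :- y) refl _ (∑.sum {q} (λ x → x)) ⟩
    total + q · 1# + - total    ≡⟨ cong (_+ - total) (sym shifted) ⟩
    total + - total             ≡⟨ -‿inverseʳ total ⟩
    0#                          ∎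
    where
    total = ∑.sum {q} (λ x → x)
    shifted : total ≡ total + q · 1#
    shifted = begin
      total                                  ≡⟨ ∑.sum-permute (λ x → x) (translation 1#) ⟩
      ∑.sum {q} (λ x → x + 1#)               ≡⟨ ∑.∑-distrib-+ {q} (λ x → x) (λ _ → 1#) ⟩
      total + ∑.sum {q} (λ _ → 1#)           ≡⟨ cong (total +_) (∑.sum-replicate q) ⟩
      total + q · 1#                         ∎

  ·1-homo-^ : ∀ p n → (p ℕ.^ n) · 1# ≡ (p · 1#) ^ n
  ·1-homo-^ p zero    = +-identityʳ 1#
  ·1-homo-^ p (suc n) = trans (×1-homo-* p (p ℕ.^ n)) (cong (p · 1# *_) (·1-homo-^ p n))

  -- q · 1 = 0 is the n-th power of p · 1, and a field has no nilpotents besides 0.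
  characteristic : ∀ {p n} → q ≡ p ℕ.^ n → p · 1# ≡ 0#
  characteristic {p} {n} e = x^n≡0⇒x≡0 _ n (begin
    (p · 1#) ^ n     ≡⟨ ·1-homo-^ p n ⟨
    (p ℕ.^ n) · 1#   ≡⟨ cong (_· 1#) e ⟨
    q · 1#           ≡⟨ q·1≡0 ⟩
    0#               ∎)

  dilation : ∀ {y z} → y * z ≡ 1# → Permutation q q
  dilation {y} {z} yz≡1 = permutation (y *_) (z *_)
    (λ x → trans (sym (*-assoc y z x)) (trans (cong (_* x) yz≡1) (*-identityˡ x)))
    (λ x → trans (sym (*-assoc z y x)) (trans (cong (_* x) (trans (*-comm z y) yz≡1)) (*-identityˡ x)))

  -- One of the n factors is 1, so the product is a power with exponent one less; the extra factor y
  -- avoids truncated subtraction.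
  ∏-constant-except : ∀ {n} (i : Fin n) y (f : Fin n → Fin q) → f i ≡ 1# → (∀ j → j ≢ i → f j ≡ y) →
                      y * ∏.sum f ≡ y ^ n
  ∏-constant-except {suc n} zero y f fi≡1 f≡y = cong (y *_) (begin
    f zero * ∏.sum (λ j → f (suc j)) ≡⟨ cong₂ _*_ fi≡1 (∏.sum-cong-≗ (λ j → f≡y (suc j) λ ())) ⟩
    1# * ∏.sum {n} (λ _ → y)         ≡⟨ *-identityˡ _ ⟩
    ∏.sum {n} (λ _ → y)              ≡⟨ ∏.sum-replicate n ⟩
    y ^ n                            ∎)
  ∏-constant-except {suc n} (suc i) y f fi≡1 f≡y =
    cong (y *_) (trans (cong (_* ∏.sum (λ j → f (suc j))) (f≡y zero λ ()))
      (∏-constant-except i y (λ j → f (suc j)) fi≡1 (λ j j≢i → f≡y (suc j) (λ e → j≢i (Fin.suc-injective e)))))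

  -- Putting 1 at the position of 0 lets a product over the non-zero elements be indexed by all of
  -- `Fin q`.
  ifZero : Fin q → Fin q → Fin q
  ifZero y x with x ≟ 0#
  ... | yes _ = 1#
  ... | no  _ = y

  ifZero-0 : ∀ {y x} → x ≡ 0# → ifZero y x ≡ 1#
  ifZero-0 {y} {x} x≡0 with x ≟ 0#
  ... | yes _   = refl
  ... | no  x≢0 = contradiction x≡0 x≢0

  ifZero-≢0 : ∀ {y x} → x ≢ 0# → ifZero y x ≡ y
  ifZero-≢0 {y} {x} x≢0 with x ≟ 0#
  ... | yes x≡0 = contradiction x≡0 x≢0
  ... | no  _   = refl

  ∏≢0 : ∀ {n} (f : Fin n → Fin q) → (∀ i → f i ≢ 0#) → ∏.sum f ≢ 0#
  ∏≢0 {zero}  f f≢0 e = 0≢1 (sym e)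
  ∏≢0 {suc n} f f≢0   = xy≢0 (f≢0 zero) (∏≢0 (λ i → f (suc i)) (λ i → f≢0 (suc i)))

  -- For y ≠ 0 multiplication by y permutes K and multiplies the product of the non-zero elements by
  -- the product of `ifZero y`. Cancelling shows that the latter is 1; one more factor y makes it
  -- y^q.
  fermat : ∀ y → y ^ q ≡ y
  fermat y with y ≟ 0#
  ... | yes refl = 0^n≡0 0#
    where
    -- The element of `Fin n` serves only as evidence that the exponent is positive.
    0^n≡0 : ∀ {n} → Fin n → 0# ^ n ≡ 0#
    0^n≡0 {suc n} _ = zeroˡ _
  ... | no y≢0 = begin
      y ^ q                     ≡⟨ ∏-constant-except 0# y (ifZero y) (ifZero-0 refl) (λ _ → ifZero-≢0) ⟨
      y * ∏.sum (ifZero y)      ≡⟨ cong (y *_) (*-cancelˡ (∏≢0 unit unit≢0) (sym dilated)) ⟩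
      y * 1#                    ≡⟨ *-identityʳ y ⟩
      y                         ∎
    where
    unit : Fin q → Fin q
    unit x = ifZero x x
    unit≢0 : ∀ x → unit x ≢ 0#
    unit≢0 x e with x ≟ 0#
    ... | yes x≡0 = 0≢1 (sym e)
    ... | no  x≢0 = x≢0 e
    unit-* : ∀ x → unit (y * x) ≡ unit x * ifZero y x
    unit-* x with x ≟ 0#
    ... | yes refl = trans (ifZero-0 (zeroʳ y)) (sym (*-identityʳ 1#))
    ... | no  x≢0  = trans (ifZero-≢0 (xy≢0 y≢0 x≢0)) (*-comm y x)
    dilated : ∏.sum unit * 1# ≡ ∏.sum unit * ∏.sum (ifZero y)
    dilated = begin
      ∏.sum unit * 1#                    ≡⟨ *-identityʳ _ ⟩
      ∏.sum unit                         ≡⟨ ∏.sum-permute unit (dilation (proj₂ (inverse y y≢0))) ⟩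
      ∏.sum (λ x → unit (y * x))         ≡⟨ ∏.sum-cong-≗ unit-* ⟩
      ∏.sum (λ x → unit x * ifZero y x)  ≡⟨ ∏.∑-distrib-+ unit (ifZero y) ⟩
      ∏.sum unit * ∏.sum (ifZero y)      ∎

-- Counting in finite sets

-- A missed value could be punched out, embedding m elements into fewer than m.
injective⇒surjective : ∀ {m n} {f : Fin m → Fin n} → Injective _≡_ _≡_ f → n ≤ m → ∀ y → ∃ λ i → f i ≡ y
injective⇒surjective {m} {suc n} {f} inj n≤m y with Fin.any? (λ i → f i Fin.≟ y)
... | yes found = found
... | no  ¬found = contradiction
  (Fin.injective⇒≤ {f = λ i → punchOut (λ e → ¬found (i , sym e))} (inj ∘ Fin.punchOut-injective {i = y} _ _))
  (ℕ.<⇒≱ n≤m)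

-- A section g of f is injective, hence onto by the previous lemma, hence a two-sided inverse.
surjective⇒injective : ∀ {n} {f : Fin n → Fin n} → (∀ y → ∃ λ i → f i ≡ y) → Injective _≡_ _≡_ f
surjective⇒injective {f = f} surj {i} {j} fi≡fj = begin
  i                ≡⟨ i≡g (i) ⟩
  g (f i)          ≡⟨ cong g fi≡fj ⟩
  g (f j)          ≡⟨ i≡g j ⟨
  j                ∎
  where
  open ≡-Reasoning
  g = proj₁ ∘ surj
  g-inj : Injective _≡_ _≡_ g
  g-inj {x} {y} gx≡gy = trans (sym (proj₂ (surj x))) (trans (cong f gx≡gy) (proj₂ (surj y)))
  i≡g : ∀ i → i ≡ g (f i)
  i≡g i with k , refl ← injective⇒surjective g-inj ℕ.≤-refl i = cong g (sym (proj₂ (surj k)))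

-- An enumeration without repetition. `elem-index` holds for every proof of `P x`, so P need not be
-- proof-irrelevant.
record Listing {n} (P : Pred (Fin n) 0ℓ) : Set where
  field
    size           : ℕ
    elem           : Fin size → Fin n
    elem-injective : Injective _≡_ _≡_ elem
    elem-satisfies : ∀ i → P (elem i)
    index          : ∀ {x} → P x → Fin size
    elem-index     : ∀ {x} (px : P x) → elem (index px) ≡ x

listing : ∀ {n} {P : Pred (Fin n) 0ℓ} → Decidable P → Listing P
listing {zero} P? = record
  { size = 0 ; elem = λ () ; elem-injective = λ {i} → contradiction i Fin.¬Fin0 ; elem-satisfies = λ ()
  ; index = λ {x} → contradiction x Fin.¬Fin0 ; elem-index = λ {x} → contradiction x Fin.¬Fin0 }
listing {suc n} {P} P? with listing {n} {P ∘ suc} (P? ∘ suc) | P? zero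
... | rest | no ¬p₀ = record
  { size = size ; elem = suc ∘ elem ; elem-injective = elem-injective ∘ Fin.suc-injective
  ; elem-satisfies = elem-satisfies ; index = λ {x} → idx {x} ; elem-index = λ {x} → elem-idx {x} }
  where
  open Listing rest
  idx : ∀ {x} → P x → Fin size
  idx {zero}  p₀ = contradiction p₀ ¬p₀
  idx {suc x} px = index px
  elem-idx : ∀ {x} (px : P x) → suc (elem (idx px)) ≡ x
  elem-idx {zero}  p₀ = contradiction p₀ ¬p₀
  elem-idx {suc x} px = cong suc (elem-index px)
... | rest | yes p₀ = record
  { size = suc size ; elem = el ; elem-injective = λ {i} {j} → el-inj i j
  ; elem-satisfies = el-sat ; index = λ {x} → idx {x} ; elem-index = λ {x} → el-idx {x} }
  where
  open Listing rest
  el : Fin (suc size) → Fin (suc n)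
  el zero    = zero
  el (suc i) = suc (elem i)
  el-inj : ∀ i j → el i ≡ el j → i ≡ j
  el-inj zero    zero    _ = refl
  el-inj (suc i) (suc j) e = cong suc (elem-injective (Fin.suc-injective e))
  el-sat : ∀ i → P (el i)
  el-sat zero    = p₀
  el-sat (suc i) = elem-satisfies i
  idx : ∀ {x} → P x → Fin (suc size)
  idx {zero}  _  = zero
  idx {suc x} px = suc (index px)
  el-idx : ∀ {x} (px : P x) → el (idx px) ≡ x
  el-idx {zero}  _  = refl
  el-idx {suc x} px = cong suc (elem-index px)

-- Polynomials and the number of their roots

module Polynomials {q} (K : FiniteField q) where
  open FiniteField K
  open ≡-Reasoning

  -- Coefficients start with the constant term and the leading 1 is implicit. The degree is thus
  -- exactly n, and the bound on roots needs no exception for the zero polynomial.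
  monic : ∀ {n} → Vec (Fin q) n → Fin q → Fin q
  monic []       y = 1#
  monic (c ∷ cs) y = c + y * monic cs y

  -- Synthetic division by y - r: the coefficients are the intermediate values of Horner's scheme at
  -- r.
  quotient : ∀ {n} → Fin q → Vec (Fin q) (suc n) → Vec (Fin q) n
  quotient r (c ∷ [])         = []
  quotient r (c ∷ cs@(_ ∷ _)) = monic cs r ∷ quotient r cs

  factor : ∀ {n} r (cs : Vec (Fin q) (suc n)) y → monic cs y + - monic cs r ≡ (y + - r) * monic (quotient r cs) y
  factor r (c ∷ []) y = solve 3 (λ c y r → c :+ y :* con (pos 1) :- (c :+ r :* con (pos 1)) := (y :- r) :* con (pos 1)) refl c y r
  factor r (c ∷ cs@(_ ∷ _)) y = begin
    c + y * monic cs y + - (c + r * monic cs r)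
      ≡⟨ solve 5 (λ c y r f g → c :+ y :* f :- (c :+ r :* g) := (y :- r) :* g :+ y :* (f :- g)) refl c y r (monic cs y) (monic cs r) ⟩
    (y + - r) * monic cs r + y * (monic cs y + - monic cs r)
      ≡⟨ cong (λ z → (y + - r) * monic cs r + y * z) (factor r cs y) ⟩
    (y + - r) * monic cs r + y * ((y + - r) * monic (quotient r cs) y)
      ≡⟨ solve 4 (λ y r f g → (y :- r) :* f :+ y :* ((y :- r) :* g) := (y :- r) :* (f :+ y :* g)) refl y r (monic cs r) (monic (quotient r cs) y) ⟩
    (y + - r) * (monic cs r + y * monic (quotient r cs) y) ∎

  -- One root is divided out at a time; the others stay roots of the quotient because they differ
  -- from it and there are no zero divisors.
  roots≤degree : ∀ {n m} (cs : Vec (Fin q) n) (g : Fin m → Fin q) → Injective _≡_ _≡_ g →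
                 (∀ i → monic cs (g i) ≡ 0#) → m ≤ n
  roots≤degree {m = zero}   cs g g-inj root = z≤n
  roots≤degree {zero}  {suc m} [] g g-inj root = contradiction (sym (root zero)) 0≢1
  roots≤degree {suc n} {suc m} cs g g-inj root =
    s≤s (roots≤degree (quotient r cs) (g ∘ suc) (Fin.suc-injective ∘ g-inj) root′)
    where
    r = g zero
    root′ : ∀ i → monic (quotient r cs) (g (suc i)) ≡ 0#
    root′ i = xy≡0⇒y≡0 (λ e → contradiction (g-inj (x-y≡0⇒x≡y e)) λ ()) (begin
      (g (suc i) + - r) * monic (quotient r cs) (g (suc i)) ≡⟨ factor r cs (g (suc i)) ⟨
      monic cs (g (suc i)) + - monic cs r                   ≡⟨ cong₂ (λ u v → u + - v) (root (suc i)) (root zero) ⟩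
      0# + - 0#                                             ≡⟨ -‿inverseʳ 0# ⟩
      0#                                                    ∎)

  poly : ∀ {n} → Vec (Fin q) n → Fin q → Fin q
  poly []       y = 0#
  poly (c ∷ cs) y = c + y * poly cs y

  monic≡poly+^ : ∀ {n} (cs : Vec (Fin q) n) y → monic cs y ≡ poly cs y + y ^ n
  monic≡poly+^ []       y = sym (+-identityˡ 1#)
  monic≡poly+^ {suc n} (c ∷ cs) y = trans (cong (λ z → c + y * z) (monic≡poly+^ cs y))
    (solve 4 (λ c y f g → c :+ y :* (f :+ g) := c :+ y :* f :+ y :* g) refl c y (poly cs y) (y ^ n))

  -- Stated for functions, so that powers with an abstract exponent can be added and negated without
  -- handling their coefficients.
  Degree<_ : ℕ → (Fin q → Fin q) → Set
  (Degree< n) f = ∃ λ (cs : Vec (Fin q) n) → ∀ y → f y ≡ poly cs y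

  degree-+ : ∀ {n f g} → (Degree< n) f → (Degree< n) g → (Degree< n) (λ y → f y + g y)
  degree-+ (cs , f≡) (ds , g≡) = Vec.zipWith _+_ cs ds , λ y → trans (cong₂ _+_ (f≡ y) (g≡ y)) (homo cs ds y)
    where
    homo : ∀ {n} (cs ds : Vec (Fin q) n) y → poly cs y + poly ds y ≡ poly (Vec.zipWith _+_ cs ds) y
    homo []       []       y = +-identityˡ 0#
    homo (c ∷ cs) (d ∷ ds) y = trans
      (solve 5 (λ c d y f g → c :+ y :* f :+ (d :+ y :* g) := c :+ d :+ y :* (f :+ g)) refl c d y (poly cs y) (poly ds y))
      (cong (λ z → c + d + y * z) (homo cs ds y))

  degree-neg : ∀ {n f} → (Degree< n) f → (Degree< n) (λ y → - f y)
  degree-neg (cs , f≡) = Vec.map -_ cs , λ y → trans (cong -_ (f≡ y)) (homo cs y)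
    where
    homo : ∀ {n} (cs : Vec (Fin q) n) y → - poly cs y ≡ poly (Vec.map -_ cs) y
    homo []       y = solve 0 (:- con (pos 0) := con (pos 0)) refl
    homo (c ∷ cs) y = trans (solve 3 (λ c y f → :- (c :+ y :* f) := :- c :+ y :* :- f) refl c y (poly cs y))
      (cong (λ z → - c + y * z) (homo cs y))

  degree-^ : ∀ {n k} → k < n → (Degree< n) (_^ k)
  degree-^ k<n = coeffs k<n , poly-coeffs k<n
    where
    zeros : ∀ n y → poly (Vec.replicate n 0#) y ≡ 0#
    zeros zero    y = refl
    zeros (suc n) y = trans (+-identityˡ _) (trans (cong (y *_) (zeros n y)) (zeroʳ y))
    coeffs : ∀ {n k} → k < n → Vec (Fin q) n
    coeffs {suc n} {zero}  _         = 1# ∷ Vec.replicate n 0#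
    coeffs {suc n} {suc k} k<n = 0# ∷ coeffs (s<s⁻¹ k<n)
    poly-coeffs : ∀ {n k} (k<n : k < n) y → y ^ k ≡ poly (coeffs k<n) y
    poly-coeffs {suc n} {zero}  k<n y = sym (trans (cong (λ z → 1# + y * z) (zeros n y)) (trans (cong (1# +_) (zeroʳ y)) (+-identityʳ 1#)))
    poly-coeffs {suc n} {suc k} k<n y = trans (cong (y *_) (poly-coeffs (s<s⁻¹ k<n) y)) (sym (+-identityˡ _))

  rootCount : ∀ {n f} → (Degree< n) f → {P : Pred (Fin q) 0ℓ} → (∀ {y} → P y → f y + y ^ n ≡ 0#) →
              (ls : Listing P) → Listing.size ls ≤ n
  rootCount (cs , f≡) root ls = roots≤degree cs elem elem-injective λ i →
    trans (monic≡poly+^ cs (elem i)) (trans (cong (_+ _) (sym (f≡ (elem i)))) (root (elem-satisfies i)))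
    where open Listing ls

-- Subfields and quadratic extensions

module Subfields {q} (K : FiniteField q) where
  open FiniteField K
  open Polynomials K
  open ≡-Reasoning

  record IsSubfield (P : Pred (Fin q) 0ℓ) : Set where
    field
      0∈  : P 0#
      1∈  : P 1#
      +∈  : ∀ {x y} → P x → P y → P (x + y)
      *∈  : ∀ {x y} → P x → P y → P (x * y)
      -∈  : ∀ {x} → P x → P (- x)
      ⁻¹∈ : ∀ {x y} → P x → x * y ≡ 1# → P y

  ⊤-isSubfield : IsSubfield (λ _ → ⊤)
  ⊤-isSubfield = record { 0∈ = tt ; 1∈ = tt ; +∈ = λ _ _ → tt ; *∈ = λ _ _ → tt ; -∈ = λ _ → tt ; ⁻¹∈ = λ _ _ → tt }

  -- (1, θ) is a basis of S′ over S. Existence and uniqueness of coordinates are what splits vectors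
  -- and linear forms later on.
  record QuadraticExtension (S S′ : Pred (Fin q) 0ℓ) : Set where
    field
      θ         : Fin q
      θ∈        : S′ θ
      θ∉        : ¬ S θ
      decompose : ∀ {y} → S′ y → ∃ λ a → ∃ λ b → S a × S b × y ≡ a + θ * b
      unique    : ∀ {a b c d} → S a → S b → S c → S d → a + θ * b ≡ c + θ * d → a ≡ c × b ≡ d

  -- The a + θ b with a, b ∈ S are |S|² ≥ |S′| distinct elements of S′.
  quadraticExtension : ∀ {S S′} → IsSubfield S → IsSubfield S′ → S ⊆ S′ → Decidable S →
                       (A : Listing S) (B : Listing S′) → Listing.size A < Listing.size B →
                       Listing.size B ≤ Listing.size A ℕ.* Listing.size A → QuadraticExtension S S′
  quadraticExtension {S} {S′} subS subS′ S⊆S′ S? A B A<B B≤A² = record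
    { θ = θ ; θ∈ = B.elem-satisfies k ; θ∉ = θ∉S ; decompose = decomp ; unique = unique }
    where
    module A = Listing A
    module B = Listing B
    module S = IsSubfield subS
    module S′ = IsSubfield subS′
    outside : ∃ λ k → ¬ S (B.elem k)
    outside = Fin.¬∀⟶∃¬ B.size (S ∘ B.elem) (S? ∘ B.elem) λ B⊆S → ℕ.<⇒≱ A<B
      (Fin.injective⇒≤ {f = λ i → A.index (B⊆S i)} (λ {i} {j} e → B.elem-injective
        (trans (sym (A.elem-index (B⊆S i))) (trans (cong A.elem e) (A.elem-index (B⊆S j))))))
    k = proj₁ outside
    θ = B.elem k
    θ∉S = proj₂ outside
    unique : ∀ {a b c d} → S a → S b → S c → S d → a + θ * b ≡ c + θ * d → a ≡ c × b ≡ d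
    unique {a} {b} {c} {d} a∈ b∈ c∈ d∈ e with b ≟ d
    ... | yes refl = trans (solve 2 (λ a t → a := a :+ t :- t) refl a (θ * b))
                       (trans (cong (_+ - (θ * b)) e) (solve 2 (λ a t → a :+ t :- t := a) refl c (θ * b))) , refl
    -- If b ≠ d, then θ = (c - a) / (b - d) would lie in S.
    ... | no b≢d = contradiction
        (subst S (sym θ≡) (S.*∈ (S.+∈ c∈ (S.-∈ a∈)) (S.⁻¹∈ (S.+∈ b∈ (S.-∈ d∈)) δδ⁻¹≡1))) θ∉S
      where
      δ = b + - d
      δ⁻¹ = proj₁ (inverse δ (b≢d ∘ x-y≡0⇒x≡y))
      δδ⁻¹≡1 : δ * δ⁻¹ ≡ 1#
      δδ⁻¹≡1 = proj₂ (inverse δ (b≢d ∘ x-y≡0⇒x≡y))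
      θ≡ : θ ≡ (c + - a) * δ⁻¹
      θ≡ = begin
        θ                                        ≡⟨ *-identityʳ θ ⟨
        θ * 1#                                   ≡⟨ cong (θ *_) δδ⁻¹≡1 ⟨
        θ * ((b + - d) * δ⁻¹)                    ≡⟨ solve 5 (λ θ a b d i → θ :* ((b :- d) :* i) := (a :+ θ :* b :- θ :* d :- a) :* i) refl θ a b d δ⁻¹ ⟩
        (a + θ * b + - (θ * d) + - a) * δ⁻¹      ≡⟨ cong (λ z → (z + - (θ * d) + - a) * δ⁻¹) e ⟩
        (c + θ * d + - (θ * d) + - a) * δ⁻¹      ≡⟨ solve 4 (λ c t a i → (c :+ t :- t :- a) :* i := (c :- a) :* i) refl c (θ * d) a δ⁻¹ ⟩
        (c + - a) * δ⁻¹                          ∎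
    value : Fin A.size × Fin A.size → Fin q
    value (i , j) = A.elem i + θ * A.elem j
    value∈ : ∀ ij → S′ (value ij)
    value∈ (i , j) = S′.+∈ (S⊆S′ (A.elem-satisfies i)) (S′.*∈ (B.elem-satisfies k) (S⊆S′ (A.elem-satisfies j)))
    code : Fin (A.size ℕ.* A.size) → Fin B.size
    code i = B.index (value∈ (remQuot {A.size} A.size i))
    value-code : ∀ i → value (remQuot {A.size} A.size i) ≡ B.elem (code i)
    value-code i = sym (B.elem-index (value∈ (remQuot {A.size} A.size i)))
    code-injective : Injective _≡_ _≡_ code
    code-injective {i} {j} e
      with a≡c , b≡d ← unique (A.elem-satisfies _) (A.elem-satisfies _) (A.elem-satisfies _) (A.elem-satisfies _)
                         (trans (value-code i) (trans (cong B.elem e) (sym (value-code j)))) = begin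
      i                                        ≡⟨ Fin.combine-remQuot {A.size} A.size i ⟨
      uncurry combine (remQuot {A.size} A.size i)  ≡⟨ cong₂ combine (A.elem-injective a≡c) (A.elem-injective b≡d) ⟩
      uncurry combine (remQuot {A.size} A.size j)  ≡⟨ Fin.combine-remQuot {A.size} A.size j ⟩
      j                                        ∎
    decomp : ∀ {y} → S′ y → ∃ λ a → ∃ λ b → S a × S b × y ≡ a + θ * b
    decomp {y} y∈ with i , e ← injective⇒surjective code-injective B≤A² (B.index y∈) =
      A.elem (proj₁ (remQuot {A.size} A.size i)) , A.elem (proj₂ (remQuot {A.size} A.size i)) ,
      A.elem-satisfies _ , A.elem-satisfies _ ,
      trans (sym (B.elem-index y∈)) (trans (cong B.elem (sym e)) (sym (value-code i)))

  -- A point is determined by its image and its offset from a chosen preimage.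
  image*kernel : (f : Fin q → Fin q) → (∀ a b → f (a + - b) ≡ f a + - f b) →
                 ∀ {P Q} (ker : Listing Q) → (∀ {y} → f y ≡ 0# → Q y) → (im : Listing P) → (∀ y → P (f y)) →
                 q ≤ Listing.size im ℕ.* Listing.size ker
  image*kernel f f-sub {Q = Q} ker ker∈ im f∈ = Fin.injective⇒≤ {f = code} code-injective
    where
    module ker = Listing ker
    module im = Listing im
    preimage : Fin q → Fin q
    preimage c with Fin.any? (λ y → f y ≟ c)
    ... | yes (y , _) = y
    -- A dummy value: `preimage` is applied only to values of f.
    ... | no  _       = c
    f-preimage : ∀ y → f (preimage (f y)) ≡ f y
    f-preimage y with Fin.any? (λ z → f z ≟ f y)
    ... | yes (_ , e) = e
    ... | no  ¬e      = contradiction (y , refl) ¬e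
    offset∈ker : ∀ y → Q (y + - preimage (f y))
    offset∈ker y = ker∈ (trans (f-sub y _) (trans (cong (λ z → f y + - z) (f-preimage y)) (-‿inverseʳ (f y))))
    code : Fin q → Fin (im.size ℕ.* ker.size)
    code y = combine (im.index (f∈ y)) (ker.index (offset∈ker y))
    code-injective : Injective _≡_ _≡_ code
    code-injective {y} {z} e with e₁ , e₂ ← Fin.combine-injective _ _ _ _ e = begin
      y                                         ≡⟨ solve 2 (λ a b → a := a :- b :+ b) refl y (preimage (f y)) ⟩
      y + - preimage (f y) + preimage (f y)     ≡⟨ cong₂ _+_ off (cong preimage fy≡fz) ⟩
      z + - preimage (f z) + preimage (f z)     ≡⟨ solve 2 (λ a b → a :- b :+ b := a) refl z (preimage (f z)) ⟩
      z                                         ∎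
      where
      fy≡fz : f y ≡ f z
      fy≡fz = trans (sym (im.elem-index (f∈ y))) (trans (cong im.elem e₁) (im.elem-index (f∈ z)))
      off : y + - preimage (f y) ≡ z + - preimage (f z)
      off = trans (sym (ker.elem-index (offset∈ker y))) (trans (cong ker.elem e₂) (ker.elem-index (offset∈ker z)))

  -- The fixed fields of the Frobenius power y ↦ y^x and of its square

  module FrobeniusFixed (x : ℕ) (1<x : 1 < x) (q≡x⁴ : q ≡ x ℕ.^ 4)
                        (φ-+ : ∀ a b → (a + b) ^ x ≡ a ^ x + b ^ x) (fermat : ∀ y → y ^ q ≡ y) where

    0<x : 0 < x
    0<x = ℕ.<-trans (s≤s z≤n) 1<x
    instance
      x-nonZero : ℕ.NonZero x
      x-nonZero = ℕ.>-nonZero 0<x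

    φ : Fin q → Fin q
    φ y = y ^ x

    φ-* : ∀ a b → φ (a * b) ≡ φ a * φ b
    φ-* a b = ^-distrib-* a b x

    φ-1 : φ 1# ≡ 1#
    φ-1 = 1^n x
      where
      1^n : ∀ n → 1# ^ n ≡ 1#
      1^n zero    = refl
      1^n (suc n) = trans (*-identityˡ _) (1^n n)

    φ-0 : φ 0# ≡ 0#
    φ-0 = 0^n 0<x
      where
      0^n : ∀ {n} → 0 < n → 0# ^ n ≡ 0#
      0^n {suc n} _ = zeroˡ _

    φ-neg : ∀ a → φ (- a) ≡ - φ a
    φ-neg a = begin
      φ (- a)                   ≡⟨ solve 2 (λ a b → a := a :+ b :- b) refl (φ (- a)) (φ a) ⟩
      φ (- a) + φ a + - φ a     ≡⟨ cong (_+ - φ a) (φ-+ (- a) a) ⟨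
      φ (- a + a) + - φ a       ≡⟨ cong (λ z → φ z + - φ a) (-‿inverseˡ a) ⟩
      φ 0# + - φ a              ≡⟨ cong (_+ - φ a) φ-0 ⟩
      0# + - φ a                ≡⟨ +-identityˡ _ ⟩
      - φ a                     ∎

    φ-sub : ∀ a b → φ (a + - b) ≡ φ a + - φ b
    φ-sub a b = trans (φ-+ a (- b)) (cong (φ a +_) (φ-neg b))

    φ² : ∀ y → φ (φ y) ≡ y ^ (x ℕ.* x)
    φ² y = ^-assocʳ y x x

    φ³ : ∀ y → φ (φ (φ y)) ≡ y ^ (x ℕ.* x ℕ.* x)
    φ³ y = trans (cong φ (φ² y)) (^-assocʳ y (x ℕ.* x) x)

    φ⁴ : ∀ y → φ (φ (φ (φ y))) ≡ y
    φ⁴ y = begin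
      φ (φ (φ (φ y)))                ≡⟨ φ² (φ (φ y)) ⟩
      φ (φ y) ^ (x ℕ.* x)            ≡⟨ cong (_^ (x ℕ.* x)) (φ² y) ⟩
      (y ^ (x ℕ.* x)) ^ (x ℕ.* x)    ≡⟨ ^-assocʳ y (x ℕ.* x) (x ℕ.* x) ⟩
      y ^ (x ℕ.* x ℕ.* (x ℕ.* x))    ≡⟨ cong (y ^_) (trans x⁴ (sym q≡x⁴)) ⟩
      y ^ q                          ≡⟨ fermat y ⟩
      y                              ∎
      where
      x⁴ : x ℕ.* x ℕ.* (x ℕ.* x) ≡ x ℕ.^ 4
      x⁴ = ℕ+*.solve 1 (λ x → x ℕ+*.:* x ℕ+*.:* (x ℕ+*.:* x) ℕ+*.:= x ℕ+*.:^ 4) refl x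

    -- As fixed points of φ and φ² these sets are decidable and closed under the operations; they
    -- are the subfields with x and x² elements. The upper bounds on their sizes count roots of y^x
    -- - y and of y^(x²) - y.
    L E : Pred (Fin q) 0ℓ
    L y = φ y ≡ y
    E y = φ (φ y) ≡ y

    L? : Decidable L
    L? y = φ y ≟ y

    E? : Decidable E
    E? y = φ (φ y) ≟ y

    φ-⁻¹ : ∀ {a b} → a * b ≡ 1# → φ a * φ b ≡ 1#
    φ-⁻¹ {a} {b} ab≡1 = trans (sym (φ-* a b)) (trans (cong φ ab≡1) φ-1)

    fixed-⁻¹ : ∀ {a a′ b b′} → a ≡ a′ → a * b ≡ 1# → a′ * b′ ≡ 1# → b′ ≡ b
    fixed-⁻¹ {a} {b = b} refl ab≡1 ab′≡1 =
      *-cancelˡ (λ { refl → 0≢1 (trans (sym (zeroˡ b)) ab≡1) }) (trans ab′≡1 (sym ab≡1))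

    L-isSubfield : IsSubfield L
    L-isSubfield = record
      { 0∈ = φ-0 ; 1∈ = φ-1
      ; +∈ = λ {a} {b} a∈ b∈ → trans (φ-+ a b) (cong₂ _+_ a∈ b∈)
      ; *∈ = λ {a} {b} a∈ b∈ → trans (φ-* a b) (cong₂ _*_ a∈ b∈)
      ; -∈ = λ {a} a∈ → trans (φ-neg a) (cong -_ a∈)
      ; ⁻¹∈ = λ a∈ ab≡1 → fixed-⁻¹ (sym a∈) ab≡1 (φ-⁻¹ ab≡1) }

    E-isSubfield : IsSubfield E
    E-isSubfield = record
      { 0∈ = trans (cong φ φ-0) φ-0 ; 1∈ = trans (cong φ φ-1) φ-1
      ; +∈ = λ {a} {b} a∈ b∈ → trans (cong φ (φ-+ a b)) (trans (φ-+ _ _) (cong₂ _+_ a∈ b∈))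
      ; *∈ = λ {a} {b} a∈ b∈ → trans (cong φ (φ-* a b)) (trans (φ-* _ _) (cong₂ _*_ a∈ b∈))
      ; -∈ = λ {a} a∈ → trans (cong φ (φ-neg a)) (trans (φ-neg _) (cong -_ a∈))
      ; ⁻¹∈ = λ a∈ ab≡1 → fixed-⁻¹ (sym a∈) ab≡1 (φ-⁻¹ (φ-⁻¹ ab≡1)) }

    L⊆E : L ⊆ E
    L⊆E y∈ = trans (cong φ y∈) y∈

    listL : Listing L
    listL = listing L?
    listE : Listing E
    listE = listing E?
    module listL = Listing listL
    module listE = Listing listE

    x<x² : x < x ℕ.* x
    x<x² = ℕ.m<m*n x x 1<x
    x²<x³ : x ℕ.* x < x ℕ.* x ℕ.* x
    x²<x³ = ℕ.m<m*n (x ℕ.* x) x {{ℕ.>-nonZero (ℕ.*-mono-< 0<x 0<x)}} 1<x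

    degree-y : ∀ {n} → 1 < n → (Degree< n) (λ y → y)
    degree-y 1<n = proj₁ (degree-^ 1<n) , λ y → trans (sym (*-identityʳ y)) (proj₂ (degree-^ 1<n) y)

    |L|≤x : listL.size ≤ x
    |L|≤x = rootCount (degree-neg (degree-y 1<x)) (λ {y} y∈ → trans (cong (- y +_) y∈) (-‿inverseˡ y)) listL

    |E|≤x² : listE.size ≤ x ℕ.* x
    |E|≤x² = rootCount (degree-neg (degree-y (ℕ.<-trans 1<x x<x²)))
      (λ {y} y∈ → trans (cong (- y +_) (trans (sym (φ² y)) y∈)) (-‿inverseˡ y)) listE

    -- φ⁴ − 1 = (φ − 1)(φ³ + φ² + φ + 1) vanishes on K, so φ − 1 maps K into the at most x³ roots of
    -- the second factor; likewise φ² − 1 maps K into the at most x² roots of φ² + 1.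
    x≤|L| : x ≤ listL.size
    x≤|L| = ℕ.*-cancelˡ-≤ (x ℕ.* x ℕ.* x) {{ℕ.m*n≢0 (x ℕ.* x) x {{ℕ.m*n≢0 x x}}}}
      (ℕ.≤-trans (ℕ.≤-reflexive (sym (trans q≡x⁴ (ℕ+*.solve 1 (λ x → x ℕ+*.:^ 4 ℕ+*.:= x ℕ+*.:* x ℕ+*.:* x ℕ+*.:* x) refl x))))
        (ℕ.≤-trans
          (image*kernel (λ y → φ y + - y) sub listL x-y≡0⇒x≡y roots image)
          (ℕ.*-monoˡ-≤ listL.size (rootCount
            (degree-+ (degree-+ (degree-y (ℕ.<-trans 1<x x<x³)) (degree-^ x<x³)) (degree-^ x²<x³))
            (λ {y} e → trans (cong (y + φ y + y ^ (x ℕ.* x) +_) (sym (φ³ y)))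
                         (trans (cong (λ z → y + φ y + z + φ (φ (φ y))) (sym (φ² y))) e))
            roots))))
      where
      trace : Fin q → Fin q
      trace y = y + φ y + φ (φ y) + φ (φ (φ y))
      roots : Listing (λ y → trace y ≡ 0#)
      roots = listing (λ y → trace y ≟ 0#)
      x<x³ : x < x ℕ.* x ℕ.* x
      x<x³ = ℕ.<-trans x<x² x²<x³
      sub : ∀ a b → φ (a + - b) + - (a + - b) ≡ φ a + - a + - (φ b + - b)
      sub a b = trans (cong (_+ - (a + - b)) (φ-sub a b))
        (solve 4 (λ a b c d → c :- d :- (a :- b) := c :- a :- (d :- b)) refl a b (φ a) (φ b))
      image : ∀ y → trace (φ y + - y) ≡ 0#
      image y rewrite φ-sub (φ y) y | φ-sub (φ (φ y)) (φ y) | φ-sub (φ (φ (φ y))) (φ (φ y)) | φ⁴ y =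
        solve 4 (λ a b c d → b :- a :+ (c :- b) :+ (d :- c) :+ (a :- d) := con (pos 0)) refl y (φ y) (φ (φ y)) (φ (φ (φ y)))

    x²≤|E| : x ℕ.* x ≤ listE.size
    x²≤|E| = ℕ.*-cancelˡ-≤ (x ℕ.* x) {{ℕ.m*n≢0 x x}}
      (ℕ.≤-trans (ℕ.≤-reflexive (sym (trans q≡x⁴ (ℕ+*.solve 1 (λ x → x ℕ+*.:^ 4 ℕ+*.:= x ℕ+*.:* x ℕ+*.:* (x ℕ+*.:* x)) refl x))))
        (ℕ.≤-trans
          (image*kernel (λ y → φ (φ y) + - y) sub listE x-y≡0⇒x≡y roots image)
          (ℕ.*-monoˡ-≤ listE.size (rootCount (degree-y (ℕ.<-trans 1<x x<x²))
            (λ {y} e → trans (cong (y +_) (sym (φ² y))) e) roots))))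
      where
      roots : Listing (λ y → y + φ (φ y) ≡ 0#)
      roots = listing (λ y → y + φ (φ y) ≟ 0#)
      sub : ∀ a b → φ (φ (a + - b)) + - (a + - b) ≡ φ (φ a) + - a + - (φ (φ b) + - b)
      sub a b = trans (cong (_+ - (a + - b)) (trans (cong φ (φ-sub a b)) (φ-sub (φ a) (φ b))))
        (solve 4 (λ a b c d → c :- d :- (a :- b) := c :- a :- (d :- b)) refl a b (φ (φ a)) (φ (φ b)))
      image : ∀ y → φ (φ y) + - y + φ (φ (φ (φ y) + - y)) ≡ 0#
      image y rewrite φ-sub (φ (φ y)) y | φ-sub (φ (φ (φ y))) (φ y) | φ⁴ y =
        solve 2 (λ a b → b :- a :+ (a :- b) := con (pos 0)) refl y (φ (φ y))

    listK : Listing {q} (λ _ → ⊤)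
    listK = record { size = q ; elem = λ i → i ; elem-injective = λ e → e ; elem-satisfies = λ _ → tt
                   ; index = λ {i} _ → i ; elem-index = λ _ → refl }

    -- Degree 2 follows from cardinalities alone.
    E/L : QuadraticExtension L E
    E/L = quadraticExtension L-isSubfield E-isSubfield L⊆E L? listL listE
      (ℕ.≤-<-trans |L|≤x (ℕ.<-≤-trans x<x² x²≤|E|))
      (ℕ.≤-trans |E|≤x² (ℕ.*-mono-≤ x≤|L| x≤|L|))

    K/E : QuadraticExtension E (λ _ → ⊤)
    K/E = quadraticExtension E-isSubfield ⊤-isSubfield _ E? listE listK
      (ℕ.≤-<-trans |E|≤x² (subst (x ℕ.* x <_) (sym q≡x²x²) (ℕ.m<m*n (x ℕ.* x) (x ℕ.* x) {{ℕ.m*n≢0 x x}} (ℕ.<-trans 1<x x<x²))))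
      (ℕ.≤-trans (ℕ.≤-reflexive q≡x²x²) (ℕ.*-mono-≤ x²≤|E| x²≤|E|))
      where
      q≡x²x² : q ≡ x ℕ.* x ℕ.* (x ℕ.* x)
      q≡x²x² = trans q≡x⁴ (ℕ+*.solve 1 (λ x → x ℕ+*.:^ 4 ℕ+*.:= x ℕ+*.:* x ℕ+*.:* (x ℕ+*.:* x)) refl x)

    -- t ↦ t³ − t identifies 0 and 1, hence is not onto L.
    irreducibleCubic : ∃ λ γ → L γ × (∀ {t} → L t → t * t * t + - t ≢ γ)
    irreducibleCubic = listL.elem k , listL.elem-satisfies k , λ {t} t∈ e → missed (listL.index t∈ ,
        listL.elem-injective (trans (elem-cubic _) (trans (cong (λ t → t * t * t + - t) (listL.elem-index t∈)) e)))
      where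
      module L = IsSubfield L-isSubfield
      cubic∈ : ∀ {t} → L t → L (t * t * t + - t)
      cubic∈ t∈ = L.+∈ (L.*∈ (L.*∈ t∈ t∈) t∈) (L.-∈ t∈)
      cubic : Fin listL.size → Fin listL.size
      cubic i = listL.index (cubic∈ (listL.elem-satisfies i))
      elem-cubic : ∀ i → listL.elem (cubic i) ≡ listL.elem i * listL.elem i * listL.elem i + - listL.elem i
      elem-cubic i = listL.elem-index (cubic∈ (listL.elem-satisfies i))
      0≡1 : (∀ k → ∃ λ i → cubic i ≡ k) → 0# ≡ 1#
      0≡1 onto = begin
        0#                               ≡⟨ listL.elem-index L.0∈ ⟨
        listL.elem (listL.index L.0∈)    ≡⟨ cong listL.elem (surjective⇒injective onto (listL.elem-injective (begin
            listL.elem (cubic (listL.index L.0∈)) ≡⟨ trans (elem-cubic _) (cong (λ t → t * t * t + - t) (listL.elem-index L.0∈)) ⟩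
            0# * 0# * 0# + - 0#                   ≡⟨ solve 0 (con (pos 0) :* con (pos 0) :* con (pos 0) :- con (pos 0) := con (pos 1) :* con (pos 1) :* con (pos 1) :- con (pos 1)) refl ⟩
            1# * 1# * 1# + - 1#                   ≡⟨ trans (elem-cubic _) (cong (λ t → t * t * t + - t) (listL.elem-index L.1∈)) ⟨
            listL.elem (cubic (listL.index L.1∈)) ∎))) ⟩
        listL.elem (listL.index L.1∈)    ≡⟨ listL.elem-index L.1∈ ⟩
        1#                               ∎
      missing : ∃ λ k → ¬ ∃ λ i → cubic i ≡ k
      missing = Fin.¬∀⟶∃¬ listL.size _ (λ k → Fin.any? (λ i → cubic i Fin.≟ k)) (0≢1 ∘ 0≡1)
      k = proj₁ missing
      missed = proj₂ missing

    -- A root ρ ∈ E ∖ L has a conjugate φ ρ ≠ ρ, and the third root − (ρ + φ ρ) lies in L.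
    cubic-irreducible-over-E : ∀ {γ} → L γ → (∀ {t} → L t → t * t * t + - t ≢ γ) → ∀ {ρ} → E ρ → ρ * ρ * ρ + - ρ ≢ γ
    cubic-irreducible-over-E {γ} γ∈ noRoot {ρ} ρ∈ e with ρ ≟ φ ρ
    ... | yes ρ≡φρ = noRoot (sym ρ≡φρ) e
    ... | no  ρ≢φρ = noRoot {t = - (ρ + σ)} r∈L (begin
        - (ρ + σ) * - (ρ + σ) * - (ρ + σ) + - - (ρ + σ)
          ≡⟨ solve 2 (λ r s → :- (r :+ s) :* :- (r :+ s) :* :- (r :+ s) :- :- (r :+ s)
                           := r :* r :* r :- r :- (con (pos 2) :* r :+ s) :* (r :* r :+ r :* s :+ s :* s :- con (pos 1))) refl ρ σ ⟩
        ρ * ρ * ρ + - ρ + - ((two * ρ + σ) * (ρ * ρ + ρ * σ + σ * σ + - 1#))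
          ≡⟨ cong₂ (λ u v → u + - ((two * ρ + σ) * v)) e quadratic ⟩
        γ + - ((two * ρ + σ) * 0#)
          ≡⟨ solve 2 (λ g a → g :- a :* con (pos 0) := g) refl γ (two * ρ + σ) ⟩
        γ ∎)
      where
      two = 1# + 1#
      σ = φ ρ
      eσ : σ * σ * σ + - σ ≡ γ
      -- φ is applied to the equation for ρ; it fixes γ, so φ ρ is a root as well.
      eσ = trans (sym (trans (φ-sub (ρ * ρ * ρ) ρ) (cong (_+ - σ) (trans (φ-* _ ρ) (cong (_* σ) (φ-* ρ ρ)))))) (trans (cong φ e) γ∈)
      quadratic : ρ * ρ + ρ * σ + σ * σ + - 1# ≡ 0#
      quadratic = xy≡0⇒y≡0 (ρ≢φρ ∘ x-y≡0⇒x≡y) (begin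
        (ρ + - σ) * (ρ * ρ + ρ * σ + σ * σ + - 1#)
          ≡⟨ solve 2 (λ r s → (r :- s) :* (r :* r :+ r :* s :+ s :* s :- con (pos 1)) := r :* r :* r :- r :- (s :* s :* s :- s)) refl ρ σ ⟩
        ρ * ρ * ρ + - ρ + - (σ * σ * σ + - σ)  ≡⟨ cong₂ (λ u v → u + - v) e eσ ⟩
        γ + - γ                                ≡⟨ -‿inverseʳ γ ⟩
        0#                                     ∎)
      r∈L : L (- (ρ + σ))
      r∈L = trans (φ-neg (ρ + σ)) (cong -_ (trans (φ-+ ρ σ) (trans (cong (σ +_) ρ∈) (+-comm σ ρ))))

-- Vectors, planes and determinants in K³

module LinearAlgebra {q} (K : FiniteField q) where
  open FiniteField K
  open ≡-Reasoning

  comb : ∀ {n} → Fin q → Vec (Fin q) n → Fin q → Vec (Fin q) n → Vec (Fin q) n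
  comb a v b w = Vec.zipWith (λ x y → a * x + b * y) v w

  infixr 7 _∙_
  _∙_ : ∀ {n} → Fin q → Vec (Fin q) n → Vec (Fin q) n
  a ∙ v = Vec.map (a *_) v

  𝟎 : ∀ {n} → Vec (Fin q) n
  𝟎 = Vec.replicate _ 0#

  comb-∙ : ∀ {n} a c b d (v w : Vec (Fin q) n) → comb a (c ∙ v) b (d ∙ w) ≡ comb (a * c) v (b * d) w
  comb-∙ a c b d []      []      = refl
  comb-∙ a c b d (x ∷ v) (y ∷ w) = cong₂ _∷_
    (solve 6 (λ a c b d x y → a :* (c :* x) :+ b :* (d :* y) := a :* c :* x :+ b :* d :* y) refl a c b d x y) (comb-∙ a c b d v w)

  ∙-comb : ∀ {n} c a b (v w : Vec (Fin q) n) → c ∙ comb a v b w ≡ comb (c * a) v (c * b) w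
  ∙-comb c a b []      []      = refl
  ∙-comb c a b (x ∷ v) (y ∷ w) = cong₂ _∷_
    (solve 5 (λ c a b x y → c :* (a :* x :+ b :* y) := c :* a :* x :+ c :* b :* y) refl c a b x y) (∙-comb c a b v w)

  comb-0ʳ : ∀ {n} a (v w : Vec (Fin q) n) → comb a v 0# w ≡ a ∙ v
  comb-0ʳ a []      []      = refl
  comb-0ʳ a (x ∷ v) (y ∷ w) = cong₂ _∷_ (solve 3 (λ a x y → a :* x :+ con (pos 0) :* y := a :* x) refl a x y) (comb-0ʳ a v w)

  comb-0ˡ : ∀ {n} b (v w : Vec (Fin q) n) → comb 0# v b w ≡ b ∙ w
  comb-0ˡ b []      []      = refl
  comb-0ˡ b (x ∷ v) (y ∷ w) = cong₂ _∷_ (solve 3 (λ b x y → con (pos 0) :* x :+ b :* y := b :* y) refl b x y) (comb-0ˡ b v w)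

  0∙ : ∀ {n} (v : Vec (Fin q) n) → 0# ∙ v ≡ 𝟎
  0∙ []      = refl
  0∙ (x ∷ v) = cong₂ _∷_ (zeroˡ x) (0∙ v)

  v-w≡𝟎⇒v≡w : ∀ {n} a (v w : Vec (Fin q) n) → comb 1# v (- a) w ≡ 𝟎 → v ≡ a ∙ w
  v-w≡𝟎⇒v≡w a []      []      _ = refl
  v-w≡𝟎⇒v≡w a (x ∷ v) (y ∷ w) e with e₀ , e₁ ← ∷-injective e =
    cong₂ _∷_ (x-y≡0⇒x≡y (trans (solve 3 (λ a x y → x :- a :* y := con (pos 1) :* x :+ :- a :* y) refl a x y) e₀)) (v-w≡𝟎⇒v≡w a v w e₁)

  _≟ᵛ_ : ∀ {n} (v w : Vec (Fin q) n) → Dec (v ≡ w)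
  _≟ᵛ_ = ≡-dec _≟_

  V₃ : Set
  V₃ = Vec (Fin q) 3

  ≡₃ : ∀ {a b c a′ b′ c′ : Fin q} → a ≡ a′ → b ≡ b′ → c ≡ c′ → _≡_ {A = V₃} (a ∷ b ∷ c ∷ []) (a′ ∷ b′ ∷ c′ ∷ [])
  ≡₃ refl refl refl = refl

  dot : V₃ → V₃ → Fin q
  dot (a ∷ b ∷ c ∷ []) (x ∷ y ∷ z ∷ []) = a * x + b * y + c * z

  cross : V₃ → V₃ → V₃
  cross (a ∷ b ∷ c ∷ []) (x ∷ y ∷ z ∷ []) = (b * z + - (c * y)) ∷ (c * x + - (a * z)) ∷ (a * y + - (b * x)) ∷ []

  dot-comb : ∀ f a v b w → dot f (comb a v b w) ≡ a * dot f v + b * dot f w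
  dot-comb (f ∷ g ∷ h ∷ []) a (x ∷ y ∷ z ∷ []) b (x′ ∷ y′ ∷ z′ ∷ []) = begin
    f * (a * x + b * x′) + g * (a * y + b * y′) + h * (a * z + b * z′)
      ≡⟨ cong₂ _+_ (cong₂ _+_ (term f x x′) (term g y y′)) (term h z z′) ⟩
    a * (f * x) + b * (f * x′) + (a * (g * y) + b * (g * y′)) + (a * (h * z) + b * (h * z′))
      ≡⟨ solve 8 (λ a b p p′ q q′ r r′ → a :* p :+ b :* p′ :+ (a :* q :+ b :* q′) :+ (a :* r :+ b :* r′) := a :* (p :+ q :+ r) :+ b :* (p′ :+ q′ :+ r′)) refl a b _ _ _ _ _ _ ⟩
    a * (f * x + g * y + h * z) + b * (f * x′ + g * y′ + h * z′) ∎
    where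
    term : ∀ f x x′ → f * (a * x + b * x′) ≡ a * (f * x) + b * (f * x′)
    term f x x′ = solve 5 (λ a b f x x′ → f :* (a :* x :+ b :* x′) := a :* (f :* x) :+ b :* (f :* x′)) refl a b f x x′

  dot-comm : ∀ v w → dot v w ≡ dot w v
  dot-comm (a ∷ b ∷ c ∷ []) (x ∷ y ∷ z ∷ []) = cong₂ _+_ (cong₂ _+_ (*-comm a x) (*-comm b y)) (*-comm c z)

  cross-∙ˡ : ∀ a v → cross (a ∙ v) v ≡ 𝟎
  cross-∙ˡ a (x ∷ y ∷ z ∷ []) = ≡₃ (e y z) (e z x) (e x y)
    where
    e : ∀ x y → a * x * y + - (a * y * x) ≡ 0#
    e x y = solve 3 (λ a x y → a :* x :* y :- a :* y :* x := con (pos 0)) refl a x y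

  cross-∙ʳ : ∀ a v → cross v (a ∙ v) ≡ 𝟎
  cross-∙ʳ a (x ∷ y ∷ z ∷ []) = ≡₃ (e y z) (e z x) (e x y)
    where
    e : ∀ x y → x * (a * y) + - (y * (a * x)) ≡ 0#
    e x y = solve 3 (λ a x y → x :* (a :* y) :- y :* (a :* x) := con (pos 0)) refl a x y

  -- Cramer's rule in a plane: the vanishing determinant makes the third coordinate follow from the other two.
  cramer : ∀ {s₀ s₁ s₂ w₀ w₁ w₂ g₀ g₁ g₂} → w₀ * g₁ + - (w₁ * g₀) ≢ 0# →
           s₀ * (w₁ * g₂ + - (w₂ * g₁)) + s₁ * (w₂ * g₀ + - (w₀ * g₂)) + s₂ * (w₀ * g₁ + - (w₁ * g₀)) ≡ 0# →
           ∃ λ a → ∃ λ b → a * w₀ + b * g₀ ≡ s₀ × a * w₁ + b * g₁ ≡ s₁ × a * w₂ + b * g₂ ≡ s₂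
  cramer {s₀} {s₁} {s₂} {w₀} {w₁} {w₂} {g₀} {g₁} {g₂} D≢0 det≡0 =
    (s₀ * g₁ + - (s₁ * g₀)) * i , (w₀ * s₁ + - (w₁ * s₀)) * i ,
    normalise (solve 6 (λ s₀ s₁ w₀ w₁ g₀ g₁ → (s₀ :* g₁ :- s₁ :* g₀) :* w₀ :+ (w₀ :* s₁ :- w₁ :* s₀) :* g₀ := s₀ :* (w₀ :* g₁ :- w₁ :* g₀)) refl s₀ s₁ w₀ w₁ g₀ g₁) ,
    normalise (solve 6 (λ s₀ s₁ w₀ w₁ g₀ g₁ → (s₀ :* g₁ :- s₁ :* g₀) :* w₁ :+ (w₀ :* s₁ :- w₁ :* s₀) :* g₁ := s₁ :* (w₀ :* g₁ :- w₁ :* g₀)) refl s₀ s₁ w₀ w₁ g₀ g₁) ,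
    normalise (begin
      (s₀ * g₁ + - (s₁ * g₀)) * w₂ + (w₀ * s₁ + - (w₁ * s₀)) * g₂
        ≡⟨ solve 8 (λ s₀ s₁ w₀ w₁ w₂ g₀ g₁ g₂ → (s₀ :* g₁ :- s₁ :* g₀) :* w₂ :+ (w₀ :* s₁ :- w₁ :* s₀) :* g₂ :=
             :- (s₀ :* (w₁ :* g₂ :- w₂ :* g₁) :+ s₁ :* (w₂ :* g₀ :- w₀ :* g₂)))
             refl s₀ s₁ w₀ w₁ w₂ g₀ g₁ g₂ ⟩
      - (s₀ * (w₁ * g₂ + - (w₂ * g₁)) + s₁ * (w₂ * g₀ + - (w₀ * g₂)))
        ≡⟨ solve 2 (λ u v → :- u := v :- (u :+ v)) refl _ (s₂ * D) ⟩
      s₂ * D + - (s₀ * (w₁ * g₂ + - (w₂ * g₁)) + s₁ * (w₂ * g₀ + - (w₀ * g₂)) + s₂ * (w₀ * g₁ + - (w₁ * g₀)))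
        ≡⟨ cong (λ z → s₂ * D + - z) det≡0 ⟩
      s₂ * D + - 0#
        ≡⟨ solve 1 (λ t → t :- con (pos 0) := t) refl (s₂ * D) ⟩
      s₂ * D ∎)
    where
    D = w₀ * g₁ + - (w₁ * g₀)
    i = proj₁ (inverse D D≢0)
    normalise : ∀ {A B w g s} → A * w + B * g ≡ s * D → A * i * w + B * i * g ≡ s
    normalise {A} {B} {w} {g} {s} e = begin
      A * i * w + B * i * g    ≡⟨ solve 5 (λ A B w g i → A :* i :* w :+ B :* i :* g := (A :* w :+ B :* g) :* i) refl A B w g i ⟩
      (A * w + B * g) * i      ≡⟨ cong (_* i) e ⟩
      s * D * i                ≡⟨ *-assoc s D i ⟩
      s * (D * i)              ≡⟨ cong (s *_) (proj₂ (inverse D D≢0)) ⟩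
      s * 1#                   ≡⟨ *-identityʳ s ⟩
      s                        ∎

  rotate-+ : ∀ a b c → b + c + a ≡ a + b + c
  rotate-+ a b c = trans (+-comm (b + c) a) (sym (+-assoc a b c))

  rotate : V₃ → V₃
  rotate (a ∷ b ∷ c ∷ []) = b ∷ c ∷ a ∷ []

  rotate-injective : ∀ v w → rotate v ≡ rotate w → v ≡ w
  rotate-injective (_ ∷ _ ∷ _ ∷ []) (_ ∷ _ ∷ _ ∷ []) refl = refl

  rotate-comb : ∀ a v b w → rotate (comb a v b w) ≡ comb a (rotate v) b (rotate w)
  rotate-comb a (_ ∷ _ ∷ _ ∷ []) b (_ ∷ _ ∷ _ ∷ []) = refl

  rotate-dot : ∀ v w → dot (rotate v) (rotate w) ≡ dot v w
  rotate-dot (a ∷ b ∷ c ∷ []) (x ∷ y ∷ z ∷ []) = rotate-+ (a * x) (b * y) (c * z)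

  rotate-cross : ∀ v w → cross (rotate v) (rotate w) ≡ rotate (cross v w)
  rotate-cross (_ ∷ _ ∷ _ ∷ []) (_ ∷ _ ∷ _ ∷ []) = refl

  -- Dot and cross products commute with cyclic shifts of the coordinates, so a property compatible
  -- with shifts may be proved assuming that the first coordinate is non-zero.
  nonzero-coordinate : (P : V₃ → Set) → (∀ {v} → P (rotate v) → P v) → (∀ {v} → Vec.head v ≢ 0# → P v) → ∀ {v} → v ≢ 𝟎 → P v
  nonzero-coordinate P unrotate base {a ∷ b ∷ c ∷ []} v≢𝟎 with a ≟ 0# | b ≟ 0# | c ≟ 0#
  ... | no a≢0   | _        | _        = base a≢0
  ... | yes refl | no b≢0   | _        = unrotate (base b≢0)
  ... | yes refl | yes refl | no c≢0   = unrotate (unrotate (base c≢0))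
  ... | yes refl | yes refl | yes refl = contradiction refl v≢𝟎

  -- The triple product vanishes because all three vectors lie in the plane f = 0.
  det≡0 : ∀ s w g {f} → f ≢ 𝟎 → dot f s ≡ 0# → dot f w ≡ 0# → dot f g ≡ 0# → dot s (cross w g) ≡ 0#
  det≡0 s w g f≢𝟎 fs fw fg = nonzero-coordinate P (λ {f} → unrot {f}) (λ {f} → base {f}) f≢𝟎 s w g fs fw fg
    where
    P : V₃ → Set
    P f = ∀ s w g → dot f s ≡ 0# → dot f w ≡ 0# → dot f g ≡ 0# → dot s (cross w g) ≡ 0#
    unrot : ∀ {f} → P (rotate f) → P f
    unrot {f} p s w g fs fw fg = begin
      dot s (cross w g)                                ≡⟨ rotate-dot s (cross w g) ⟨
      dot (rotate s) (rotate (cross w g))              ≡⟨ cong (dot (rotate s)) (rotate-cross w g) ⟨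
      dot (rotate s) (cross (rotate w) (rotate g))     ≡⟨ p (rotate s) (rotate w) (rotate g) (trans (rotate-dot f s) fs) (trans (rotate-dot f w) fw) (trans (rotate-dot f g) fg) ⟩
      0#                                               ∎
    base : ∀ {f} → Vec.head f ≢ 0# → P f
    base {f₀ ∷ f₁ ∷ f₂ ∷ []} f₀≢0 s@(s₀ ∷ s₁ ∷ s₂ ∷ []) w@(w₀ ∷ w₁ ∷ w₂ ∷ []) g@(g₀ ∷ g₁ ∷ g₂ ∷ []) fs fw fg = xy≡0⇒y≡0 f₀≢0 (begin
      -- With A, B, Δ the cofactors of the first coordinates, A s - B w + Δ g = (det, 0, 0): the
      -- other two entries are determinants with a repeated row. Applying f gives f₀ det = 0.
      f₀ * det                              ≡⟨ solve 3 (λ t f₁ f₂ → t := t :+ f₁ :* con (pos 0) :+ f₂ :* con (pos 0)) refl (f₀ * det) f₁ f₂ ⟩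
      dot f (det ∷ 0# ∷ 0# ∷ [])            ≡⟨ cong (dot f) (≡₃ e₀ (e s₁ w₁ g₁ s₂ w₂ g₂) (e′ s₁ w₁ g₁ s₂ w₂ g₂)) ⟩
      dot f (comb 1# (comb A s (- B) w) Δ g) ≡⟨ trans (dot-comb f 1# (comb A s (- B) w) Δ g) (cong (λ z → 1# * z + Δ * dot f g) (dot-comb f A s (- B) w)) ⟩
      1# * (A * dot f s + - B * dot f w) + Δ * dot f g
                                            ≡⟨ cong₂ (λ u v → 1# * u + Δ * v) (cong₂ (λ u v → A * u + - B * v) fs fw) fg ⟩
      1# * (A * 0# + - B * 0#) + Δ * 0#     ≡⟨ solve 3 (λ A B Δ → con (pos 1) :* (A :* con (pos 0) :+ :- B :* con (pos 0)) :+ Δ :* con (pos 0) := con (pos 0)) refl A B Δ ⟩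
      0#                                    ∎)
      where
      f = f₀ ∷ f₁ ∷ f₂ ∷ []
      det = dot s (cross w g)
      A = w₁ * g₂ + - (w₂ * g₁)
      B = s₁ * g₂ + - (s₂ * g₁)
      Δ = s₁ * w₂ + - (s₂ * w₁)
      e₀ : det ≡ 1# * (A * s₀ + - B * w₀) + Δ * g₀
      e₀ = begin
        s₀ * A + s₁ * (w₂ * g₀ + - (w₀ * g₂)) + s₂ * (w₀ * g₁ + - (w₁ * g₀))
          ≡⟨ solve 5 (λ p s₁ u s₂ v → p :+ s₁ :* u :+ s₂ :* v := p :+ (s₁ :* u :+ s₂ :* v)) refl (s₀ * A) s₁ _ s₂ _ ⟩
        s₀ * A + (s₁ * (w₂ * g₀ + - (w₀ * g₂)) + s₂ * (w₀ * g₁ + - (w₁ * g₀)))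
          ≡⟨ cong (s₀ * A +_) (solve 8 (λ w₀ g₀ s₁ w₁ g₁ s₂ w₂ g₂ →
               s₁ :* (w₂ :* g₀ :- w₀ :* g₂) :+ s₂ :* (w₀ :* g₁ :- w₁ :* g₀)
               := :- (s₁ :* g₂ :- s₂ :* g₁) :* w₀ :+ (s₁ :* w₂ :- s₂ :* w₁) :* g₀) refl w₀ g₀ s₁ w₁ g₁ s₂ w₂ g₂) ⟩
        s₀ * A + (- B * w₀ + Δ * g₀)
          ≡⟨ solve 4 (λ s₀ A u v → s₀ :* A :+ (u :+ v) := con (pos 1) :* (A :* s₀ :+ u) :+ v) refl s₀ A (- B * w₀) (Δ * g₀) ⟩
        1# * (A * s₀ + - B * w₀) + Δ * g₀ ∎
      e : ∀ s₁ w₁ g₁ s₂ w₂ g₂ → 0# ≡ 1# * ((w₁ * g₂ + - (w₂ * g₁)) * s₁ + - (s₁ * g₂ + - (s₂ * g₁)) * w₁) + (s₁ * w₂ + - (s₂ * w₁)) * g₁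
      e = solve 6 (λ s₁ w₁ g₁ s₂ w₂ g₂ → con (pos 0) := con (pos 1) :* ((w₁ :* g₂ :- w₂ :* g₁) :* s₁ :+ :- (s₁ :* g₂ :- s₂ :* g₁) :* w₁) :+ (s₁ :* w₂ :- s₂ :* w₁) :* g₁) refl
      e′ : ∀ s₁ w₁ g₁ s₂ w₂ g₂ → 0# ≡ 1# * ((w₁ * g₂ + - (w₂ * g₁)) * s₂ + - (s₁ * g₂ + - (s₂ * g₁)) * w₂) + (s₁ * w₂ + - (s₂ * w₁)) * g₂
      e′ = solve 6 (λ s₁ w₁ g₁ s₂ w₂ g₂ → con (pos 0) := con (pos 1) :* ((w₁ :* g₂ :- w₂ :* g₁) :* s₂ :+ :- (s₁ :* g₂ :- s₂ :* g₁) :* w₂) :+ (s₁ :* w₂ :- s₂ :* w₁) :* g₂) refl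

  -- Independent w and g span the plane f = 0, which contains s. Passing to P replaces f by the
  -- vanishing determinant, so that rotation can be driven by a non-zero entry of w × g.
  span : ∀ s w g {f} → f ≢ 𝟎 → dot f s ≡ 0# → dot f w ≡ 0# → dot f g ≡ 0# → cross w g ≢ 𝟎 →
         ∃ λ a → ∃ λ b → comb a w b g ≡ s
  span s w g f≢𝟎 fs fw fg indep = nonzero-coordinate P (λ {c} → unrot {c}) (λ {c} → base {c}) indep s w g refl (det≡0 s w g f≢𝟎 fs fw fg)
    where
    P : V₃ → Set
    P c = ∀ s w g → cross w g ≡ c → dot s (cross w g) ≡ 0# → ∃ λ a → ∃ λ b → comb a w b g ≡ s
    unrot : ∀ {c} → P (rotate c) → P c
    unrot p s w g refl det with a , b , e ← p (rotate s) (rotate w) (rotate g) (rotate-cross w g)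
        (trans (cong (dot (rotate s)) (rotate-cross w g)) (trans (rotate-dot s (cross w g)) det)) =
      a , b , rotate-injective _ _ (trans (rotate-comb a w b g) e)
    base : ∀ {c} → Vec.head c ≢ 0# → P c
    base c≢0 (s₀ ∷ s₁ ∷ s₂ ∷ []) (w₀ ∷ w₁ ∷ w₂ ∷ []) (g₀ ∷ g₁ ∷ g₂ ∷ []) refl det
      -- The head of w × g is the minor in coordinates 1 and 2, so Cramer's rule is used with the
      -- coordinates in the order 1, 2, 0.
      with a , b , e₁ , e₂ , e₀ ← cramer c≢0 (trans (rotate-+ _ _ _) det) = a , b , ≡₃ e₀ e₁ e₂

length-cartesianProductWith : ∀ {A B C : Set} (f : A → B → C) xs ys →
  List.length (List.cartesianProductWith f xs ys) ≡ List.length xs ℕ.* List.length ys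
length-cartesianProductWith f List.[]       ys = refl
length-cartesianProductWith f (x List.∷ xs) ys = trans (List.length-++ (List.map (f x) ys))
  (cong₂ ℕ._+_ (List.length-map (f x) ys) (length-cartesianProductWith f xs ys))

-- Lines over a subfield and two disjoint Baer subplanes

module Geometry {q} (K : FiniteField q) where
  open FiniteField K
  open Subfields K
  open LinearAlgebra K
  open ≡-Reasoning

  module _ {S} (subS : IsSubfield S) where
    private module S = IsSubfield subS

    cross-∈ : ∀ {v w} → All S v → All S w → All S (cross v w)
    cross-∈ (a ∷ b ∷ c ∷ []) (x ∷ y ∷ z ∷ []) = minor b z c y ∷ minor c x a z ∷ minor a y b x ∷ []
      where
      minor : ∀ {a b c d} → S a → S b → S c → S d → S (a * b + - (c * d))
      minor a b c d = S.+∈ (S.*∈ a b) (S.-∈ (S.*∈ c d))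

    comb-∈ : ∀ {n a b} {v w : Vec (Fin q) n} → S a → All S v → S b → All S w → All S (comb a v b w)
    comb-∈ a []      b []      = []
    comb-∈ a (x ∷ v) b (y ∷ w) = S.+∈ (S.*∈ a x) (S.*∈ b y) ∷ comb-∈ a v b w

    -- Normally the cross product. If it vanishes, (b, -a, 0) is orthogonal to v, and to w by the
    -- third entry of v × w = 0; likewise with v and w exchanged. If both of these candidates are 0,
    -- then v and w are multiples of the last unit vector, and the first unit vector serves.
    orthogonal : ∀ {v w} → All S v → All S w → ∃ λ f → All S f × f ≢ 𝟎 × dot f v ≡ 0# × dot f w ≡ 0#
    orthogonal {v@(a ∷ b ∷ c ∷ [])} {w@(x ∷ y ∷ z ∷ [])} v∈@(a∈ ∷ b∈ ∷ _) w∈@(x∈ ∷ y∈ ∷ _)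
      with cross v w ≟ᵛ 𝟎 | (b ∷ - a ∷ 0# ∷ []) ≟ᵛ 𝟎 | (y ∷ - x ∷ 0# ∷ []) ≟ᵛ 𝟎
    ... | no c≢𝟎 | _ | _ = cross v w , cross-∈ v∈ w∈ , c≢𝟎 ,
        solve 6 (λ a b c x y z → (b :* z :- c :* y) :* a :+ (c :* x :- a :* z) :* b :+ (a :* y :- b :* x) :* c := con (pos 0)) refl a b c x y z ,
        solve 6 (λ a b c x y z → (b :* z :- c :* y) :* x :+ (c :* x :- a :* z) :* y :+ (a :* y :- b :* x) :* z := con (pos 0)) refl a b c x y z
    ... | yes c≡𝟎 | no f≢𝟎 | _ = b ∷ - a ∷ 0# ∷ [] , b∈ ∷ S.-∈ a∈ ∷ S.0∈ ∷ [] , f≢𝟎 ,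
        solve 3 (λ a b c → b :* a :+ :- a :* b :+ con (pos 0) :* c := con (pos 0)) refl a b c ,
        trans (solve 5 (λ a b x y z → b :* x :+ :- a :* y :+ con (pos 0) :* z := :- (a :* y :- b :* x)) refl a b x y z)
          (trans (cong -_ (cong (λ { (_ ∷ _ ∷ t ∷ []) → t }) c≡𝟎)) (solve 0 (:- con (pos 0) := con (pos 0)) refl))
    ... | yes c≡𝟎 | yes _ | no f≢𝟎 = y ∷ - x ∷ 0# ∷ [] , y∈ ∷ S.-∈ x∈ ∷ S.0∈ ∷ [] , f≢𝟎 ,
        trans (solve 5 (λ a b c x y → y :* a :+ :- x :* b :+ con (pos 0) :* c := a :* y :- b :* x) refl a b c x y)
          (cong (λ { (_ ∷ _ ∷ t ∷ []) → t }) c≡𝟎) ,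
        solve 3 (λ a b c → b :* a :+ :- a :* b :+ con (pos 0) :* c := con (pos 0)) refl x y z
    ... | yes _ | yes v≡𝟎 | yes w≡𝟎 = 1# ∷ 0# ∷ 0# ∷ [] , S.1∈ ∷ S.0∈ ∷ S.0∈ ∷ [] , (λ e → 0≢1 (sym (cong Vec.head e))) ,
        first (cong (λ { (_ ∷ t ∷ _ ∷ []) → t }) v≡𝟎) , first (cong (λ { (_ ∷ t ∷ _ ∷ []) → t }) w≡𝟎)
      where
      first : ∀ {a b c} → - a ≡ 0# → 1# * a + 0# * b + 0# * c ≡ 0#
      first {a} {b} {c} e = trans
        (solve 3 (λ a b c → con (pos 1) :* a :+ con (pos 0) :* b :+ con (pos 0) :* c := :- (:- a)) refl a b c)
        (trans (cong -_ e) (solve 0 (:- con (pos 0) := con (pos 0)) refl))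

    -- The ratio can be read off at a non-zero coordinate of w, hence lies in S.
    parallel : ∀ {w g} → All S w → All S g → w ≢ 𝟎 → cross w g ≡ 𝟎 → ∃ λ c → S c × g ≡ c ∙ w
    parallel w∈ g∈ w≢𝟎 = nonzero-coordinate P (λ {w} → unrot {w}) (λ {w} → base {w}) w≢𝟎 w∈ g∈
      where
      P : V₃ → Set
      P w = ∀ {g} → All S w → All S g → cross w g ≡ 𝟎 → ∃ λ c → S c × g ≡ c ∙ w
      unrot : ∀ {w} → P (rotate w) → P w
      unrot {w@(_ ∷ _ ∷ _ ∷ [])} p {_ ∷ _ ∷ _ ∷ []} (w₀ ∷ w₁ ∷ w₂ ∷ []) (g₀ ∷ g₁ ∷ g₂ ∷ []) e
        with c , c∈ , e′ ← p (w₁ ∷ w₂ ∷ w₀ ∷ []) (g₁ ∷ g₂ ∷ g₀ ∷ []) (cong rotate e) = c , c∈ , rotate-injective _ _ e′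
      base : ∀ {w} → Vec.head w ≢ 0# → P w
      base {w₀ ∷ w₁ ∷ w₂ ∷ []} w₀≢0 {g₀ ∷ g₁ ∷ g₂ ∷ []} (w₀∈ ∷ _) (g₀∈ ∷ _) e with i , w₀i≡1 ← inverse w₀ w₀≢0 =
        g₀ * i , S.*∈ g₀∈ (S.⁻¹∈ w₀∈ w₀i≡1) ,
        ≡₃ (ratio (solve 2 (λ a b → a :* b := b :* a) refl w₀ g₀))
           (ratio (x-y≡0⇒x≡y (trans (cong (w₀ * g₁ +_) (cong -_ (*-comm g₀ w₁))) (cong (λ { (_ ∷ _ ∷ t ∷ []) → t }) e))))
           (ratio (sym (trans (*-comm g₀ w₂) (x-y≡0⇒x≡y (cong (λ { (_ ∷ t ∷ _ ∷ []) → t }) e)))))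
        where
        ratio : ∀ {g w} → w₀ * g ≡ g₀ * w → g ≡ g₀ * i * w
        ratio {g} {w} e = begin
          g                ≡⟨ *-identityˡ g ⟨
          1# * g           ≡⟨ cong (_* g) w₀i≡1 ⟨
          w₀ * i * g       ≡⟨ solve 3 (λ w i g → w :* i :* g := i :* (w :* g)) refl w₀ i g ⟩
          i * (w₀ * g)     ≡⟨ cong (i *_) e ⟩
          i * (g₀ * w)     ≡⟨ solve 3 (λ i g w → i :* (g :* w) := g :* i :* w) refl i g₀ w ⟩
          g₀ * i * w       ∎

    independent : ∀ {w} → w ≢ 𝟎 → ∃ λ w′ → All S w′ × w′ ≢ 𝟎 × cross w w′ ≢ 𝟎
    independent w≢𝟎 = nonzero-coordinate P (λ {w} → unrot {w}) (λ {w} → base {w}) w≢𝟎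
      where
      P : V₃ → Set
      P w = ∃ λ w′ → All S w′ × w′ ≢ 𝟎 × cross w w′ ≢ 𝟎
      unrot : ∀ {w} → P (rotate w) → P w
      unrot {_ ∷ _ ∷ _ ∷ []} (_ ∷ _ ∷ _ ∷ [] , a ∷ b ∷ c ∷ [] , w′≢𝟎 , indep) =
        _ ∷ _ ∷ _ ∷ [] , c ∷ a ∷ b ∷ [] , (λ e → w′≢𝟎 (cong rotate e)) , (λ e → indep (cong rotate e))
      base : ∀ {w} → Vec.head w ≢ 0# → P w
      base {a ∷ b ∷ c ∷ []} a≢0 = 0# ∷ 1# ∷ 0# ∷ [] , S.0∈ ∷ S.1∈ ∷ S.0∈ ∷ [] , (λ e → 0≢1 (sym (cong (λ { (_ ∷ t ∷ _ ∷ []) → t }) e))) ,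
        λ e → a≢0 (trans (solve 2 (λ a b → a := a :* con (pos 1) :- b :* con (pos 0)) refl a b) (cong (λ { (_ ∷ _ ∷ t ∷ []) → t }) e))

  decompose-vec : ∀ {S S′} (Q : QuadraticExtension S S′) {n} {v : Vec (Fin q) n} → All S′ v →
                  ∃ λ v₁ → ∃ λ v₂ → All S v₁ × All S v₂ × v ≡ comb 1# v₁ (QuadraticExtension.θ Q) v₂
  decompose-vec Q []      = [] , [] , [] , [] , refl
  decompose-vec Q (x∈ ∷ v∈)
    with a , b , a∈ , b∈ , refl ← QuadraticExtension.decompose Q x∈ | v₁ , v₂ , v₁∈ , v₂∈ , refl ← decompose-vec Q v∈ =
    a ∷ v₁ , b ∷ v₂ , a∈ ∷ v₁∈ , b∈ ∷ v₂∈ , cong (λ t → (t + QuadraticExtension.θ Q * b) ∷ comb 1# v₁ (QuadraticExtension.θ Q) v₂) (sym (*-identityˡ a))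

  module Planes {L E} (subL : IsSubfield L) (subE : IsSubfield E) (L⊆E : L ⊆ E)
                (E/L : QuadraticExtension L E) (K/E : QuadraticExtension E (λ _ → ⊤))
                {γ} (γ∈ : L γ) (irreducible : ∀ {t} → E t → t * t * t + - t ≢ γ) where
    private
      module L = IsSubfield subL
      module E = IsSubfield subE
      module E/L = QuadraticExtension E/L
      module K/E = QuadraticExtension K/E
      τ = E/L.θ

    L⊆Eᵛ : ∀ {n} {v : Vec (Fin q) n} → All L v → All E v
    L⊆Eᵛ = All.map L⊆E

    -- multiplication by t on K[t]/(t³ − t − γ) in the basis 1, t, t²
    Ω : V₃ → V₃
    Ω (a ∷ b ∷ c ∷ []) = γ * c ∷ a + c ∷ b ∷ []

    Ωᵀ : V₃ → V₃
    Ωᵀ (a ∷ b ∷ c ∷ []) = b ∷ c ∷ γ * a + b ∷ []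

    dot-Ω : ∀ f v → dot f (Ω v) ≡ dot (Ωᵀ f) v
    dot-Ω (a ∷ b ∷ c ∷ []) (x ∷ y ∷ z ∷ []) =
      solve 7 (λ γ a b c x y z → a :* (γ :* z) :+ b :* (x :+ z) :+ c :* y := b :* x :+ c :* y :+ (γ :* a :+ b) :* z) refl γ a b c x y z

    Ω-∈ : ∀ {v} → All L v → All L (Ω v)
    Ω-∈ (a ∷ b ∷ c ∷ []) = L.*∈ γ∈ c ∷ L.+∈ a c ∷ b ∷ []

    Ωᵀ-∈ : ∀ {v} → All E v → All E (Ωᵀ v)
    Ωᵀ-∈ (a ∷ b ∷ c ∷ []) = b ∷ c ∷ E.+∈ (E.*∈ (L⊆E γ∈) a) b ∷ []

    -- t³ - t - γ is the characteristic polynomial of Ω: eliminating x and y leaves (c³ - c - γ) z =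
    -- 0. The vector may have entries in all of K; only the eigenvalue has to lie in E.
    no-eigenvector : ∀ {c v} → E c → Ω v ≡ c ∙ v → v ≡ 𝟎
    no-eigenvector {c} {x ∷ y ∷ z ∷ []} c∈ e = ≡₃ x≡0 y≡0 z≡0
      where
      e₀ : γ * z ≡ c * x
      e₀ = cong Vec.head e
      e₁ : x + z ≡ c * y
      e₁ = cong (λ { (_ ∷ t ∷ _ ∷ []) → t }) e
      e₂ : y ≡ c * z
      e₂ = cong (λ { (_ ∷ _ ∷ t ∷ []) → t }) e
      x≡ : x ≡ c * y + - z
      x≡ = trans (solve 2 (λ x z → x := x :+ z :- z) refl x z) (cong (_+ - z) e₁)
      z≡0 : z ≡ 0#
      z≡0 = xy≡0⇒y≡0 (irreducible c∈ ∘ x-y≡0⇒x≡y) (begin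
        (c * c * c + - c + - γ) * z          ≡⟨ solve 3 (λ c γ z → (c :* c :* c :- c :- γ) :* z := c :* (c :* (c :* z) :- z) :- γ :* z) refl c γ z ⟩
        c * (c * (c * z) + - z) + - (γ * z)  ≡⟨ cong (λ t → c * (c * t + - z) + - (γ * z)) e₂ ⟨
        c * (c * y + - z) + - (γ * z)        ≡⟨ cong (λ t → c * t + - (γ * z)) x≡ ⟨
        c * x + - (γ * z)                    ≡⟨ cong (λ t → c * x + - t) e₀ ⟩
        c * x + - (c * x)                    ≡⟨ -‿inverseʳ _ ⟩
        0#                                   ∎)
      y≡0 : y ≡ 0#
      y≡0 = trans e₂ (trans (cong (c *_) z≡0) (zeroʳ c))
      x≡0 : x ≡ 0#
      x≡0 = trans x≡ (trans (cong₂ (λ u v → c * u + - v) y≡0 z≡0) (solve 1 (λ c → c :* con (pos 0) :- con (pos 0) := con (pos 0)) refl c))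

    M : V₃ → V₃
    M v = comb 1# v τ (Ω v)

    M-∈ : ∀ {v} → All L v → All E (M v)
    M-∈ v∈ = comb-∈ subE E.1∈ (L⊆Eᵛ v∈) E/L.θ∈ (L⊆Eᵛ (Ω-∈ v∈))

    M-∙ : ∀ c v → M (c ∙ v) ≡ c ∙ M v
    M-∙ c (x ∷ y ∷ z ∷ []) = ≡₃
      (solve 5 (λ c τ x γ z → con (pos 1) :* (c :* x) :+ τ :* (γ :* (c :* z)) := c :* (con (pos 1) :* x :+ τ :* (γ :* z))) refl c τ x γ z)
      (solve 5 (λ c τ x y z → con (pos 1) :* (c :* y) :+ τ :* (c :* x :+ c :* z) := c :* (con (pos 1) :* y :+ τ :* (x :+ z))) refl c τ x y z)
      (solve 4 (λ c τ y z → con (pos 1) :* (c :* z) :+ τ :* (c :* y) := c :* (con (pos 1) :* z :+ τ :* y)) refl c τ y z)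

    M-sub : ∀ v c w → M (comb 1# v (- c) w) ≡ comb 1# (M v) (- c) (M w)
    M-sub (x ∷ y ∷ z ∷ []) c (x′ ∷ y′ ∷ z′ ∷ []) = ≡₃
      (solve 7 (λ c τ γ x x′ z z′ → con (pos 1) :* (con (pos 1) :* x :+ :- c :* x′) :+ τ :* (γ :* (con (pos 1) :* z :+ :- c :* z′))
         := con (pos 1) :* (con (pos 1) :* x :+ τ :* (γ :* z)) :+ :- c :* (con (pos 1) :* x′ :+ τ :* (γ :* z′))) refl c τ γ x x′ z z′)
      (solve 8 (λ c τ x x′ y y′ z z′ → con (pos 1) :* (con (pos 1) :* y :+ :- c :* y′) :+ τ :* ((con (pos 1) :* x :+ :- c :* x′) :+ (con (pos 1) :* z :+ :- c :* z′))
         := con (pos 1) :* (con (pos 1) :* y :+ τ :* (x :+ z)) :+ :- c :* (con (pos 1) :* y′ :+ τ :* (x′ :+ z′))) refl c τ x x′ y y′ z z′)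
      (solve 6 (λ c τ y y′ z z′ → con (pos 1) :* (con (pos 1) :* z :+ :- c :* z′) :+ τ :* (con (pos 1) :* y :+ :- c :* y′)
         := con (pos 1) :* (con (pos 1) :* z :+ τ :* y) :+ :- c :* (con (pos 1) :* z′ :+ τ :* y′)) refl c τ y y′ z z′)

    τ≢0 : τ ≢ 0#
    τ≢0 τ≡0 = E/L.θ∉ (subst L (sym τ≡0) L.0∈)

    -- M v = 0 would make v an eigenvector of Ω with eigenvalue − 1 / τ.
    M-injective : ∀ {v} → M v ≡ 𝟎 → v ≡ 𝟎
    M-injective {v} Mv≡𝟎 with i , τi≡1 ← inverse τ τ≢0 =
      no-eigenvector (E.-∈ (E.⁻¹∈ E/L.θ∈ τi≡1)) (eigen v (Ω v) Mv≡𝟎)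
      where
      eigen : ∀ {n} (v w : Vec (Fin q) n) → comb 1# v τ w ≡ 𝟎 → w ≡ (- i) ∙ v
      eigen []      []      _ = refl
      eigen (x ∷ v) (y ∷ w) e with e₀ , e₁ ← ∷-injective e = cong₂ _∷_ (begin
        y                                        ≡⟨ *-identityˡ y ⟨
        1# * y                                   ≡⟨ cong (_* y) τi≡1 ⟨
        τ * i * y                                ≡⟨ solve 4 (λ τ i x y → τ :* i :* y := i :* (con (pos 1) :* x :+ τ :* y) :+ :- i :* x) refl τ i x y ⟩
        i * (1# * x + τ * y) + - i * x           ≡⟨ cong (λ t → i * t + - i * x) e₀ ⟩
        i * 0# + - i * x                         ≡⟨ solve 2 (λ i x → i :* con (pos 0) :+ :- i :* x := :- i :* x) refl i x ⟩
        - i * x                                  ∎) (eigen v w e₁)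

    -- M v = c M w means M (v - c w) = 0, so v = c w even for c outside L.
    M-independent : ∀ {v w} c → cross v w ≢ 𝟎 → M v ≢ c ∙ M w
    M-independent {v} {w} c indep Mv≡cMw = indep (trans (cong (λ u → cross u w) v≡cw) (cross-∙ˡ c w))
      where
      cancel : ∀ {n} c (w : Vec (Fin q) n) → comb 1# (c ∙ w) (- c) w ≡ 𝟎
      cancel c []      = refl
      cancel c (x ∷ w) = cong₂ _∷_ (solve 2 (λ c x → con (pos 1) :* (c :* x) :+ :- c :* x := con (pos 0)) refl c x) (cancel c w)
      v≡cw : v ≡ c ∙ w
      v≡cw = v-w≡𝟎⇒v≡w c v w (M-injective (trans (M-sub v c w)
        (trans (cong (λ u → comb 1# u (- c) (M w)) Mv≡cMw) (cancel c (M w)))))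

    -- The Baer subplanes PG(2, L) and M PG(2, L) are disjoint: M v = (l₀ + τ l₁) w with v, w over L
    -- gives v = l₀ w and Ω v = l₁ w, so v is an eigenvector of Ω.
    disjoint : ∀ {w v} → All L w → All L v → w ≢ 𝟎 → v ≢ 𝟎 → cross w (M v) ≢ 𝟎
    disjoint {w} {v} w∈ v∈ w≢𝟎 v≢𝟎 cross≡𝟎
      with c , c∈ , Mv≡cw ← parallel subE (L⊆Eᵛ w∈) (M-∈ v∈) w≢𝟎 cross≡𝟎
      with l₀ , l₁ , l₀∈ , l₁∈ , refl ← E/L.decompose c∈ = v≢𝟎 (no-eigenvector (L⊆E (L.*∈ l₁∈ (L.⁻¹∈ l₀∈ l₀i≡1))) eigen)
      where
      compare : ∀ {n} {v u w : Vec (Fin q) n} → All L v → All L u → All L w →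
                comb 1# v τ u ≡ (l₀ + τ * l₁) ∙ w → v ≡ l₀ ∙ w × u ≡ l₁ ∙ w
      compare []       []       []       _ = refl , refl
      compare {v = x ∷ _} {y ∷ _} {z ∷ _} (x∈ ∷ v∈) (y∈ ∷ u∈) (z∈ ∷ w∈) e
        with e₀ , e₁ ← ∷-injective e
        with x≡ , y≡ ← E/L.unique x∈ y∈ (L.*∈ l₀∈ z∈) (L.*∈ l₁∈ z∈)
               (trans (solve 3 (λ x τ y → x :+ τ :* y := con (pos 1) :* x :+ τ :* y) refl x τ y)
                 (trans e₀ (solve 4 (λ a τ b z → (a :+ τ :* b) :* z := a :* z :+ τ :* (b :* z)) refl l₀ τ l₁ z)))
           | v≡ , u≡ ← compare v∈ u∈ w∈ e₁ = cong₂ _∷_ x≡ v≡ , cong₂ _∷_ y≡ u≡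
      both = compare v∈ (Ω-∈ v∈) w∈ Mv≡cw
      l₀≢0 : l₀ ≢ 0#
      l₀≢0 l₀≡0 = v≢𝟎 (trans (proj₁ both) (trans (cong (_∙ w) l₀≡0) (0∙ w)))
      i = proj₁ (inverse l₀ l₀≢0)
      l₀i≡1 = proj₂ (inverse l₀ l₀≢0)
      scale : ∀ {n} (w : Vec (Fin q) n) → l₁ ∙ w ≡ (l₁ * i) ∙ l₀ ∙ w
      scale []      = refl
      scale (x ∷ w) = cong₂ _∷_ (begin
        l₁ * x               ≡⟨ cong (_* x) (sym (trans (cong (l₁ *_) l₀i≡1) (*-identityʳ l₁))) ⟩
        l₁ * (l₀ * i) * x    ≡⟨ solve 4 (λ a b i x → a :* (b :* i) :* x := a :* i :* (b :* x)) refl l₁ l₀ i x ⟩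
        l₁ * i * (l₀ * x)    ∎) (scale w)
      eigen : Ω v ≡ (l₁ * i) ∙ v
      eigen = trans (proj₂ both) (trans (scale w) (cong ((l₁ * i) ∙_) (sym (proj₁ both))))

    dot-split : ∀ {f₁ f₂ v} → dot v f₁ ≡ 0# → dot v f₂ ≡ 0# → dot (comb 1# f₁ τ f₂) v ≡ 0#
    dot-split {f₁} {f₂} {v} e₁ e₂ = begin
      dot (comb 1# f₁ τ f₂) v        ≡⟨ dot-comm (comb 1# f₁ τ f₂) v ⟩
      dot v (comb 1# f₁ τ f₂)        ≡⟨ dot-comb v 1# f₁ τ f₂ ⟩
      1# * dot v f₁ + τ * dot v f₂   ≡⟨ cong₂ (λ a b → 1# * a + τ * b) e₁ e₂ ⟩
      1# * 0# + τ * 0#               ≡⟨ solve 1 (λ τ → con (pos 1) :* con (pos 0) :+ τ :* con (pos 0) := con (pos 0)) refl τ ⟩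
      0#                             ∎

    -- A common zero over L of both components of f = f₁ + τ f₂ is a zero of f.
    point₁ : ∀ {f} → All E f → ∃ λ w → All L w × w ≢ 𝟎 × dot f w ≡ 0#
    point₁ f∈ with f₁ , f₂ , f₁∈ , f₂∈ , refl ← decompose-vec E/L f∈
              with w , w∈ , w≢𝟎 , e₁ , e₂ ← orthogonal subL f₁∈ f₂∈ = w , w∈ , w≢𝟎 , dot-split {v = w} e₁ e₂

    -- The pullback f + τ Ωᵀ f of f under M again has coefficients in E, so the first case applies
    -- to it.
    point₂ : ∀ {f} → All E f → ∃ λ v → All L v × v ≢ 𝟎 × dot f (M v) ≡ 0#
    point₂ {f} f∈ with v , v∈ , v≢𝟎 , e ← point₁ (comb-∈ subE E.1∈ f∈ E/L.θ∈ (Ωᵀ-∈ f∈)) = v , v∈ , v≢𝟎 , (begin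
      dot f (M v)                      ≡⟨ dot-comb f 1# v τ (Ω v) ⟩
      1# * dot f v + τ * dot f (Ω v)   ≡⟨ cong (λ t → 1# * dot f v + τ * t) (dot-Ω f v) ⟩
      1# * dot f v + τ * dot (Ωᵀ f) v  ≡⟨ cong₂ (λ a b → 1# * a + τ * b) (dot-comm f v) (dot-comm (Ωᵀ f) v) ⟩
      1# * dot v f + τ * dot v (Ωᵀ f)  ≡⟨ dot-comb v 1# f τ (Ωᵀ f) ⟨
      dot v (comb 1# f τ (Ωᵀ f))       ≡⟨ dot-comm v _ ⟩
      dot (comb 1# f τ (Ωᵀ f)) v       ≡⟨ e ⟩
      0#                               ∎)

    -- Both coefficients are required to be non-zero because the lifting to higher codimension
    -- divides by each of them.
    Split : V₃ → Set
    Split s = ∃ λ a → ∃ λ w → ∃ λ b → ∃ λ v → a ≢ 0# × b ≢ 0# × All L w × All L v × w ≢ 𝟎 × v ≢ 𝟎 × comb a w b (M v) ≡ s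

    split-∙ : ∀ {c s} → c ≢ 0# → Split s → Split (c ∙ s)
    split-∙ c≢0 (a , w , b , v , a≢0 , b≢0 , w∈ , v∈ , w≢𝟎 , v≢𝟎 , refl) =
      _ , w , _ , v , xy≢0 c≢0 a≢0 , xy≢0 c≢0 b≢0 , w∈ , v∈ , w≢𝟎 , v≢𝟎 , sym (∙-comb _ a b w (M v))

    -- The line through a point and a second point of the same Baer subplane also meets the other one.
    split₁ : ∀ {w} → All L w → w ≢ 𝟎 → Split w
    split₁ {w} w∈ w≢𝟎
      with w′ , w′∈ , w′≢𝟎 , indep ← independent subL w≢𝟎
      with f , f∈ , f≢𝟎 , fw , fw′ ← orthogonal subE (L⊆Eᵛ w∈) (L⊆Eᵛ w′∈)
      with v , v∈ , v≢𝟎 , fv ← point₂ f∈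
      with a , b , e ← span w w′ (M v) f≢𝟎 fw fw′ fv (disjoint w′∈ v∈ w′≢𝟎 v≢𝟎)
      -- b = 0 would make w a multiple of `w′`, and a = 0 would put w into the other subplane.
      with a ≟ 0# | b ≟ 0#
    ... | no a≢0 | no b≢0 = a , w′ , b , v , a≢0 , b≢0 , w′∈ , v∈ , w′≢𝟎 , v≢𝟎 , e
    ... | _ | yes refl = contradiction (trans (cong (λ u → cross u w′) (trans (sym e) (comb-0ʳ a w′ (M v)))) (cross-∙ˡ a w′)) indep
    ... | yes refl | _ = contradiction (trans (cong (λ u → cross u (M v)) (trans (sym e) (comb-0ˡ b w′ (M v)))) (cross-∙ˡ b (M v)))
                           (disjoint w∈ v∈ w≢𝟎 v≢𝟎)

    split₂ : ∀ {v} → All L v → v ≢ 𝟎 → Split (M v)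
    split₂ {v} v∈ v≢𝟎
      with v′ , v′∈ , v′≢𝟎 , indep ← independent subL v≢𝟎
      with f , f∈ , f≢𝟎 , fv , fv′ ← orthogonal subE (M-∈ v∈) (M-∈ v′∈)
      with w , w∈ , w≢𝟎 , fw ← point₁ f∈
      with a , b , e ← span (M v) w (M v′) f≢𝟎 fv fw fv′ (disjoint w∈ v′∈ w≢𝟎 v′≢𝟎)
      with a ≟ 0# | b ≟ 0#
    ... | no a≢0 | no b≢0 = a , w , b , v′ , a≢0 , b≢0 , w∈ , v′∈ , w≢𝟎 , v′≢𝟎 , e
    ... | _ | yes refl = contradiction (trans (cong (cross w) (trans (sym e) (comb-0ʳ a w (M v′)))) (cross-∙ʳ a w))
                           (disjoint w∈ v∈ w≢𝟎 v≢𝟎)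
    ... | yes refl | _ = contradiction (trans (sym e) (comb-0ˡ b w (M v′))) (M-independent b indep)

    -- If one coefficient vanishes, s is a multiple of a point of one subplane, and that point is
    -- split along another line.
    split-comb : ∀ {s w v} a b → s ≢ 𝟎 → All L w → w ≢ 𝟎 → All L v → v ≢ 𝟎 → comb a w b (M v) ≡ s → Split s
    split-comb {s} {w} {v} a b s≢𝟎 w∈ w≢𝟎 v∈ v≢𝟎 e with a ≟ 0# | b ≟ 0#
    ... | no a≢0 | no b≢0 = a , w , b , v , a≢0 , b≢0 , w∈ , v∈ , w≢𝟎 , v≢𝟎 , e
    ... | yes refl | yes refl = contradiction (trans (sym e) (trans (comb-0ˡ 0# w (M v)) (0∙ (M v)))) s≢𝟎
    ... | yes refl | no b≢0 = subst Split (trans (sym (comb-0ˡ b w (M v))) e) (split-∙ b≢0 (split₂ v∈ v≢𝟎))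
    ... | no a≢0 | yes refl = subst Split (trans (sym (comb-0ʳ a w (M v))) e) (split-∙ a≢0 (split₁ w∈ w≢𝟎))

    dot-K/E : ∀ {f s₁ s₂} → dot f s₁ ≡ 0# → dot f s₂ ≡ 0# → dot f (comb 1# s₁ K/E.θ s₂) ≡ 0#
    dot-K/E {f} {s₁} {s₂} e₁ e₂ = trans (dot-comb f 1# s₁ K/E.θ s₂)
      (trans (cong₂ (λ a b → 1# * a + K/E.θ * b) e₁ e₂)
        (solve 1 (λ t → con (pos 1) :* con (pos 0) :+ t :* con (pos 0) := con (pos 0)) refl K/E.θ))

    -- Every point of PG(2, K) lies on a line defined over E, which meets both Baer subplanes.
    split : ∀ {s} → s ≢ 𝟎 → Split s
    split {s} s≢𝟎
      with s₁ , s₂ , s₁∈ , s₂∈ , s≡ ← decompose-vec K/E (All.universal _ s)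
      with f , f∈ , f≢𝟎 , fs₁ , fs₂ ← orthogonal subE s₁∈ s₂∈
      with w , w∈ , w≢𝟎 , fw ← point₁ f∈ | v , v∈ , v≢𝟎 , fv ← point₂ f∈
      with a , b , e ← span s w (M v) f≢𝟎 (trans (cong (dot f) s≡) (dot-K/E {f} {s₁} fs₁ fs₂)) fw fv (disjoint w∈ v∈ w≢𝟎 v≢𝟎) =
      split-comb a b s≢𝟎 w∈ w≢𝟎 v∈ v≢𝟎 e

    module _ (listL : Listing L) where
      private module listL = Listing listL

      elements : List (Fin q)
      elements = List.map listL.elem (List.allFin listL.size)

      ∈-elements : ∀ {x} → L x → x ∈ elements
      ∈-elements x∈ = subst (_∈ elements) (listL.elem-index x∈) (∈-map⁺ listL.elem (∈-allFin (listL.index x∈)))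

      affine infinite : List V₃
      affine   = List.cartesianProductWith (λ y z → 1# ∷ y ∷ z ∷ []) elements elements
      infinite = List.map (λ z → 0# ∷ 1# ∷ z ∷ []) elements

      -- Representatives whose first non-zero coordinate is 1. Their leading coordinate is therefore
      -- 0 or 1, and `points-heads` provides both values as ε for the chords.
      points : List V₃
      points = affine List.++ infinite List.++ List.[ 0# ∷ 0# ∷ 1# ∷ [] ]

      length-elements : List.length elements ≡ listL.size
      length-elements = trans (List.length-map listL.elem (List.allFin listL.size)) (List.length-tabulate {n = listL.size} (λ i → i))

      length-points : List.length points ≡ listL.size ℕ.* listL.size ℕ.+ (listL.size ℕ.+ 1)
      length-points = trans (List.length-++ affine) (cong₂ ℕ._+_
        (trans (length-cartesianProductWith _ elements elements) (cong₂ ℕ._*_ length-elements length-elements))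
        (trans (List.length-++ infinite) (cong (ℕ._+ 1) (trans (List.length-map _ elements) length-elements))))

      normalise : ∀ {w} → All L w → w ≢ 𝟎 → ∃ λ c → ∃ λ p → c ≢ 0# × p ∈ points × w ≡ c ∙ p
      normalise {a ∷ b ∷ c ∷ []} (a∈ ∷ b∈ ∷ c∈ ∷ []) w≢𝟎 with a ≟ 0# | b ≟ 0# | c ≟ 0#
      ... | yes refl | yes refl | yes refl = contradiction refl w≢𝟎
      ... | yes refl | yes refl | no c≢0 = c , _ , c≢0 ,
          ∈-++⁺ʳ affine (∈-++⁺ʳ infinite (here refl)) , ≡₃ (sym (zeroʳ c)) (sym (zeroʳ c)) (sym (*-identityʳ c))
      ... | yes refl | no b≢0 | _ with i , bi≡1 ← inverse b b≢0 = b , _ , b≢0 ,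
          ∈-++⁺ʳ affine (∈-++⁺ˡ (∈-map⁺ (λ z → 0# ∷ 1# ∷ z ∷ []) (∈-elements (L.*∈ c∈ (L.⁻¹∈ b∈ bi≡1))))) ,
          ≡₃ (sym (zeroʳ b)) (sym (*-identityʳ b)) (divide bi≡1)
        where
        divide : ∀ {b c i} → b * i ≡ 1# → c ≡ b * (c * i)
        divide {b} {c} {i} bi≡1 = sym (trans (solve 3 (λ b c i → b :* (c :* i) := c :* (b :* i)) refl b c i) (trans (cong (c *_) bi≡1) (*-identityʳ c)))
      ... | no a≢0 | _ | _ with i , ai≡1 ← inverse a a≢0 = a , _ , a≢0 ,
          ∈-++⁺ˡ (∈-cartesianProductWith⁺ (λ y z → 1# ∷ y ∷ z ∷ []) (∈-elements (L.*∈ b∈ (L.⁻¹∈ a∈ ai≡1))) (∈-elements (L.*∈ c∈ (L.⁻¹∈ a∈ ai≡1)))) ,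
          ≡₃ (sym (*-identityʳ a)) (divide ai≡1) (divide ai≡1)
        where
        divide : ∀ {b c i} → b * i ≡ 1# → c ≡ b * (c * i)
        divide {b} {c} {i} bi≡1 = sym (trans (solve 3 (λ b c i → b :* (c :* i) := c :* (b :* i)) refl b c i) (trans (cong (c *_) bi≡1) (*-identityʳ c)))

      split-points : ∀ {s} → s ≢ 𝟎 → ∃ λ a → ∃ λ w → ∃ λ b → ∃ λ v →
                     a ≢ 0# × b ≢ 0# × w ∈ points × v ∈ points × comb a w b (M v) ≡ s
      split-points s≢𝟎 with a , w , b , v , a≢0 , b≢0 , w∈ , v∈ , w≢𝟎 , v≢𝟎 , e ← split s≢𝟎
        with c , w′ , c≢0 , w′∈ , refl ← normalise w∈ w≢𝟎 | d , v′ , d≢0 , v′∈ , refl ← normalise v∈ v≢𝟎 =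
        a * c , w′ , b * d , v′ , xy≢0 a≢0 c≢0 , xy≢0 b≢0 d≢0 , w′∈ , v′∈ ,
        trans (sym (comb-∙ a c b d w′ (M v′))) (trans (cong (comb a (c ∙ w′) b) (sym (M-∙ d v′))) e)

      points-heads : ∀ {ε} → ε ≡ 0# ⊎ ε ≡ 1# → ∃ λ v → v ∈ points × Vec.head v ≡ ε
      points-heads (inj₁ refl) = 0# ∷ 0# ∷ 1# ∷ [] , ∈-++⁺ʳ affine (∈-++⁺ʳ infinite (here refl)) , refl
      points-heads (inj₂ refl) = 1# ∷ 0# ∷ 0# ∷ [] ,
        ∈-++⁺ˡ (∈-cartesianProductWith⁺ (λ y z → 1# ∷ y ∷ z ∷ []) (∈-elements L.0∈) (∈-elements L.0∈)) , refl

-- Lifting to higher codimension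

-- Unlike `2 * n` this computes to two successors, so vectors of this length can be matched pair by
-- pair.
double : ℕ → ℕ
double zero    = zero
double (suc n) = suc (suc (double n))

module Lifting {q} (K : FiniteField q) where
  open FiniteField K
  open LinearAlgebra K
  open ≡-Reasoning

  -- Coefficients may be 0 and g, h may coincide, so combinations of fewer than two columns are
  -- included.
  Covered : ∀ {r} → List (Vec (Fin q) r) → Vec (Fin q) r → Set
  Covered cols s = ∃ λ a → ∃ λ g → ∃ λ b → ∃ λ h → g ∈ cols × h ∈ cols × comb a g b h ≡ s

  vectors : ∀ n → List (Vec (Fin q) n)
  vectors zero    = List.[ [] ]
  vectors (suc n) = List.cartesianProductWith _∷_ (List.allFin q) (vectors n)

  ∈-vectors : ∀ {n} (v : Vec (Fin q) n) → v ∈ vectors n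
  ∈-vectors []      = here refl
  ∈-vectors (x ∷ v) = ∈-cartesianProductWith⁺ _∷_ (∈-allFin x) (∈-vectors v)

  length-vectors : ∀ n → List.length (vectors n) ≡ q ℕ.^ n
  length-vectors zero    = refl
  length-vectors (suc n) = trans (length-cartesianProductWith _∷_ (List.allFin q) (vectors n))
    (cong₂ ℕ._*_ (List.length-tabulate {n = q} (λ i → i)) (length-vectors n))

  comb-++ : ∀ {m n} a b (v w : Vec (Fin q) m) (x y : Vec (Fin q) n) →
            comb a (v Vec.++ x) b (w Vec.++ y) ≡ comb a v b w Vec.++ comb a x b y
  comb-++ a b []      []      x y = refl
  comb-++ a b (s ∷ v) (t ∷ w) x y = cong (_ ∷_) (comb-++ a b v w x y)

  comb-self : ∀ {n} c (v : Vec (Fin q) n) → comb c v (- c) v ≡ 𝟎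
  comb-self c []      = refl
  comb-self c (x ∷ v) = cong₂ _∷_ (solve 2 (λ c x → c :* x :+ :- c :* x := con (pos 0)) refl c x) (comb-self c v)

  divide : ∀ {a} → a ≢ 0# → ∀ b → ∃ λ x → a * x ≡ b
  divide {a} a≢0 b with i , ai≡1 ← inverse a a≢0 = i * b , trans (sym (*-assoc a i b)) (trans (cong (_* b) ai≡1) (*-identityˡ b))

  -- Vectors of length 2m are read as m consecutive pairs (uᵢ, vᵢ).
  vertical : ∀ {m} → Vec (Fin q) m → Vec (Fin q) (double m)
  vertical []      = []
  vertical (ξ ∷ v) = 0# ∷ ξ ∷ vertical v

  linear : ∀ {m} → Fin q → Vec (Fin q) m → Vec (Fin q) (double m)
  linear y []      = []
  linear y (η ∷ v) = η ∷ y * η ∷ linear y v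

  -- The first pair lies on the parabola v = ε u², and its parameter η is the slope of the line on
  -- which all further pairs lie.
  quadratic : ∀ {m} → Fin q → Vec (Fin q) m → Vec (Fin q) (double m)
  quadratic ε []      = []
  quadratic ε (η ∷ v) = η ∷ ε * (η * η) ∷ linear η v

  -- A triangular system: the first equation gives η whatever f is, and then the second is linear in
  -- ξ.
  solve-pair : ∀ {a b} → a ≢ 0# → b ≢ 0# → ∀ (f : Fin q → Fin q) u v → ∃ λ ξ → ∃ λ η → a * 0# + b * η ≡ u × a * ξ + b * f η ≡ v
  solve-pair {a} {b} a≢0 b≢0 f u v with η , bη≡u ← divide b≢0 u with ξ , aξ≡ ← divide a≢0 (v + - (b * f η)) =
    ξ , η , trans (solve 2 (λ a t → a :* con (pos 0) :+ t := t) refl a (b * η)) bη≡u ,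
    trans (cong (_+ b * f η) aξ≡) (solve 2 (λ v t → v :- t :+ t := v) refl v (b * f η))

  vertical+linear : ∀ {m a b} → a ≢ 0# → b ≢ 0# → ∀ y (w : Vec (Fin q) (double m)) →
                    ∃ λ ξ → ∃ λ η → comb a (vertical {m} ξ) b (linear y η) ≡ w
  vertical+linear {zero}  a≢0 b≢0 y []          = [] , [] , refl
  vertical+linear {suc m} a≢0 b≢0 y (u ∷ v ∷ w)
    with ξ , η , e₁ , e₂ ← solve-pair a≢0 b≢0 (y *_) u v | ξs , ηs , e ← vertical+linear {m} a≢0 b≢0 y w =
    ξ ∷ ξs , η ∷ ηs , cong₂ _∷_ e₁ (cong₂ _∷_ e₂ e)

  -- The first pair already determines η, so for the remaining pairs the slope is a known constant.
  vertical+quadratic : ∀ {m a b} → a ≢ 0# → b ≢ 0# → ∀ ε (w : Vec (Fin q) (double m)) →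
                       ∃ λ ξ → ∃ λ η → comb a (vertical {m} ξ) b (quadratic ε η) ≡ w
  vertical+quadratic {zero}  a≢0 b≢0 ε []          = [] , [] , refl
  vertical+quadratic {suc m} a≢0 b≢0 ε (u ∷ v ∷ w)
    with ξ , η , e₁ , e₂ ← solve-pair a≢0 b≢0 (λ η → ε * (η * η)) u v
    with ξs , ηs , e ← vertical+linear {m} a≢0 b≢0 η w =
    ξ ∷ ξs , η ∷ ηs , cong₂ _∷_ e₁ (cong₂ _∷_ e₂ e)

  -- For each pair the system in (η, η′) has determinant c² σ. The slope 0 of the second column
  -- makes it triangular.
  linear-linear : ∀ {m c σ} → c ≢ 0# → σ ≢ 0# → (w : Vec (Fin q) (double m)) →
                  ∃ λ η → ∃ λ η′ → comb c (linear {m} σ η) (- c) (linear 0# η′) ≡ w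
  linear-linear {zero}              c≢0 σ≢0 []          = [] , [] , refl
  linear-linear {suc m} {c} {σ} c≢0 σ≢0 (u ∷ v ∷ w)
    with η , cση≡v ← divide (xy≢0 c≢0 σ≢0) v | d , cd≡u ← divide c≢0 u | ηs , ηs′ , e ← linear-linear {m} c≢0 σ≢0 w =
    η ∷ ηs , η + - d ∷ ηs′ , cong₂ _∷_
      (trans (solve 3 (λ c η d → c :* η :+ :- c :* (η :- d) := c :* d) refl c η d) cd≡u) (cong₂ _∷_
      (trans (solve 4 (λ c σ η d → c :* (σ :* η) :+ :- c :* (con (pos 0) :* (η :- d)) := c :* σ :* η) refl c σ η d) cση≡v) e)

  -- The chord from 0 to σ of the graph of η ↦ ε η² has slope ε σ, so ε = 1 yields all non-zero
  -- slopes and ε = 0 the slope 0.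
  quadratic-chord : ∀ {m u} → u ≢ 0# → ∀ v (w : Vec (Fin q) (double m)) →
                    ∃ λ ε → (ε ≡ 0# ⊎ ε ≡ 1#) × ∃ λ c → ∃ λ η → ∃ λ η′ →
                    comb c (quadratic {suc m} ε η) (- c) (quadratic ε η′) ≡ u ∷ v ∷ w
  quadratic-chord {m} {u} u≢0 v w with v ≟ 0#
  -- With ε = 0 the first pair only has to produce u, so parameters 1 and 0 do with c = u; their
  -- difference 1 keeps the remaining pairs solvable.
  ... | yes refl with ηs , ηs′ , e ← linear-linear {m} u≢0 (0≢1 ∘ sym) w =
    0# , inj₁ refl , u , 1# ∷ ηs , 0# ∷ ηs′ , cong₂ _∷_
      (solve 1 (λ c → c :* con (pos 1) :+ :- c :* con (pos 0) := c) refl u) (cong₂ _∷_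
      (solve 1 (λ c → c :* (con (pos 0) :* (con (pos 1) :* con (pos 1))) :+ :- c :* (con (pos 0) :* (con (pos 0) :* con (pos 0))) := con (pos 0)) refl u) e)
  ... | no v≢0
    -- The chord must have direction (u, v), so σ = v / u; as it joins (0, 0) to (σ, σ²), the scale
    -- is c = u / σ.
    with σ , uσ≡v ← divide u≢0 v
    with σ≢0 ← (λ { refl → v≢0 (trans (sym uσ≡v) (zeroʳ u)) })
    with c , σc≡u ← divide σ≢0 u
    with c≢0 ← (λ { refl → u≢0 (trans (sym σc≡u) (zeroʳ σ)) })
    with ηs , ηs′ , e ← linear-linear {m} c≢0 σ≢0 w =
    1# , inj₂ refl , c , σ ∷ ηs , 0# ∷ ηs′ , cong₂ _∷_
      (trans (solve 2 (λ c σ → c :* σ :+ :- c :* con (pos 0) := σ :* c) refl c σ) σc≡u) (cong₂ _∷_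
      (trans (solve 2 (λ c σ → c :* (con (pos 1) :* (σ :* σ)) :+ :- c :* (con (pos 1) :* (con (pos 0) :* con (pos 0))) := σ :* c :* σ) refl c σ)
        (trans (cong (_* σ) σc≡u) uσ≡v)) e)

  module _ (points : List V₃) (M : V₃ → V₃)
           (split : ∀ {s} → s ≢ 𝟎 → ∃ λ a → ∃ λ w → ∃ λ b → ∃ λ v →
                    a ≢ 0# × b ≢ 0# × w ∈ points × v ∈ points × comb a w b (M v) ≡ s)
           (heads : ∀ {ε} → ε ≡ 0# ⊎ ε ≡ 1# → ∃ λ v → v ∈ points × Vec.head v ≡ ε) where

    colA colB : ∀ {m} → V₃ → Vec (Fin q) m → Vec (Fin q) (suc (double (suc m)))
    colA w ξ = w Vec.++ vertical ξ
    colB v η = M v Vec.++ quadratic (Vec.head v) η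

    colsA colsB : ∀ m → List (Vec (Fin q) (suc (double (suc m))))
    colsA m = List.cartesianProductWith colA points (vectors m)
    colsB m = List.cartesianProductWith colB points (vectors m)

    -- The columns below the two families cover the syndromes (0, 0, 0, 0, *, …, *) not reached by a chord.
    columns : ∀ t → List (Vec (Fin q) (suc (double t)))
    columns zero          = List.[ 1# ∷ [] ]
    columns (suc zero)    = colsA 0 List.++ colsB 0
    columns (suc (suc t)) = (colsA (suc t) List.++ colsB (suc t)) List.++
                            List.map (λ g → 0# ∷ 0# ∷ 0# ∷ 0# ∷ g) (columns t)

    covered-mono : ∀ {r} {cols cols′ : List (Vec (Fin q) r)} → (∀ {g} → g ∈ cols → g ∈ cols′) → ∀ {s} → Covered cols s → Covered cols′ s
    covered-mono sub (a , g , b , h , g∈ , h∈ , e) = a , g , b , h , sub g∈ , sub h∈ , e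

    covered-≢𝟎 : ∀ {m} s (w : Vec (Fin q) (double m)) → s ≢ 𝟎 → Covered (colsA m List.++ colsB m) (s Vec.++ w)
    covered-≢𝟎 {m} s w s≢𝟎
      with a , p , b , v , a≢0 , b≢0 , p∈ , v∈ , e ← split s≢𝟎
      with ξ , η , e′ ← vertical+quadratic {m} a≢0 b≢0 (Vec.head v) w =
      a , colA p ξ , b , colB v η ,
      ∈-++⁺ˡ (∈-cartesianProductWith⁺ colA p∈ (∈-vectors ξ)) ,
      ∈-++⁺ʳ (colsA m) (∈-cartesianProductWith⁺ colB v∈ (∈-vectors η)) ,
      trans (comb-++ a b p (M v) (vertical ξ) (quadratic (Vec.head v) η)) (cong₂ Vec._++_ e e′)

    covered-chord : ∀ {m} u v (w : Vec (Fin q) (double m)) → u ≢ 0# → Covered (colsA (suc m) List.++ colsB (suc m)) (𝟎 {3} Vec.++ (u ∷ v ∷ w))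
    covered-chord {m} u v w u≢0
      with ε , ε∈ , c , η , η′ , e ← quadratic-chord {m} u≢0 v w
      with p , p∈ , refl ← heads ε∈ =
      c , colB p η , - c , colB p η′ ,
      ∈-++⁺ʳ (colsA (suc m)) (∈-cartesianProductWith⁺ colB p∈ (∈-vectors η)) ,
      ∈-++⁺ʳ (colsA (suc m)) (∈-cartesianProductWith⁺ colB p∈ (∈-vectors η′)) ,
      trans (comb-++ c (- c) (M p) (M p) (quadratic (Vec.head p) η) (quadratic (Vec.head p) η′)) (cong₂ Vec._++_ (comb-self c (M p)) e)

    -- Syndromes that begin with four zeros keep their v, so the tail (v, w) has length 1 + 2t and
    -- the recursion lowers the index by 2. Codimensions 1 and 3 are thus both base cases.
    covers : ∀ t s → Covered (columns t) s
    covers zero (x ∷ []) = x , _ , 0# , _ , here refl , here refl ,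
      cong (_∷ []) (solve 1 (λ x → x :* con (pos 1) :+ con (pos 0) :* con (pos 1) := x) refl x)
    covers (suc t) (x ∷ y ∷ z ∷ w) with (x ∷ y ∷ z ∷ []) ≟ᵛ 𝟎
    covers (suc zero)    (x ∷ y ∷ z ∷ w) | no s≢𝟎 = covered-≢𝟎 (x ∷ y ∷ z ∷ []) w s≢𝟎
    covers (suc (suc t)) (x ∷ y ∷ z ∷ w) | no s≢𝟎 = covered-mono ∈-++⁺ˡ (covered-≢𝟎 {suc t} (x ∷ y ∷ z ∷ []) w s≢𝟎)
    -- Only the zero syndrome is left; any column with coefficients 0 yields it.
    covers (suc zero)    (x ∷ y ∷ z ∷ []) | yes refl with v , v∈ , _ ← heads (inj₁ refl) =
      0# , g , 0# , g , g∈ , g∈ , trans (comb-0ˡ 0# g g) (0∙ g)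
      where
      g = colA v []
      g∈ = ∈-++⁺ˡ (∈-cartesianProductWith⁺ colA v∈ (∈-vectors []))
    covers (suc (suc t)) (x ∷ y ∷ z ∷ u ∷ v ∷ w) | yes refl with u ≟ 0#
    ... | no u≢0 = covered-mono ∈-++⁺ˡ (covered-chord u v w u≢0)
    ... | yes refl with a , g , b , h , g∈ , h∈ , e ← covers t (v ∷ w) =
      a , _ , b , _ , ∈-++⁺ʳ main (∈-map⁺ _ g∈) , ∈-++⁺ʳ main (∈-map⁺ _ h∈) , cong₂ _∷_ z₀ (cong₂ _∷_ z₀ (cong₂ _∷_ z₀ (cong₂ _∷_ z₀ e)))
      where
      main = colsA (suc t) List.++ colsB (suc t)
      z₀ : a * 0# + b * 0# ≡ 0#
      z₀ = solve 2 (λ a b → a :* con (pos 0) :+ b :* con (pos 0) := con (pos 0)) refl a b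

    length-cols : ∀ m → List.length (colsA m List.++ colsB m) ≡ 2 ℕ.* List.length points ℕ.* q ℕ.^ m
    length-cols m = begin
      List.length (colsA m List.++ colsB m)            ≡⟨ List.length-++ (colsA m) ⟩
      List.length (colsA m) ℕ.+ List.length (colsB m)  ≡⟨ cong₂ ℕ._+_ (len colA) (len colB) ⟩
      N ℕ.* q ℕ.^ m ℕ.+ N ℕ.* q ℕ.^ m                  ≡⟨ ℕ+*.solve 2 (λ n p → n ℕ+*.:* p ℕ+*.:+ n ℕ+*.:* p ℕ+*.:= ℕ+*.con 2 ℕ+*.:* n ℕ+*.:* p) refl N (q ℕ.^ m) ⟩
      2 ℕ.* N ℕ.* q ℕ.^ m                              ∎
      where
      N = List.length points
      len : (f : V₃ → Vec (Fin q) m → Vec (Fin q) (suc (double (suc m)))) → List.length (List.cartesianProductWith f points (vectors m)) ≡ N ℕ.* q ℕ.^ m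
      len f = trans (length-cartesianProductWith f points (vectors m)) (cong (N ℕ.*_) (length-vectors m))

    length-columns : ∀ t → List.length (columns (suc (suc t))) ≡ 2 ℕ.* List.length points ℕ.* q ℕ.^ suc t ℕ.+ List.length (columns t)
    length-columns t = trans (List.length-++ (colsA (suc t) List.++ colsB (suc t)))
      (cong₂ ℕ._+_ (length-cols (suc t)) (List.length-map _ (columns t)))

-- Transport of an abstract finite field to `Fin q`

module Transport (F : Field 0ℓ 0ℓ) {q} (card : HasCard F q) where
  module F = Field F
  open F using (_≈_; Carrier)

  e : Fin q → Carrier
  e = proj₁ card

  index : Carrier → Fin q
  index x = proj₁ (proj₁ (proj₂ card) x)

  e-index : ∀ x → e (index x) ≈ x
  e-index x = proj₂ (proj₁ (proj₂ card) x)

  e-injective : ∀ {i j} → e i ≈ e j → i ≡ j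
  e-injective = proj₂ (proj₂ card) _ _

  -- The operations on indices are computed through the carrier, so `e` is a homomorphism by
  -- construction, and its injectivity pulls the ring laws back.
  e-monomorphism : IsRingMonomorphism
    (record { _≈_ = _≡_ ; _+_ = λ i j → index (e i F.+ e j) ; _*_ = λ i j → index (e i F.* e j)
            ; -_ = λ i → index (F.- e i) ; 0# = index F.0# ; 1# = index F.1# })
    (CommutativeRing.rawRing F.commutativeRing) e
  e-monomorphism = record
    { isRingHomomorphism = record
      { isSemiringHomomorphism = record
        { isNearSemiringHomomorphism = record
          { +-isMonoidHomomorphism = record
            { isMagmaHomomorphism = record { isRelHomomorphism = record { cong = F.reflexive ∘ cong e } ; homo = λ _ _ → e-index _ }
            ; ε-homo = e-index _ }
          ; *-homo = λ _ _ → e-index _ }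
        ; 1#-homo = e-index _ }
      ; -‿homo = λ _ → e-index _ }
    ; injective = e-injective }

  finiteField : FiniteField q
  finiteField = record
    { isCommutativeRing = RingMonomorphism.isCommutativeRing e-monomorphism F.isCommutativeRing
    ; 0≢1 = λ 0≡1 → F.0≉1 (F.trans (F.sym (e-index F.0#)) (F.trans (F.reflexive (cong e 0≡1)) (e-index F.1#)))
    ; inverse = λ i i≢0 → let y , xy≈1 = F.inverse (e i) (λ ei≈0 → i≢0 (e-injective (F.trans ei≈0 (F.sym (e-index F.0#))))) in
        index y , e-injective (F.trans (e-index _) (F.trans (F.*-congˡ (e-index y)) (F.trans xy≈1 (F.sym (e-index F.1#))))) }

-- The last element is repeated up to length n, hence the list must be non-empty. Repeated columns
-- do no harm to covering.
padding : ∀ {A : Set} (xs : List A) {n} → 0 < List.length xs → List.length xs ≤ n →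
          Σ (Fin n → A) λ f → ∀ {x} → x ∈ xs → ∃ λ j → f j ≡ x
padding (x List.∷ List.[]) {suc n} _ _ = (λ _ → x) , λ { (here refl) → zero , refl }
padding {A} (x List.∷ xs@(_ List.∷ _)) {suc n} _ (s≤s len≤n) with f , f-onto ← padding xs {n} (s≤s z≤n) len≤n = g , g-onto
  where
  g : Fin (suc n) → A
  g zero    = x
  g (suc j) = f j
  g-onto : ∀ {y} → y ∈ x List.∷ xs → ∃ λ j → g j ≡ y
  g-onto (here refl) = zero , refl
  g-onto (there y∈) with j , e ← f-onto y∈ = suc j , e

module _ (F : Field 0ℓ 0ℓ) {q} (card : HasCard F q) where
  open Transport F card
  open Codes F
  open CoveringCodes F
  private module K = FiniteField finiteField
  open Lifting finiteField using (Covered)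

  -- Padding adjusts the length to exactly n, covering also yields full rank, and n < q^r excludes a
  -- radius below 2.
  code : ∀ {r n} (cols : List (Vec (Fin q) (suc r))) → 0 < List.length cols → List.length cols ≤ n → n < q ℕ.^ r →
         (∀ s → Covered cols s) → CodeWithCoveringRadius n (suc r) 2
  code {r} {n} cols 0<len len≤n n<qʳ covered = H , covers⇒fullRowRank {H = H} covers , covers ,
      λ R R<2 → few-columns⇒¬covers card {H = H} n<qʳ R<2
    where
    open import Relation.Binary.Reasoning.Setoid F.setoid
    column : Fin n → Vec (Fin q) (suc r)
    column = proj₁ (padding cols 0<len len≤n)
    column-onto : ∀ {g} → g ∈ cols → ∃ λ j → column j ≡ g
    column-onto = proj₂ (padding cols 0<len len≤n)
    H : Matrix (suc r) n
    H i j = e (Vec.lookup (column j) i)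
    covers : CoversWithin H 2
    covers s with a , g , b , h , g∈ , h∈ , eq ← covered (Vec.tabulate (index ∘ s))
      with j , refl ← column-onto g∈ | k , refl ← column-onto h∈ =
      2 , ℕ.≤-refl , Vec.lookup (j ∷ k ∷ []) , Vec.lookup (e a ∷ e b ∷ []) , λ i → begin
        s i                                                     ≈⟨ e-index (s i) ⟨
        e (index (s i))                                         ≡⟨ cong e (≡.trans (≡.sym (Vec.lookup∘tabulate (index ∘ s) i)) (≡.sym (cong (λ v → Vec.lookup v i) eq))) ⟩
        e (Vec.lookup (Vec.zipWith (λ x y → a K.* x K.+ b K.* y) (column j) (column k)) i)
                                                                ≡⟨ cong e (Vec.lookup-zipWith _ i (column j) (column k)) ⟩
        e (a K.* Vec.lookup (column j) i K.+ b K.* Vec.lookup (column k) i)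
                                                                ≈⟨ e-index _ ⟩
        e (a K.* Vec.lookup (column j) i) F.+ e (b K.* Vec.lookup (column k) i)
                                                                ≈⟨ F.+-cong (e-index _) (F.trans (e-index _) (F.sym (F.+-identityʳ _))) ⟩
        e a F.* H i j F.+ (e b F.* H i k F.+ F.0#)              ∎

-- Estimates for the lengths

open import Data.Nat using (_+_; _*_; _∸_; _^_)

double≡2* : ∀ t → double t ≡ 2 * t
double≡2* zero    = refl
double≡2* (suc t) = cong suc (trans (cong suc (double≡2* t)) (sym (ℕ.+-suc t (t + 0))))

planeSize : ℕ → ℕ
planeSize x = x * x + (x + 1)

-- Substituting x = 2 + y leaves a difference with non-negative coefficients. The margin is smallest
-- at x = 2, where the claim is 14 < 16.
2*planeSize<x⁴ : ∀ {x} → 1 < x → 2 * planeSize x < x ^ 4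
2*planeSize<x⁴ {suc (suc y)} (s≤s (s≤s _)) = subst (suc (2 * planeSize (2 + y)) ≤_) (sym expand) (ℕ.m≤m+n _ _)
  where
  open Data.Nat.Solver.+-*-Solver
  expand : (2 + y) ^ 4 ≡ suc (2 * planeSize (2 + y)) + (1 + 22 * y + 22 * y * y + 8 * y * y * y + y * y * y * y)
  expand = solve 1 (λ y → (con 2 :+ y) :^ 4 := (con 1 :+ con 2 :* ((con 2 :+ y) :* (con 2 :+ y) :+ ((con 2 :+ y) :+ con 1)))
    :+ (con 1 :+ con 22 :* y :+ con 22 :* y :* y :+ con 8 :* y :* y :* y :+ y :* y :* y :* y)) refl y

lengthN-suc : ∀ x m → lengthN x (suc m) ≡ 2 * planeSize x * (x ^ 4) ^ m + floorTerm x (suc m)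
lengthN-suc x m = cong (_+ floorTerm x (suc m)) (begin
  2 * x ^ (4 * suc m ∸ 2) + 2 * x ^ (4 * suc m ∸ 3) + 2 * x ^ (4 * suc m ∸ 4)
    ≡⟨ cong (λ k → 2 * x ^ (k ∸ 2) + 2 * x ^ (k ∸ 3) + 2 * x ^ (k ∸ 4)) (ℕ.*-suc 4 m) ⟩
  2 * (x * (x * x ^ (4 * m))) + 2 * (x * x ^ (4 * m)) + 2 * x ^ (4 * m)
    ≡⟨ solve 2 (λ x z → con 2 :* (x :* (x :* z)) :+ con 2 :* (x :* z) :+ con 2 :* z := con 2 :* (x :* x :+ (x :+ con 1)) :* z) refl x (x ^ (4 * m)) ⟩
  2 * planeSize x * x ^ (4 * m)
    ≡⟨ cong (2 * planeSize x *_) (ℕ.^-*-assoc x 4 m) ⟨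
  2 * planeSize x * (x ^ 4) ^ m ∎)
  where
  open ≡.≡-Reasoning
  open Data.Nat.Solver.+-*-Solver

lengthN-suc-suc : ∀ x k → lengthN x (suc (suc k)) ≡ 2 * planeSize x * (x ^ 4) ^ suc k + (x ^ 4) ^ k
lengthN-suc-suc x k = trans (lengthN-suc x (suc k)) (cong (2 * planeSize x * (x ^ 4) ^ suc k +_) (sym (ℕ.^-*-assoc x 4 k)))

module Lengths {x} (1<x : 1 < x) where

  private
    q = x ^ 4
    instance
      q≢0 : ℕ.NonZero q
      q≢0 = ℕ.m^n≢0 x 4 {{ℕ.>-nonZero (ℕ.<-trans (s≤s z≤n) 1<x)}}

  1<q : 1 < q
  1<q = ℕ.≤-<-trans (ℕ.≤-trans (ℕ.m≤n+m 1 (x * x + x)) (ℕ.≤-trans (ℕ.≤-reflexive (ℕ.+-assoc (x * x) x 1)) (ℕ.m≤m+n (planeSize x) _))) (2*planeSize<x⁴ 1<x)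

  -- The induction step shared by the bounds for `lengthN` and for the column lists: n is absorbed
  -- by one more copy of q^(k+1), and 2N + 1 ≤ q.
  extend-≤ : ∀ {N n k} → 2 * N < q → n ≤ q ^ k → 2 * N * q ^ suc k + n ≤ q ^ suc (suc k)
  extend-≤ {N} {n} {k} 2N<q n≤qᵏ = begin
    2 * N * q ^ suc k + n           ≤⟨ ℕ.+-monoʳ-≤ (2 * N * q ^ suc k) (ℕ.≤-trans n≤qᵏ (ℕ.m≤n*m (q ^ k) q)) ⟩
    2 * N * q ^ suc k + q ^ suc k   ≡⟨ ℕ.+-comm (2 * N * q ^ suc k) _ ⟩
    suc (2 * N) * q ^ suc k         ≤⟨ ℕ.*-monoˡ-≤ (q ^ suc k) 2N<q ⟩
    q ^ suc (suc k)                 ∎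
    where open ℕ.≤-Reasoning

  lengthN≤q^t : ∀ t → 1 ≤ t → lengthN x t ≤ q ^ t
  lengthN≤q^t (suc zero)    _ = ℕ.≤-trans (ℕ.≤-reflexive (trans (lengthN-suc x 0) (trans (ℕ.+-identityʳ _) (ℕ.*-identityʳ _))))
    (ℕ.≤-trans (ℕ.<⇒≤ (2*planeSize<x⁴ 1<x)) (ℕ.≤-reflexive (sym (ℕ.*-identityʳ q))))
  lengthN≤q^t (suc (suc k)) _ = ℕ.≤-trans (ℕ.≤-reflexive (lengthN-suc-suc x k))
    (extend-≤ {planeSize x} {k = k} (2*planeSize<x⁴ 1<x) ℕ.≤-refl)

  -- Since 2t = r - 1, this is the hypothesis that rules out covering radius 0 and 1.
  lengthN<q^2t : ∀ t → 1 ≤ t → lengthN x t < q ^ double t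
  lengthN<q^2t t 1≤t = ℕ.≤-<-trans (lengthN≤q^t t 1≤t) (ℕ.^-monoʳ-< q 1<q (t<double t 1≤t))
    where
    t<double : ∀ t → 1 ≤ t → t < double t
    t<double (suc zero)    _ = s≤s (s≤s z≤n)
    t<double (suc (suc t)) _ = s≤s (ℕ.m≤n⇒m≤1+n (t<double (suc t) (s≤s z≤n)))

primePower>1 : ∀ {p k} → Prime p → 1 ≤ k → 1 < p ^ k
primePower>1 {p} {k} pr 1≤k = ℕ.^-monoʳ-< p (ℕ.nonTrivial⇒n>1 p {{prime⇒nonTrivial pr}}) {0} {k} 1≤k

-- The codes of length n_r

module Construction {p k} (pr : Prime p) (1≤k : 1 ≤ k) (F : Field 0ℓ 0ℓ) (card : HasCard F ((p ^ k) ^ 4)) where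

  private
    x = p ^ k
    K = Transport.finiteField F card
    module K = FiniteField K
    open FiniteFieldProperties K using (fermat; characteristic)
    open Frobenius K.commutativeRing using (frobenius^-+)

  1<x : 1 < x
  1<x = primePower>1 pr 1≤k

  open Lengths 1<x
  open Subfields.FrobeniusFixed K x 1<x refl
    (frobenius^-+ pr (characteristic {n = k * 4} (ℕ.^-*-assoc p k 4)) k) fermat
  open Geometry.Planes K L-isSubfield E-isSubfield L⊆E E/L K/E (proj₁ (proj₂ irreducibleCubic))
    (cubic-irreducible-over-E (proj₁ (proj₂ irreducibleCubic)) (proj₂ (proj₂ irreducibleCubic)))
  open Lifting K using (Covered)

  columns : ∀ t → List (Vec _ (suc (double t)))
  columns = Lifting.columns K (points listL) M (split-points listL) (points-heads listL)

  covers : ∀ t s → Covered (columns t) s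
  covers = Lifting.covers K (points listL) M (split-points listL) (points-heads listL)

  |points|≤ : List.length (points listL) ≤ planeSize x
  |points|≤ = ℕ.≤-trans (ℕ.≤-reflexive (length-points listL)) (ℕ.+-mono-≤ (ℕ.*-mono-≤ |L|≤x |L|≤x) (ℕ.+-monoˡ-≤ 1 |L|≤x))

  length-columns₁ : List.length (columns 1) ≤ 2 * planeSize x
  length-columns₁ = ℕ.≤-trans (ℕ.≤-reflexive (trans (Lifting.length-cols K (points listL) M (split-points listL) (points-heads listL) 0) (ℕ.*-identityʳ _)))
    (ℕ.*-monoʳ-≤ 2 |points|≤)

  length-columns₂ : ∀ t → List.length (columns (suc (suc t))) ≤ 2 * planeSize x * (x ^ 4) ^ suc t + List.length (columns t)
  length-columns₂ t = ℕ.≤-trans (ℕ.≤-reflexive (Lifting.length-columns K (points listL) M (split-points listL) (points-heads listL) t))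
    (ℕ.+-monoˡ-≤ _ (ℕ.*-monoˡ-≤ ((x ^ 4) ^ suc t) (ℕ.*-monoʳ-≤ 2 |points|≤)))

  -- This makes the floor term sufficient: for index t + 2 the recursive part has to fit into q^t
  -- columns.
  length-columns≤q^t : ∀ t → List.length (columns t) ≤ (x ^ 4) ^ t
  length-columns≤q^t zero          = ℕ.≤-refl
  length-columns≤q^t (suc zero)    = ℕ.≤-trans length-columns₁ (ℕ.≤-trans (ℕ.<⇒≤ (2*planeSize<x⁴ 1<x)) (ℕ.≤-reflexive (sym (ℕ.*-identityʳ (x ^ 4)))))
  length-columns≤q^t (suc (suc t)) = ℕ.≤-trans (length-columns₂ t)
    (extend-≤ {planeSize x} {k = t} (2*planeSize<x⁴ 1<x) (length-columns≤q^t t))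

  length-columns≤lengthN : ∀ t → 1 ≤ t → List.length (columns t) ≤ lengthN x t
  length-columns≤lengthN (suc zero)    _ = ℕ.≤-trans length-columns₁
    (ℕ.≤-reflexive (sym (trans (lengthN-suc x 0) (trans (ℕ.+-identityʳ _) (ℕ.*-identityʳ _)))))
  length-columns≤lengthN (suc (suc t)) _ = ℕ.≤-trans (length-columns₂ t)
    (ℕ.≤-trans (ℕ.+-monoʳ-≤ (2 * planeSize x * (x ^ 4) ^ suc t) (length-columns≤q^t t)) (ℕ.≤-reflexive (sym (lengthN-suc-suc x t))))

  0<length-columns : ∀ {r} (cols : List (Vec _ r)) s → Covered cols s → 0 < List.length cols
  0<length-columns (_ List.∷ _) s _ = s≤s z≤n
  0<length-columns List.[] s (_ , _ , _ , _ , () , _)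

  coveringCode : ∀ t → 1 ≤ t → Codes.CodeWithCoveringRadius F (lengthN x t) (2 * t + 1) 2
  coveringCode t 1≤t = subst (λ r → Codes.CodeWithCoveringRadius F (lengthN x t) r 2)
    (trans (cong suc (double≡2* t)) (ℕ.+-comm 1 (2 * t)))
    (code F card (columns t) (0<length-columns (columns t) (Vec.replicate _ K.0#) (covers t _)) (length-columns≤lengthN t 1≤t) (lengthN<q^2t t 1≤t) (covers t))

-- The covering density

÷-mono-≤ : ∀ a b c d .{{_ : NonZero b}} .{{_ : NonZero d}} → a * d ≤ c * b → (a ÷ℕ b) ℚ.≤ (c ÷ℕ d)
÷-mono-≤ a (suc b) c (suc d) ad≤cb = ℚ.toℚᵘ-cancel-≤
  (ℚᵘ.≤-respˡ-≃ (ℚᵘ.≃-sym (ℚ.toℚᵘ-fromℚᵘ (mkℚᵘ (pos a) b)))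
    (ℚᵘ.≤-respʳ-≃ (ℚᵘ.≃-sym (ℚ.toℚᵘ-fromℚᵘ (mkℚᵘ (pos c) d)))
      (*≤* (subst₂ ℤ._≤_ (ℤ.pos-* a (suc d)) (ℤ.pos-* c (suc b)) (ℤ.+≤+ ad≤cb)))))

÷-mono-< : ∀ a b c d .{{_ : NonZero b}} .{{_ : NonZero d}} → a * d < c * b → (a ÷ℕ b) ℚ.< (c ÷ℕ d)
÷-mono-< a (suc b) c (suc d) ad<cb = ℚ.toℚᵘ-cancel-<
  (ℚᵘ.<-respˡ-≃ (ℚᵘ.≃-sym (ℚ.toℚᵘ-fromℚᵘ (mkℚᵘ (pos a) b)))
    (ℚᵘ.<-respʳ-≃ (ℚᵘ.≃-sym (ℚ.toℚᵘ-fromℚᵘ (mkℚᵘ (pos c) d)))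
      (*<* (subst₂ ℤ._<_ (ℤ.pos-* a (suc d)) (ℤ.pos-* c (suc b)) (ℤ.+<+ ad<cb)))))

÷-cong : ∀ a b c d .{{_ : NonZero b}} .{{_ : NonZero d}} → a * d ≡ c * b → (a ÷ℕ b) ≡ (c ÷ℕ d)
÷-cong a b c d ad≡cb = ℚ.≤-antisym (÷-mono-≤ a b c d (ℕ.≤-reflexive ad≡cb)) (÷-mono-≤ c d a b (ℕ.≤-reflexive (sym ad≡cb)))

÷-+ : ∀ a c b .{{_ : NonZero b}} → (a ÷ℕ b) ℚ.+ (c ÷ℕ b) ≡ ((a + c) ÷ℕ b)
÷-+ a c (suc b) = ℚ.toℚᵘ-injective (begin
  ℚ.toℚᵘ (a ÷ℕ suc b ℚ.+ c ÷ℕ suc b)                ≈⟨ ℚ.toℚᵘ-homo-+ (a ÷ℕ suc b) (c ÷ℕ suc b) ⟩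
  ℚ.toℚᵘ (a ÷ℕ suc b) ℚᵘ.+ ℚ.toℚᵘ (c ÷ℕ suc b)      ≈⟨ ℚᵘ.+-cong (ℚ.toℚᵘ-fromℚᵘ (mkℚᵘ (pos a) b)) (ℚ.toℚᵘ-fromℚᵘ (mkℚᵘ (pos c) b)) ⟩
  mkℚᵘ (pos a) b ℚᵘ.+ mkℚᵘ (pos c) b                ≈⟨ *≡* (solve 3 (λ a c b → (a :* b :+ c :* b) :* b := (a :+ c) :* (b :* b)) refl (pos a) (pos c) (pos (suc b))) ⟩
  mkℚᵘ (pos (a + c)) b                              ≈⟨ ℚ.toℚᵘ-fromℚᵘ (mkℚᵘ (pos (a + c)) b) ⟨
  ℚ.toℚᵘ ((a + c) ÷ℕ suc b)                         ∎)
  where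
  open ℚᵘ.≃-Reasoning
  open Data.Integer.Solver.+-*-Solver

÷-∸ : ∀ a c b .{{_ : NonZero b}} → ((a + c) ÷ℕ b) ℚ.- (c ÷ℕ b) ≡ (a ÷ℕ b)
÷-∸ a c b = begin
  ((a + c) ÷ℕ b) ℚ.- (c ÷ℕ b)              ≡⟨ cong (ℚ._- (c ÷ℕ b)) (÷-+ a c b) ⟨
  (a ÷ℕ b) ℚ.+ (c ÷ℕ b) ℚ.- (c ÷ℕ b)       ≡⟨ ℚ.+-assoc (a ÷ℕ b) (c ÷ℕ b) (ℚ.- (c ÷ℕ b)) ⟩
  (a ÷ℕ b) ℚ.+ ((c ÷ℕ b) ℚ.- (c ÷ℕ b))     ≡⟨ cong ((a ÷ℕ b) ℚ.+_) (ℚ.+-inverseʳ (c ÷ℕ b)) ⟩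
  (a ÷ℕ b) ℚ.+ ℚ.0ℚ                        ≡⟨ ℚ.+-identityʳ (a ÷ℕ b) ⟩
  (a ÷ℕ b)                                 ∎
  where open ≡.≡-Reasoning

nC2 : ∀ n → 2 * (suc n C 2) ≡ suc n * n
nC2 n = trans (absorption n 1) (cong (suc n *_) (nC1≡n n))

-- The sphere is dominated by its outermost layer, ((q − 1) n)² / 2.
2*V≤ : ∀ r n → 4 ≤ r → 1 ≤ n → 2 * V (suc r) n 2 ≤ (r * n) * (r * n)
2*V≤ r (suc n) 4≤r _ = begin
  2 * V (suc r) (suc n) 2
    ≡⟨ cong (λ c → 2 * (1 + r * 1 * c + r * (r * 1) * (suc n C 2))) (nC1≡n (suc n)) ⟩
  2 * (1 + r * 1 * suc n + r * (r * 1) * (suc n C 2))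
    ≡⟨ solve 3 (λ r n b → con 2 :* (con 1 :+ r :* con 1 :* n :+ r :* (r :* con 1) :* b) := con 2 :+ con 2 :* r :* n :+ r :* r :* (con 2 :* b)) refl r (suc n) (suc n C 2) ⟩
  2 + 2 * r * suc n + r * r * (2 * (suc n C 2))
    ≡⟨ cong (λ b → 2 + 2 * r * suc n + r * r * b) (nC2 n) ⟩
  2 + 2 * r * suc n + r * r * (suc n * n)
    ≤⟨ ℕ.+-monoˡ-≤ (r * r * (suc n * n)) small ⟩
  r * r * suc n + r * r * (suc n * n)
    ≡⟨ solve 2 (λ r n → r :* r :* (con 1 :+ n) :+ r :* r :* ((con 1 :+ n) :* n) := r :* (con 1 :+ n) :* (r :* (con 1 :+ n))) refl r n ⟩
  r * suc n * (r * suc n) ∎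
  where
  open ℕ.≤-Reasoning
  open Data.Nat.Solver.+-*-Solver
  -- The two inner layers contribute at most 4 r n, which r ≥ 4 turns into the missing r² n.
  small : 2 + 2 * r * suc n ≤ r * r * suc n
  small = begin
    2 + 2 * r * suc n                ≤⟨ ℕ.+-monoˡ-≤ (2 * r * suc n) (ℕ.≤-trans (ℕ.m≤m*n 2 r {{ℕ.>-nonZero (ℕ.≤-trans (s≤s z≤n) 4≤r)}}) (ℕ.m≤m*n (2 * r) (suc n))) ⟩
    2 * r * suc n + 2 * r * suc n    ≡⟨ solve 2 (λ r n → con 2 :* r :* n :+ con 2 :* r :* n := con 4 :* (r :* n)) refl r (suc n) ⟩
    4 * (r * suc n)                  ≤⟨ ℕ.*-monoˡ-≤ (r * suc n) 4≤r ⟩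
    r * (r * suc n)                  ≡⟨ ℕ.*-assoc r r (suc n) ⟨
    r * r * suc n                    ∎

module Density {x} (1<x : 1 < x) where

  open Data.Nat.Solver.+-*-Solver

  private
    P = planeSize x
    q = x ^ 4
    r = q ∸ 1
    M = 2 * P * q + 1
    instance
      x≢0 : NonZero x
      x≢0 = ℕ.>-nonZero (ℕ.<-trans (s≤s z≤n) 1<x)
      q≢0 : NonZero q
      q≢0 = ℕ.m^n≢0 x 4
    x^≢0 : ∀ n → NonZero (x ^ n)
    x^≢0 n = ℕ.m^n≢0 x n
    q^≢0 : ∀ n → NonZero (q ^ n)
    q^≢0 n = ℕ.m^n≢0 q n
    2≤x = 1<x

  q≡suc[r] : q ≡ suc r
  q≡suc[r] = sym (ℕ.suc-pred q)

  4≤r : 4 ≤ r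
  4≤r = ℕ.≤-pred (ℕ.≤-trans (s≤s (s≤s (s≤s (s≤s (s≤s z≤n))))) (ℕ.≤-trans (ℕ.^-monoˡ-≤ 4 1<x) (ℕ.≤-reflexive q≡suc[r])))

  -- (q − 1)² n² / 2 q^(2t+1) does not depend on t, because n = q^(t−2) M.
  limitNumerator limitDenominator : ℕ
  limitNumerator   = r * M * (r * M)
  limitDenominator = 2 * q ^ 5

  density≤ : ∀ k → density x (suc (suc k)) ℚ.≤ (limitNumerator ÷ℕ limitDenominator)
  density≤ k = ÷-mono-≤ _ (q ^ (2 * t + 1)) limitNumerator limitDenominator {{q^≢0 (2 * t + 1)}} {{ℕ.m*n≢0 2 (q ^ 5) {{_}} {{q^≢0 5}}}} (begin
    V q (lengthN x t) 2 * (2 * q ^ 5)          ≡⟨ solve 2 (λ v z → v :* (con 2 :* z) := con 2 :* v :* z) refl (V q (lengthN x t) 2) (q ^ 5) ⟩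
    2 * V q (lengthN x t) 2 * q ^ 5            ≤⟨ ℕ.*-monoˡ-≤ (q ^ 5) sphere ⟩
    r * (M * q ^ k) * (r * (M * q ^ k)) * q ^ 5 ≡⟨ solve 4 (λ r M z w → r :* (M :* z) :* (r :* (M :* z)) :* w := r :* M :* (r :* M) :* (w :* (z :* z))) refl r M (q ^ k) (q ^ 5) ⟩
    r * M * (r * M) * (q ^ 5 * (q ^ k * q ^ k)) ≡⟨ cong (r * M * (r * M) *_) powers ⟩
    r * M * (r * M) * q ^ (2 * t + 1)          ∎)
    where
    open ℕ.≤-Reasoning
    t = suc (suc k)
    powers : q ^ 5 * (q ^ k * q ^ k) ≡ q ^ (2 * t + 1)
    powers = trans (cong (q ^ 5 *_) (sym (ℕ.^-distribˡ-+-* q k k))) (trans (sym (ℕ.^-distribˡ-+-* q 5 (k + k)))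
      (cong (q ^_) (solve 1 (λ k → con 5 :+ (k :+ k) := con 2 :* (con 2 :+ k) :+ con 1) refl k)))
    n≡ : lengthN x t ≡ M * q ^ k
    n≡ = trans (lengthN-suc-suc x k) (solve 3 (λ P q z → con 2 :* P :* (q :* z) :+ z := (con 2 :* P :* q :+ con 1) :* z) refl P q (q ^ k))
    sphere : 2 * V q (lengthN x t) 2 ≤ r * (M * q ^ k) * (r * (M * q ^ k))
    sphere = ℕ.≤-trans (ℕ.≤-reflexive (cong₂ (λ q n → 2 * V q n 2) q≡suc[r] n≡))
      (2*V≤ r (M * q ^ k) 4≤r (ℕ.*-mono-≤ (ℕ.m≤n+m 1 (2 * P * q)) (ℕ.>-nonZero⁻¹ (q ^ k) {{q^≢0 k}})))

  -- The positive terms of the bound over the common denominator x⁵.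
  N : ℕ
  N = 2 * x ^ 5 + 4 * x ^ 4 + 6 * x ^ 3 + 4 * x ^ 2

  2x+8≤N : 2 * x + 8 ≤ N
  2x+8≤N = begin
    2 * x + 8           ≤⟨ ℕ.+-mono-≤ (ℕ.*-monoʳ-≤ 2 (ℕ.≤-trans (ℕ.≤-reflexive (sym (ℕ.^-identityʳ x))) (ℕ.^-monoʳ-≤ x {1} {5} (s≤s z≤n)))) 8≤4x² ⟩
    2 * x ^ 5 + 4 * x ^ 2   ≤⟨ ℕ.+-monoˡ-≤ (4 * x ^ 2) (ℕ.≤-trans (ℕ.m≤m+n (2 * x ^ 5) (4 * x ^ 4)) (ℕ.m≤m+n _ (6 * x ^ 3))) ⟩
    N                   ∎
    where
    open ℕ.≤-Reasoning
    8≤4x² : 8 ≤ 4 * x ^ 2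
    8≤4x² = ℕ.*-monoʳ-≤ 4 (ℕ.≤-trans 1<x (ℕ.≤-trans (ℕ.≤-reflexive (sym (ℕ.^-identityʳ x))) (ℕ.^-monoʳ-≤ x {1} {2} (s≤s z≤n))))

  -- The numerator of the whole bound over x⁵; the truncated subtraction is exact because 2x + 8 ≤
  -- N.
  m : ℕ
  m = N ∸ (2 * x + 8)

  m+2x+8≡N : m + (2 * x + 8) ≡ N
  m+2x+8≡N = ℕ.m∸n+n≡m 2x+8≤N

  densityBound≡ : densityBound x ≡ (m ÷ℕ (x ^ 5))
  densityBound≡ = begin
    densityBound x
      ≡⟨ cong₂ ℚ._-_ (cong₂ ℚ._-_ (cong₂ ℚ._+_ (cong₂ ℚ._+_ (cong₂ ℚ._+_ c₀ c₁) c₂) c₃) c₄) refl ⟩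
    (2 * x ^ 5) ÷ℕ D ℚ.+ (4 * x ^ 4) ÷ℕ D ℚ.+ (6 * x ^ 3) ÷ℕ D ℚ.+ (4 * x ^ 2) ÷ℕ D ℚ.- (2 * x) ÷ℕ D ℚ.- 8 ÷ℕ D
      ≡⟨ cong (λ s → s ℚ.- (2 * x) ÷ℕ D ℚ.- 8 ÷ℕ D) sum ⟩
    N ÷ℕ D ℚ.- (2 * x) ÷ℕ D ℚ.- 8 ÷ℕ D
      ≡⟨ cong (λ n → n ÷ℕ D ℚ.- (2 * x) ÷ℕ D ℚ.- 8 ÷ℕ D) (trans (sym m+2x+8≡N) (solve 2 (λ m x → m :+ (con 2 :* x :+ con 8) := m :+ con 8 :+ con 2 :* x) refl m x)) ⟩
    (m + 8 + 2 * x) ÷ℕ D ℚ.- (2 * x) ÷ℕ D ℚ.- 8 ÷ℕ D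
      ≡⟨ cong (ℚ._- 8 ÷ℕ D) (÷-∸ (m + 8) (2 * x) D) ⟩
    (m + 8) ÷ℕ D ℚ.- 8 ÷ℕ D
      ≡⟨ ÷-∸ m 8 D ⟩
    m ÷ℕ D ∎
    where
    open ≡.≡-Reasoning
    D = x ^ 5
    instance
      D≢0 : NonZero D
      D≢0 = x^≢0 5
    sum : (2 * x ^ 5) ÷ℕ D ℚ.+ (4 * x ^ 4) ÷ℕ D ℚ.+ (6 * x ^ 3) ÷ℕ D ℚ.+ (4 * x ^ 2) ÷ℕ D ≡ N ÷ℕ D
    sum = trans (cong (λ s → s ℚ.+ (6 * x ^ 3) ÷ℕ D ℚ.+ (4 * x ^ 2) ÷ℕ D) (÷-+ (2 * x ^ 5) (4 * x ^ 4) D))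
      (trans (cong (ℚ._+ (4 * x ^ 2) ÷ℕ D) (÷-+ (2 * x ^ 5 + 4 * x ^ 4) (6 * x ^ 3) D)) (÷-+ (2 * x ^ 5 + 4 * x ^ 4 + 6 * x ^ 3) (4 * x ^ 2) D))
    c₀ : 2 ÷ℕ 1 ≡ (2 * x ^ 5) ÷ℕ D
    c₀ = ÷-cong 2 1 (2 * x ^ 5) D (sym (ℕ.*-identityʳ _))
    c₁ : 4 ÷ℕ x ≡ (4 * x ^ 4) ÷ℕ D
    c₁ = ÷-cong 4 x (4 * x ^ 4) D (solve 1 (λ x → con 4 :* (x :^ 5) := con 4 :* x :^ 4 :* x) refl x)
    c₂ : 6 ÷ℕ (x ^ 2) ≡ (6 * x ^ 3) ÷ℕ D
    c₂ = ÷-cong 6 (x ^ 2) (6 * x ^ 3) D {{x^≢0 2}} (solve 1 (λ x → con 6 :* (x :^ 5) := con 6 :* x :^ 3 :* x :^ 2) refl x)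
    c₃ : 4 ÷ℕ (x ^ 3) ≡ (4 * x ^ 2) ÷ℕ D
    c₃ = ÷-cong 4 (x ^ 3) (4 * x ^ 2) D {{x^≢0 3}} (solve 1 (λ x → con 4 :* (x :^ 5) := con 4 :* x :^ 2 :* x :^ 3) refl x)
    c₄ : 2 ÷ℕ (x ^ 4) ≡ (2 * x) ÷ℕ D
    c₄ = ÷-cong 2 (x ^ 4) (2 * x) D (solve 1 (λ x → con 2 :* (x :^ 5) := con 2 :* x :* x :^ 4) refl x)

  -- Both sides of limitNumerator < 2 m x¹⁵ are compared after adding 8 P² q³ + (4 x + 16) x¹⁵, which clears
  -- all subtractions; what remains is 4 P² q² + (q − 1)² (4 P q + 1) < 8 (3 x² + 2 x + 1) q³.
  P≤2x² : P ≤ 2 * (x * x)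
  P≤2x² = ℕ.≤-trans (ℕ.+-monoʳ-≤ (x * x) (ℕ.≤-trans (ℕ.+-monoʳ-≤ x (ℕ.<⇒≤ 1<x)) (ℕ.≤-trans (ℕ.≤-reflexive (solve 1 (λ x → x :+ x := con 2 :* x) refl x)) (ℕ.*-monoˡ-≤ x 1<x))))
    (ℕ.≤-reflexive (solve 1 (λ x → x :* x :+ x :* x := con 2 :* (x :* x)) refl x))

  r<q : r ≤ q
  r<q = ℕ.m∸n≤m q 1

  remainder : 4 * (P * P) * (q * q) + r * r * (4 * P * q + 1) < 8 * (3 * (x * x) + 2 * x + 1) * (q * q * q)
  remainder = begin-strict
    4 * (P * P) * (q * q) + r * r * (4 * P * q + 1)
      -- P² ≤ 4 x⁴ = 4 q makes the first term cubic in q, and r ≤ q, 1 ≤ q suffice for the second: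
      -- the leading coefficients 4 x² and 24 x² leave ample room.
      ≤⟨ ℕ.+-mono-≤ (ℕ.*-monoˡ-≤ (q * q) (ℕ.*-monoʳ-≤ 4 (ℕ.*-mono-≤ P≤2x² P≤2x²)))
           (ℕ.*-mono-≤ (ℕ.*-mono-≤ r<q r<q) (ℕ.+-monoʳ-≤ (4 * P * q) (ℕ.>-nonZero⁻¹ q))) ⟩
    4 * (2 * (x * x) * (2 * (x * x))) * (q * q) + q * q * (4 * P * q + q)
      ≡⟨ solve 2 (λ x q → con 4 :* (con 2 :* (x :* x) :* (con 2 :* (x :* x))) :* (q :* q) :+ q :* q :* (con 4 :* (x :* x :+ (x :+ con 1)) :* q :+ q)
             := con 16 :* (x :^ 4) :* (q :* q) :+ (con 4 :* (x :* x) :+ con 4 :* x :+ con 5) :* (q :* q :* q)) refl x q ⟩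
    16 * q * (q * q) + (4 * (x * x) + 4 * x + 5) * (q * q * q)
      ≡⟨ solve 2 (λ u q → con 16 :* q :* (q :* q) :+ (u :+ con 5) :* (q :* q :* q) := (u :+ con 21) :* (q :* q :* q)) refl (4 * (x * x) + 4 * x) q ⟩
    (4 * (x * x) + 4 * x + 21) * (q * q * q)
      <⟨ ℕ.*-monoˡ-< (q * q * q) {{ℕ.m*n≢0 (q * q) q {{ℕ.m*n≢0 q q}}}} coefficients ⟩
    8 * (3 * (x * x) + 2 * x + 1) * (q * q * q) ∎
    where
    open ℕ.≤-Reasoning
    coefficients : 4 * (x * x) + 4 * x + 21 < 8 * (3 * (x * x) + 2 * x + 1)
    coefficients = begin-strict
      4 * (x * x) + 4 * x + 21              <⟨ ℕ.+-monoʳ-< (4 * (x * x) + 4 * x) (ℕ.m≤m+n 22 18) ⟩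
      4 * (x * x) + 4 * x + 20 * (1 * 2)    ≤⟨ ℕ.+-monoʳ-≤ (4 * (x * x) + 4 * x) (ℕ.*-monoʳ-≤ 20 (ℕ.*-mono-≤ (ℕ.<⇒≤ 1<x) 1<x)) ⟩
      4 * (x * x) + 4 * x + 20 * (x * x)    ≤⟨ ℕ.m≤m+n _ (12 * x + 8) ⟩
      4 * (x * x) + 4 * x + 20 * (x * x) + (12 * x + 8)
        ≡⟨ solve 1 (λ x → con 4 :* (x :* x) :+ con 4 :* x :+ con 20 :* (x :* x) :+ (con 12 :* x :+ con 8) := con 8 :* (con 3 :* (x :* x) :+ con 2 :* x :+ con 1)) refl x ⟩
      8 * (3 * (x * x) + 2 * x + 1)         ∎

  limitNumerator< : limitNumerator < 2 * m * x ^ 15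
  limitNumerator< = ℕ.+-cancelʳ-< (8 * (P * P) * (q * q * q) + 2 * (2 * x + 8) * x ^ 15) _ _ (begin-strict
    limitNumerator + (8 * (P * P) * (q * q * q) + 2 * (2 * x + 8) * x ^ 15)
      ≡⟨ cong (_+ (8 * (P * P) * (q * q * q) + 2 * (2 * x + 8) * x ^ 15)) (solve 3 (λ r P q → r :* (con 2 :* P :* q :+ con 1) :* (r :* (con 2 :* P :* q :+ con 1))
           := (r :* r) :* (con 4 :* (P :* P) :* (q :* q) :+ (con 4 :* P :* q :+ con 1))) refl r P q) ⟩
    r * r * (4 * (P * P) * (q * q) + (4 * P * q + 1)) + (8 * (P * P) * (q * q * q) + 2 * (2 * x + 8) * x ^ 15)
      ≡⟨ solve 6 (λ rr p q s g y → rr :* (con 4 :* p :* (q :* q) :+ g) :+ (con 8 :* p :* (q :* q :* q) :+ y)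
           := con 4 :* p :* (q :* q) :* (rr :+ con 2 :* q) :+ rr :* g :+ y) refl (r * r) (P * P) q 0 (4 * P * q + 1) (2 * (2 * x + 8) * x ^ 15) ⟩
    4 * (P * P) * (q * q) * (r * r + 2 * q) + r * r * (4 * P * q + 1) + 2 * (2 * x + 8) * x ^ 15
      ≡⟨ cong (λ z → 4 * (P * P) * (q * q) * z + r * r * (4 * P * q + 1) + 2 * (2 * x + 8) * x ^ 15) square ⟩
    4 * (P * P) * (q * q) * (q * q + 1) + r * r * (4 * P * q + 1) + 2 * (2 * x + 8) * x ^ 15
      ≡⟨ solve 4 (λ p q g y → con 4 :* p :* (q :* q) :* (q :* q :+ con 1) :+ g :+ y
           := con 4 :* p :* (q :* q :* (q :* q)) :+ y :+ (con 4 :* p :* (q :* q) :+ g)) refl (P * P) q (r * r * (4 * P * q + 1)) (2 * (2 * x + 8) * x ^ 15) ⟩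
    4 * (P * P) * (q * q * (q * q)) + 2 * (2 * x + 8) * x ^ 15 + (4 * (P * P) * (q * q) + r * r * (4 * P * q + 1))
      <⟨ ℕ.+-monoʳ-< (4 * (P * P) * (q * q * (q * q)) + 2 * (2 * x + 8) * x ^ 15) remainder ⟩
    4 * (P * P) * (q * q * (q * q)) + 2 * (2 * x + 8) * x ^ 15 + 8 * (3 * (x * x) + 2 * x + 1) * (q * q * q)
      ≡⟨ cong (λ y → 4 * (P * P) * (q * q * (q * q)) + 2 * (2 * x + 8) * y + 8 * (3 * (x * x) + 2 * x + 1) * (q * q * q)) x¹⁵≡ ⟩
    4 * (P * P) * (q * q * (q * q)) + 2 * (2 * x + 8) * (x ^ 3 * (q * q * q)) + 8 * (3 * (x * x) + 2 * x + 1) * (q * q * q)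
      ≡⟨ solve 6 (λ p q z a b y → con 4 :* p :* (q :* q :* (q :* q)) :+ con 2 :* a :* (y :* (q :* q :* q)) :+ b :* (q :* q :* q)
           := (con 4 :* p :* q :+ con 2 :* a :* y :+ b) :* (q :* q :* q)) refl (P * P) q 0 (2 * x + 8) (8 * (3 * (x * x) + 2 * x + 1)) (x ^ 3) ⟩
    (4 * (P * P) * q + 2 * (2 * x + 8) * x ^ 3 + 8 * (3 * (x * x) + 2 * x + 1)) * (q * q * q)
      -- As P² = x⁴ + 2x³ + 3x² + 2x + 1, the terms of 4 P² q from x⁵ upwards are exactly 2 N x³;
      -- its last term 4x⁴ and the other summands add up to 8 P².
      ≡⟨ cong (_* (q * q * q)) (solve 1 (λ x → con 4 :* ((x :* x :+ (x :+ con 1)) :* (x :* x :+ (x :+ con 1))) :* x :^ 4 :+ con 2 :* (con 2 :* x :+ con 8) :* x :^ 3 :+ con 8 :* (con 3 :* (x :* x) :+ con 2 :* x :+ con 1)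
           := con 2 :* (con 2 :* x :^ 5 :+ con 4 :* x :^ 4 :+ con 6 :* x :^ 3 :+ con 4 :* x :^ 2) :* x :^ 3 :+ con 8 :* ((x :* x :+ (x :+ con 1)) :* (x :* x :+ (x :+ con 1)))) refl x) ⟩
    (2 * N * x ^ 3 + 8 * (P * P)) * (q * q * q)
      ≡⟨ cong (λ n → (2 * n * x ^ 3 + 8 * (P * P)) * (q * q * q)) (sym m+2x+8≡N) ⟩
    (2 * (m + (2 * x + 8)) * x ^ 3 + 8 * (P * P)) * (q * q * q)
      ≡⟨ solve 5 (λ m a y p c → (con 2 :* (m :+ a) :* y :+ con 8 :* p) :* c := con 2 :* m :* (y :* c) :+ (con 8 :* p :* c :+ con 2 :* a :* (y :* c))) refl m (2 * x + 8) (x ^ 3) (P * P) (q * q * q) ⟩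
    2 * m * (x ^ 3 * (q * q * q)) + (8 * (P * P) * (q * q * q) + 2 * (2 * x + 8) * (x ^ 3 * (q * q * q)))
      ≡⟨ cong (λ y → 2 * m * y + (8 * (P * P) * (q * q * q) + 2 * (2 * x + 8) * y)) (sym x¹⁵≡) ⟩
    2 * m * x ^ 15 + (8 * (P * P) * (q * q * q) + 2 * (2 * x + 8) * x ^ 15) ∎)
    where
    open ℕ.≤-Reasoning
    square : r * r + 2 * q ≡ q * q + 1
    square = subst (λ q → r * r + 2 * q ≡ q * q + 1) (sym q≡suc[r])
      (solve 1 (λ r → r :* r :+ con 2 :* (con 1 :+ r) := (con 1 :+ r) :* (con 1 :+ r) :+ con 1) refl r)
    x¹⁵≡ : x ^ 15 ≡ x ^ 3 * (q * q * q)
    x¹⁵≡ = solve 1 (λ x → x :^ 15 := x :^ 3 :* (x :^ 4 :* x :^ 4 :* x :^ 4)) refl x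

  limit<bound : (limitNumerator ÷ℕ limitDenominator) ℚ.< densityBound x
  limit<bound = subst ((limitNumerator ÷ℕ limitDenominator) ℚ.<_) (sym densityBound≡)
    (÷-mono-< limitNumerator limitDenominator m (x ^ 5) {{ℕ.m*n≢0 2 (q ^ 5) {{_}} {{q^≢0 5}}}} {{x^≢0 5}} (begin-strict
      limitNumerator * x ^ 5      <⟨ ℕ.*-monoˡ-< (x ^ 5) {{x^≢0 5}} limitNumerator< ⟩
      2 * m * x ^ 15 * x ^ 5      ≡⟨ trans (ℕ.*-assoc (2 * m) (x ^ 15) (x ^ 5)) (cong (2 * m *_) (sym (ℕ.^-distribˡ-+-* x 15 5))) ⟩
      2 * m * x ^ 20              ≡⟨ cong (2 * m *_) (sym (ℕ.^-*-assoc x 4 5)) ⟩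
      2 * m * q ^ 5               ≡⟨ solve 2 (λ m z → con 2 :* m :* z := m :* (con 2 :* z)) refl m (q ^ 5) ⟩
      m * limitDenominator        ∎))
    where open ℕ.≤-Reasoning

  liminf : LiminfBelow (density x) (densityBound x)
  liminf = (limitNumerator ÷ℕ limitDenominator) , limit<bound ,
    -- The estimate is available from t = 2 on.
    λ N → suc (suc N) , ℕ.≤-trans (ℕ.n≤1+n N) (ℕ.n≤1+n (suc N)) , s≤s z≤n , density≤ N

theorem12 : (q′ : ℕ) → IsPrimePower q′ →
    ((F : Field 0ℓ 0ℓ) → HasCard F (q′ ^ 4) →
    (t : ℕ) → 1 ≤ t →
    Codes.CodeWithCoveringRadius F (lengthN q′ t) (2 * t + 1) 2)
    × LiminfBelow (density q′) (densityBound q′)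
theorem12 q′ (p , k , pr , 1≤k , refl) =
  (λ F card → Construction.coveringCode pr 1≤k F card) , Density.liminf (primePower>1 pr 1≤k)
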